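{- If a type-2 functional $\Psi$ is in $\mathrm{BFF}_2$, then there exists a finite orthogonal STRS $\mathcal{R}$ such that the distinguished symbol $\mathsf{F}$ computes $\Psi$ in $\mathcal{R}$ and $\mathcal{R}$ admits a polynomially bounded cost-size interpretation.
   Context: Type-2 complexity. $W=\{0,1\}^*$, $|w|$ its length; type-1 functions $W\to W$; type-2 functionals of rank $(k,l)$: $(W\to W)^k\to W^l\to W$; $|f|(n)=\max_{|y|\le n}|f(y)|$. OTMs: deterministic multi-tape Turing machines with a main tape and, per oracle $i$, a query tape, answer tape, query state $q_i$ and answer state $a_i$; entering $q_i$ moves in one step to $a_i$ with the answer tape containing $f_i(u)$, $u$ the (then erased) query-tape content. An OTM computes $\Psi$ if started with $x_1..x_l$ on its main tape and oracles $f_1..f_k$ it halts with $\Psi(\vec f,\vec x)$ on its main tape. Second-order polynomials: $P::=n\mid x\mid P+P\mid P*P\mid F(P)$. $\Psi\in\mathrm{BFF}_2$ iff some OTM computes $\Psi$ within time $P(|f_1|,..,|f_k|,|x_1|,..,|x_l|)$ for a second-order polynomial $P$. STRS: typed applicative terms, function symbols of type order $\le2$; rules $\ell\to r$ of base type, $\ell=\mathsf{f}\,\ell_1..\ell_m$, $\mathrm{vars}(r)\subseteq\mathrm{vars}(\ell)$; innermost rewriting; orthogonal = left-linear with no two distinct rules having left-hand sides with a common instance. Cost-size interpretations: quasi-ordered sets $\mathcal{S}_\iota$ per base type, pointwise-ordered monotone function spaces at arrows; cost sets $\mathcal{C}_\kappa=\mathbb{N}$, $\mathcal{C}_{\iota\Rightarrow\tau}=\mathcal{S}_\iota\Longrightarrow\mathcal{C}_\tau$,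 $\mathcal{C}_{\sigma\Rightarrow\tau}=\mathcal{C}_\sigma\Longrightarrow\mathcal{S}_\sigma\Longrightarrow\mathcal{C}_\tau$ ($\mathrm{ord}\sigma=1$); symbols get size $\mathcal{J}^{\mathsf{s}}$ and cost $\mathcal{J}^{\mathsf{c}}$; term size compositional; cost of $\mathsf{f}\,s_1..s_k\,t_1..t_n$ is $\mathcal{J}^{\mathsf{c}}_{\mathsf{f}}$ applied to cost and size of each order-1 argument and sizes of base-type arguments, cost of $x\,\vec s$ is $\zeta(x)$ of the sizes; compatible iff for every rule and all valuations, cost of $\ell$ $>$ sum of costs of non-variable base-type subterms of $r$, and size of $\ell\sqsupseteq$ size of $r$. Encoding: $\mathsf{o},\mathsf{i}:\mathsf{bit}$, $[]:\mathsf{word}$, $::\ :\mathsf{bit}\Rightarrow\mathsf{word}\Rightarrow\mathsf{word}$, words as lists $\underline{w}$; distinguished $\mathsf{F}:(\mathsf{word}\Rightarrow\mathsf{word})^k\Rightarrow\mathsf{word}^l\Rightarrow\mathsf{word}$. For $f$, fresh $\mathsf{S}_f:\mathsf{word}\Rightarrow\mathsf{word}$ with rules $\mathcal{R}_f=\{\mathsf{S}_f\,\underline{u}\to\underline{f(u)}\mid u\in W\}$; $\mathcal{R}_{+\vec f}=\mathcal{R}\cup\bigcup_i\mathcal{R}_{f_i}$. $\mathsf{F}$ computes $\Psi$ iff $\mathsf{F}\,\mathsf{S}_{f_1}..\mathsf{S}_{f_k}\,\underline{w_1}..\underline{w_l}\to^+_{\mathcal{R}_{+\vec f}}\underline{\Psi(\vec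 f,\vec w)}$ for all $\vec f,\vec w$. Polynomially bounded interpretation: compatible, $\mathcal{S}_{\mathsf{word}}=(\mathbb{N},\ge)$, costs of $\mathsf{o},\mathsf{i},[]$ zero, $\mathcal{J}^{\mathsf{c}}_{::}=\lambda xy.0$, $\mathcal{J}^{\mathsf{s}}_{::}=\lambda xy.x+y+c$ for some $c\ge1$, and $\mathcal{J}^{\mathsf{c}}_{\mathsf{F}}$ bounded by a second-order polynomial in $F_1^{\mathsf{c}},F_1^{\mathsf{s}},..,F_k^{\mathsf{c}},F_k^{\mathsf{s}};x_1..x_l$. -}

module Defs where

open import Data.Nat using (ℕ; zero; suc; _+_; _*_; _≤_; _<_; _≥_; _⊔_)
open import Data.Nat.Properties using (≤-refl; ≤-trans)
open import Data.Bool using (Bool; true; false)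
open import Data.Fin using (Fin; zero; suc; toℕ)
open import Data.List using (List; []; _∷_; _++_; length; map; foldr; concatMap; reverse; replicate; intercalate; mapMaybe)
open import Data.List.Membership.Propositional using (_∈_)
open import Data.Vec using (Vec; []; _∷_; lookup; tabulate; toList; _[_]≔_) renaming (map to vmap; _++_ to _v++_)
open import Data.Maybe using (Maybe; just; nothing)
open import Data.Product using (Σ; _×_; _,_; proj₁; proj₂; ∃)
open import Data.Sum using (_⊎_; inj₁; inj₂)
open import Data.Unit using (⊤)
open import Data.Empty using (⊥)
open import Relation.Nullary using (¬_)
open import Relation.Binary.PropositionalEquality using (_≡_; _≢_)

-- W = {0,1}^* ; false = 0, true = 1 ; |w| = length w
W : Set
W = List Bool

wordsOfLen : ℕ → List W
wordsOfLen zero    = [] ∷ []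
wordsOfLen (suc n) = concatMap (λ w → (false ∷ w) ∷ (true ∷ w) ∷ []) (wordsOfLen n)

wordsUpTo : ℕ → List W
wordsUpTo zero    = wordsOfLen zero
wordsUpTo (suc n) = wordsOfLen (suc n) ++ wordsUpTo n

∣_∣₁ : (W → W) → ℕ → ℕ
∣ f ∣₁ n = foldr _⊔_ 0 (map (λ y → length (f y)) (wordsUpTo n))

Functional : ℕ → ℕ → Set
Functional k l = Vec (W → W) k → Vec W l → W

data SOP (m l : ℕ) : Set where
  cst  : ℕ → SOP m l
  var  : Fin l → SOP m l
  _⊕_  : SOP m l → SOP m l → SOP m l
  _⊛_  : SOP m l → SOP m l → SOP m l
  fapp : Fin m → SOP m l → SOP m l

evalSOP : ∀ {m l} → SOP m l → Vec (ℕ → ℕ) m → Vec ℕ l → ℕ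
evalSOP (cst n)    F x = n
evalSOP (var j)    F x = lookup x j
evalSOP (P ⊕ Q)    F x = evalSOP P F x + evalSOP Q F x
evalSOP (P ⊛ Q)    F x = evalSOP P F x * evalSOP Q F x
evalSOP (fapp i P) F x = lookup F i (evalSOP P F x)

-- Oracle Turing machines
-- Tape alphabet Fin (4 + e): 0 = blank, 1 = bit 0, 2 = bit 1, 3 = separator,
-- the remaining e symbols are auxiliary.

Sym⊤ : ℕ → Set
Sym⊤ e = Fin (4 + e)

blank sep : ∀ {e} → Sym⊤ e
blank = zero
sep   = suc (suc (suc zero))

encBit : ∀ {e} → Bool → Sym⊤ e
encBit false = suc zero
encBit true  = suc (suc zero)

decBit : ∀ {e} → Sym⊤ e → Maybe Bool
decBit (suc zero)       = just false
decBit (suc (suc zero)) = just true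
decBit _                = nothing

-- two-way infinite tape: left part (reversed, nearest cell first) and
-- right part (first element is the scanned cell); blanks beyond.
record Tape (A : Set) : Set where
  constructor tape
  field
    lft : List A
    rgt : List A

data Move : Set where
  mL mR mN : Move

emptyTape : ∀ {A} → Tape A
emptyTape = tape [] []

content : ∀ {A} → Tape A → List A
content (tape l r) = reverse l ++ r

readT : ∀ {e} → Tape (Sym⊤ e) → Sym⊤ e
readT (tape l [])      = blank
readT (tape l (a ∷ r)) = a

writeT : ∀ {e} → Sym⊤ e → Tape (Sym⊤ e) → Tape (Sym⊤ e)
writeT a (tape l [])      = tape l (a ∷ [])
writeT a (tape l (_ ∷ r)) = tape l (a ∷ r)

moveT : ∀ {e} → Move → Tape (Sym⊤ e) → Tape (Sym⊤ e)
moveT mL (tape [] r)      = tape [] (blank ∷ r)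
moveT mL (tape (a ∷ l) r) = tape l (a ∷ r)
moveT mR (tape l [])      = tape (blank ∷ l) []
moveT mR (tape l (a ∷ r)) = tape (a ∷ l) r
moveT mN t                = t

act : ∀ {e} → Sym⊤ e × Move → Tape (Sym⊤ e) → Tape (Sym⊤ e)
act (a , d) t = moveT d (writeT a t)

data Ctrl (n k : ℕ) : Set where
  run  : Fin n → Ctrl n k
  ask  : Fin k → Ctrl n k
  stop : Ctrl n k

-- A deterministic OTM with k oracles: a main tape, w work tapes, and per
-- oracle a query tape and an answer tape.  δ is used in ordinary states.
record OTM (k : ℕ) : Set where
  field
    nStates  : ℕ
    nAux     : ℕ
    nWork    : ℕ
    start    : Fin nStates
    ansState : Fin k → Fin nStates
    δ        : Fin nStates →
               Sym⊤ nAux → Vec (Sym⊤ nAux) nWork → Vec (Sym⊤ nAux) k → Vec (Sym⊤ nAux) k →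
               Ctrl nStates k × (Sym⊤ nAux × Move) × Vec (Sym⊤ nAux × Move) nWork ×
               Vec (Sym⊤ nAux × Move) k × Vec (Sym⊤ nAux × Move) k

module _ {k : ℕ} (M : OTM k) where
  open OTM M

  record Config : Set where
    constructor cfg
    field
      ctrl  : Ctrl nStates k
      main  : Tape (Sym⊤ nAux)
      work  : Vec (Tape (Sym⊤ nAux)) nWork
      qry   : Vec (Tape (Sym⊤ nAux)) k
      ans   : Vec (Tape (Sym⊤ nAux)) k

  acts : ∀ {n} → Vec (Sym⊤ nAux × Move) n → Vec (Tape (Sym⊤ nAux)) n → Vec (Tape (Sym⊤ nAux)) n
  acts []       []       = []
  acts (a ∷ as) (t ∷ ts) = act a t ∷ acts as ts

  stepM : Vec (W → W) k → Config → Config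
  stepM fs (cfg stop m ws qs as) = cfg stop m ws qs as
  stepM fs (cfg (ask i) m ws qs as) =
    let u = mapMaybe decBit (content (lookup qs i)) in
    cfg (run (ansState i)) m ws (qs [ i ]≔ emptyTape)
        (as [ i ]≔ tape [] (map encBit (lookup fs i u)))
  stepM fs (cfg (run s) m ws qs as) with δ s (readT m) (vmap readT ws) (vmap readT qs) (vmap readT as)
  ... | c , a , aw , aq , aa = cfg c (act a m) (acts aw ws) (acts aq qs) (acts aa as)

  stepsM : Vec (W → W) k → ℕ → Config → Config
  stepsM fs zero    c = c
  stepsM fs (suc t) c = stepsM fs t (stepM fs c)

  initM : ∀ {l} → Vec W l → Config
  initM xs = cfg (run start)
                 (tape [] (intercalate (sep ∷ []) (map (map encBit) (toList xs))))
                 (tabulate (λ _ → emptyTape)) (tabulate (λ _ → emptyTape)) (tabulate (λ _ → emptyTape))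

  Holds : Tape (Sym⊤ nAux) → W → Set
  Holds t w = Σ ℕ λ a → Σ ℕ λ b → content t ≡ replicate a blank ++ map encBit w ++ replicate b blank

  HaltsWithin : Vec (W → W) k → ∀ {l} → Vec W l → ℕ → W → Set
  HaltsWithin fs xs T w = Σ ℕ λ t → t ≤ T ×
    (Config.ctrl (stepsM fs t (initM xs)) ≡ stop × Holds (Config.main (stepsM fs t (initM xs))) w)

BFF₂ : ∀ {k l} → Functional k l → Set
BFF₂ {k} {l} Ψ = Σ (OTM k) λ M → Σ (SOP k l) λ P →
  ∀ (fs : Vec (W → W) k) (xs : Vec W l) →
    HaltsWithin M fs xs (evalSOP P (vmap ∣_∣₁ fs) (vmap length xs)) (Ψ fs xs)

data Sort (b : ℕ) : Set where
  bitS wordS : Sort b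
  ext        : Fin b → Sort b

infixr 5 _⇒_
data Ty (b : ℕ) : Set where
  base : Sort b → Ty b
  _⇒_  : Ty b → Ty b → Ty b

ord : ∀ {b} → Ty b → ℕ
ord (base _) = 0
ord (σ ⇒ τ)  = suc (ord σ) ⊔ ord τ

data Var {b} : List (Ty b) → Ty b → Set where
  vz : ∀ {Γ σ} → Var (σ ∷ Γ) σ
  vs : ∀ {Γ σ ρ} → Var Γ σ → Var (ρ ∷ Γ) σ

varIdx : ∀ {b Γ σ} → Var {b} Γ σ → ℕ
varIdx vz     = zero
varIdx (vs x) = suc (varIdx x)

data Tm {b} {A : Set} (τ : A → Ty b) (Γ : List (Ty b)) : Ty b → Set where
  var : ∀ {σ} → Var Γ σ → Tm τ Γ σ
  sym : (f : A) → Tm τ Γ (τ f)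
  app : ∀ {σ ρ} → Tm τ Γ (σ ⇒ ρ) → Tm τ Γ σ → Tm τ Γ ρ

module _ {b} {A : Set} {τ : A → Ty b} where

  Subst : List (Ty b) → List (Ty b) → Set
  Subst Γ Δ = ∀ {σ} → Var Γ σ → Tm τ Δ σ

  subst : ∀ {Γ Δ σ} → Subst Γ Δ → Tm τ Γ σ → Tm τ Δ σ
  subst γ (var x)   = γ x
  subst γ (sym f)   = sym f
  subst γ (app s t) = app (subst γ s) (subst γ t)

  occ : ∀ {Γ σ} → ℕ → Tm τ Γ σ → ℕ
  occ n (var x) with varIdx x Data.Nat.≟ n
  ... | Relation.Nullary.yes _ = 1
  ... | Relation.Nullary.no  _ = 0
  occ n (sym f)   = 0
  occ n (app s t) = occ n s + occ n t

  HeadIsSym : ∀ {Γ σ} → Tm τ Γ σ → Set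
  HeadIsSym (var x)   = ⊥
  HeadIsSym (sym f)   = ⊤
  HeadIsSym (app s t) = HeadIsSym s

  data _⊑_ {Γ} : ∀ {ρ σ} → Tm τ Γ ρ → Tm τ Γ σ → Set where
    here  : ∀ {σ} {t : Tm τ Γ σ} → t ⊑ t
    sleft  : ∀ {ρ σ σ'} {s : Tm τ Γ ρ} {f : Tm τ Γ (σ' ⇒ σ)} {t} → s ⊑ f → s ⊑ app f t
    sright : ∀ {ρ σ σ'} {s : Tm τ Γ ρ} {f : Tm τ Γ (σ' ⇒ σ)} {t} → s ⊑ t → s ⊑ app f t

  data _⊏_ {Γ} : ∀ {ρ σ} → Tm τ Γ ρ → Tm τ Γ σ → Set where
    pleft  : ∀ {ρ σ σ'} {s : Tm τ Γ ρ} {f : Tm τ Γ (σ' ⇒ σ)} {t} → s ⊑ f → s ⊏ app f t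
    pright : ∀ {ρ σ σ'} {s : Tm τ Γ ρ} {f : Tm τ Γ (σ' ⇒ σ)} {t} → s ⊑ t → s ⊏ app f t

  record Rule : Set where
    field
      ctx     : List (Ty b)
      sort    : Sort b
      lhs     : Tm τ ctx (base sort)
      rhs     : Tm τ ctx (base sort)
      headSym : HeadIsSym lhs
      varsOK  : ∀ n → 0 < occ n rhs → 0 < occ n lhs
  open Rule public

  LeftLinear : Rule → Set
  LeftLinear ρ = ∀ n → occ n (lhs ρ) ≤ 1

  CommonInstance : Rule → Rule → Set
  CommonInstance ρ₁ ρ₂ = Σ (List (Ty b)) λ Δ →
    Σ (Subst (ctx ρ₁) Δ) λ γ₁ → Σ (Subst (ctx ρ₂) Δ) λ γ₂ →
      _≡_ {A = Σ (Sort b) λ ι → Tm τ Δ (base ι)}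
          (sort ρ₁ , subst γ₁ (lhs ρ₁)) (sort ρ₂ , subst γ₂ (lhs ρ₂))

  Orthogonal : List Rule → Set
  Orthogonal rs = (∀ {ρ} → ρ ∈ rs → LeftLinear ρ) ×
    (∀ (i j : Fin (length rs)) → i ≢ j →
       ¬ CommonInstance (Data.List.lookup rs i) (Data.List.lookup rs j))

data Sym (m : ℕ) : Set where
  o i nil cons F : Sym m
  usr : Fin m → Sym m

WTy : ∀ {b} → ℕ → Ty b
WTy zero    = base wordS
WTy (suc l) = base wordS ⇒ WTy l

FTy : ∀ {b} → ℕ → ℕ → Ty b
FTy zero    l = WTy l
FTy (suc k) l = (base wordS ⇒ base wordS) ⇒ FTy k l

symType : ∀ {b m} (k l : ℕ) → (Fin m → Ty b) → Sym m → Ty b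
symType k l u o        = base bitS
symType k l u i        = base bitS
symType k l u nil      = base wordS
symType k l u cons     = base bitS ⇒ base wordS ⇒ base wordS
symType k l u F        = FTy k l
symType k l u (usr j)  = u j

record STRS (k l : ℕ) : Set where
  field
    nSorts  : ℕ
    nSyms   : ℕ
    userTy  : Fin nSyms → Ty nSorts
    userOrd : ∀ j → ord (userTy j) ≤ 2
    rules   : List (Rule {τ = symType k l userTy})
open STRS public

-- the signature extended by S_{f₁} … S_{f_k} : word ⇒ word
extType : ∀ {k l} (R : STRS k l) → Sym (nSyms R) ⊎ Fin k → Ty (nSorts R)
extType {k} {l} R (inj₁ f) = symType k l (userTy R) f
extType R (inj₂ _) = base wordS ⇒ base wordS

module _ {k l : ℕ} (R : STRS k l) where

  TmE : List (Ty (nSorts R)) → Ty (nSorts R) → Set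
  TmE = Tm (extType R)

  emb : ∀ {Γ σ} → Tm (symType k l (userTy R)) Γ σ → TmE Γ σ
  emb (var x)   = var x
  emb (sym f)   = sym (inj₁ f)
  emb (app s t) = app (emb s) (emb t)

  bitTm : Bool → TmE [] (base bitS)
  bitTm false = sym (inj₁ o)
  bitTm true  = sym (inj₁ i)

  wordTm : W → TmE [] (base wordS)
  wordTm []      = sym (inj₁ nil)
  wordTm (c ∷ w) = app (app (sym (inj₁ cons)) (bitTm c)) (wordTm w)

  module _ (fs : Vec (W → W) k) where

    data RootStep : ∀ {σ} → TmE [] σ → TmE [] σ → Set where
      byRule   : ∀ {ρ} → ρ ∈ rules R → (γ : Subst {τ = extType R} (ctx ρ) []) →
                 RootStep (subst γ (emb (lhs ρ))) (subst γ (emb (rhs ρ)))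
      byOracle : ∀ (j : Fin k) (u : W) →
                 RootStep (app (sym (inj₂ j)) (wordTm u)) (wordTm (lookup fs j u))

    Redex : ∀ {σ} → TmE [] σ → Set
    Redex t = Σ _ λ u → RootStep t u

    NF : ∀ {σ} → TmE [] σ → Set
    NF t = ∀ {ρ} (s : TmE [] ρ) → s ⊑ t → ¬ Redex s

    data _⟶_ : ∀ {σ} → TmE [] σ → TmE [] σ → Set where
      root : ∀ {σ} {t u : TmE [] σ} → RootStep t u → (∀ {ρ} (s : TmE [] ρ) → s ⊏ t → NF s) → t ⟶ u
      appL : ∀ {σ ρ} {s s' : TmE [] (σ ⇒ ρ)} {t} → s ⟶ s' → app s t ⟶ app s' t
      appR : ∀ {σ ρ} {s : TmE [] (σ ⇒ ρ)} {t t'} → t ⟶ t' → app s t ⟶ app s t'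

    data _⟶⁺_ {σ} : TmE [] σ → TmE [] σ → Set where
      [_] : ∀ {t u} → t ⟶ u → t ⟶⁺ u
      _∷_ : ∀ {t u v} → t ⟶ u → u ⟶⁺ v → t ⟶⁺ v

  applyArgs : ∀ {Γ} {n m} → TmE Γ (FTy n m) → Vec (TmE Γ (base wordS ⇒ base wordS)) n →
              Vec (TmE Γ (base wordS)) m → TmE Γ (base wordS)
  applyArgs {m = zero}  t []       []       = t
  applyArgs {m = suc m} t []       (w ∷ ws) = applyArgs {m = m} (app t w) [] ws
  applyArgs             t (s ∷ ss) ws       = applyArgs (app t s) ss ws

  Computes : Functional k l → Set
  Computes Ψ = ∀ (fs : Vec (W → W) k) (ws : Vec W l) →
    _⟶⁺_ fs (applyArgs (sym (inj₁ F)) (tabulate (λ j → sym (inj₂ j))) (vmap wordTm ws))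
            (wordTm (Ψ fs ws))

record QO : Set₁ where
  field
    Car    : Set
    _⊒_    : Car → Car → Set
    ⊒-refl  : ∀ x → x ⊒ x
    ⊒-trans : ∀ {x y z} → x ⊒ y → y ⊒ z → x ⊒ z
open QO public

ℕ≥ : QO
ℕ≥ = record { Car = ℕ ; _⊒_ = _≥_ ; ⊒-refl = λ x → ≤-refl ; ⊒-trans = λ p q → ≤-trans q p }

_⟹_ : QO → QO → QO
A ⟹ B = record
  { Car    = Σ (Car A → Car B) (λ f → ∀ {x y} → _⊒_ A x y → _⊒_ B (f x) (f y))
  ; _⊒_    = λ f g → ∀ x → _⊒_ B (proj₁ f x) (proj₁ g x)
  ; ⊒-refl  = λ f x → ⊒-refl B (proj₁ f x)
  ; ⊒-trans = λ p q x → ⊒-trans B (p x) (q x)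
  }

module _ {b : ℕ} (Sb : Sort b → QO) where

  𝒮 : Ty b → QO
  𝒮 (base ι) = Sb ι
  𝒮 (σ ⇒ τ)  = 𝒮 σ ⟹ 𝒮 τ

  𝒞 : Ty b → QO
  𝒞 (base ι)          = ℕ≥
  𝒞 (base ι ⇒ τ)      = 𝒮 (base ι) ⟹ 𝒞 τ
  𝒞 ((σ₁ ⇒ σ₂) ⇒ τ)   = 𝒞 (σ₁ ⇒ σ₂) ⟹ (𝒮 (σ₁ ⇒ σ₂) ⟹ 𝒞 τ)

  capp : ∀ σ {ρ} → Car (𝒞 (σ ⇒ ρ)) → Car (𝒞 σ) → Car (𝒮 σ) → Car (𝒞 ρ)
  capp (base ι)  f c s = proj₁ f s
  capp (σ₁ ⇒ σ₂) f c s = proj₁ (proj₁ f c) s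

  baseCost : ∀ σ → Car (𝒞 σ) → ℕ
  baseCost (base ι) n = n
  baseCost (_ ⇒ _)  _ = 0

  module _ {A : Set} {τ : A → Ty b}
           (Js : (f : A) → Car (𝒮 (τ f))) (Jc : (f : A) → Car (𝒞 (τ f)))
           {Γ : List (Ty b)}
           (α : ∀ {σ} → Var Γ σ → Car (𝒮 σ)) (ζ : ∀ {σ} → Var Γ σ → Car (𝒞 σ)) where

    size : ∀ {σ} → Tm τ Γ σ → Car (𝒮 σ)
    size (var x)   = α x
    size (sym f)   = Js f
    size (app s t) = proj₁ (size s) (size t)

    cost : ∀ {σ} → Tm τ Γ σ → Car (𝒞 σ)
    cost (var x)           = ζ x
    cost (sym f)           = Jc f
    cost (app {σ} s t)     = capp σ (cost s) (cost t) (size t)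

    sumCost : ∀ {σ} → Tm τ Γ σ → ℕ
    sumCost (var x)           = 0
    sumCost {σ} (sym f)       = baseCost σ (cost (sym f))
    sumCost {σ} (app s t)     = baseCost σ (cost (app s t)) + sumCost s + sumCost t

  Compatible : {A : Set} {τ : A → Ty b}
               (Js : (f : A) → Car (𝒮 (τ f))) (Jc : (f : A) → Car (𝒞 (τ f))) → Rule {τ = τ} → Set
  Compatible Js Jc ρ =
    ∀ (α : ∀ {σ} → Var (ctx ρ) σ → Car (𝒮 σ)) (ζ : ∀ {σ} → Var (ctx ρ) σ → Car (𝒞 σ)) →
      sumCost Js Jc α ζ (rhs ρ) < cost Js Jc α ζ (lhs ρ) ×
      _⊒_ (Sb (sort ρ)) (size Js Jc α ζ (lhs ρ)) (size Js Jc α ζ (rhs ρ))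

sortQO : ∀ {b} → (Fin b → QO) → Sort b → QO
sortQO E bitS    = ℕ≥
sortQO E wordS   = ℕ≥
sortQO E (ext j) = E j

Mono : Set
Mono = Σ (ℕ → ℕ) (λ f → ∀ {x y} → x ≥ y → f x ≥ f y)

module _ {b : ℕ} (E : Fin b → QO) where

  applyW : ∀ l → Car (𝒞 (sortQO E) (WTy l)) → Vec ℕ l → ℕ
  applyW zero    J []       = J
  applyW (suc l) J (x ∷ xs) = applyW l (proj₁ J x) xs

  applyF : ∀ k l → Car (𝒞 (sortQO E) (FTy k l)) → Vec Mono k → Vec Mono k → Vec ℕ l → ℕ
  applyF zero    l J []       []       xs = applyW l J xs
  applyF (suc k) l J (c ∷ cs) (s ∷ ss) xs = applyF k l (proj₁ (proj₁ J c) s) cs ss xs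

record PolyBoundedInterp {k l : ℕ} (R : STRS k l) : Set₁ where
  field
    extraQO : Fin (nSorts R) → QO
  Sb = sortQO extraQO
  τ  = symType k l (userTy R)
  field
    Js : (f : Sym (nSyms R)) → Car (𝒮 Sb (τ f))
    Jc : (f : Sym (nSyms R)) → Car (𝒞 Sb (τ f))
    compatible : ∀ {ρ} → ρ ∈ rules R → Compatible Sb Js Jc ρ
    cost-o   : Jc o ≡ 0
    cost-i   : Jc i ≡ 0
    cost-nil : Jc nil ≡ 0
    cost-cons : ∀ x y → proj₁ (proj₁ (Jc cons) x) y ≡ 0
    c   : ℕ
    1≤c : 1 ≤ c
    size-cons : ∀ x y → proj₁ (proj₁ (Js cons) x) y ≡ x + y + c
    P : SOP (k + k) l
    boundF : ∀ (Fc Fs : Vec Mono k) (xs : Vec ℕ l) →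
      applyF extraQO k l (Jc F) Fc Fs xs ≤ evalSOP P (vmap proj₁ (Fc v++ Fs)) xs

{-# OPTIONS --safe #-}
module Submission where

-- The system runs the oracle machine step by step.  Before each step it compares the step counter m
-- with the time bound P, evaluated with |f|(n) replaced by the maximum of |f(u')| over the logged
-- queries u, where u' is u cut to length n.  The bound so obtained suffices: the machine cannot tell f
-- from the function that agrees with f on the log and is [] elsewhere, so once m reaches the bound it
-- has halted.  Cutting the queries makes the size of the bound exactly P(F^s, X), whatever the log
-- contains.  Hence r = P(F^s, X) - m bounds the number of remaining steps, the log and the tapes grow
-- by at most a constant K per step, and a run from total size s costs at most (r + 1) W(s + r K), with
-- W(s) a second-order polynomial bounding the cost of one step.
open import Defs
open import Data.Nat using (ℕ; zero; suc; _+_; _*_; _∸_; _≤_; _<_; _≥_; _⊔_; _≡ᵇ_; z≤n; s≤s)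
open import Data.Nat.Properties
open import Data.Nat.Tactic.RingSolver using (solve-∀)
open import Data.Bool using (Bool; true; false; _∧_; _∨_; not; T)
import Data.Bool.Properties as Boolₚ
open import Data.Bool.Properties using (T-∧; T-≡)
open import Data.Bool.ListAction using (all)
open import Data.Fin using (Fin; zero; suc; toℕ; #_; _↑ˡ_; _↑ʳ_)
open import Data.Fin.Properties using (toℕ-injective)
open import Data.List using (List; []; _∷_; _++_; length; map; reverse; replicate; mapMaybe; intercalate; foldr; allFin; cartesianProduct; cartesianProductWith)
open import Data.List.Properties using (∷-injective; mapMaybe-++; unfold-reverse; ++-assoc; ++-identityʳ; map-++; length-map; length-++; ≡-dec)
open import Data.List.Membership.Propositional using (_∈_)
open import Data.List.Membership.Propositional.Properties using (∈-lookup; ∈-map⁺; ∈-++⁺ˡ; ∈-++⁺ʳ; ∈-allFin; ∈-cartesianProduct⁺; ∈-cartesianProductWith⁺)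
import Data.List.Membership.DecPropositional as DecMembership
open import Data.List.Relation.Unary.Any using (here; there)
open import Data.List.Relation.Unary.All using (All; []; _∷_)
import Data.List.Relation.Unary.All as All
import Data.List.Relation.Unary.All.Properties as Allₚ
open import Data.List.Relation.Unary.AllPairs using (AllPairs; []; _∷_)
open import Data.List.Relation.Unary.Unique.Propositional using (Unique)
import Data.List.Relation.Unary.Unique.Propositional.Properties as Uniqueₚ
open import Data.Vec using (Vec; []; _∷_; lookup; toList; tabulate; _[_]≔_) renaming (map to vmap; _++_ to _v++_; allFin to vallFin)
open import Data.Vec.Properties using (length-toList; lookup-map; lookup∘tabulate; lookup-++ˡ; lookup-++ʳ; lookup-allFin)
open import Data.Sum using (_⊎_; inj₁; inj₂)
open import Data.Unit using (⊤; tt)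
open import Data.Empty using (⊥; ⊥-elim)
open import Data.Product using (Σ; _×_; _,_; proj₁; proj₂)
open import Function using (_∘_)
open import Function.Bundles using (Equivalence)
open import Relation.Nullary using (¬_; Dec; yes; no)
open import Relation.Binary.Construct.Closure.ReflexiveTransitive using (Star; ε; _◅_; _◅◅_; gmap)
open import Relation.Binary.PropositionalEquality using (_≡_; _≢_; refl; cong; cong₂; trans) renaming (sym to ≡sym; subst to ≡subst; subst₂ to ≡subst₂)

-- Signature and rules

-- Compatibility must hold for every valuation, hence also for terms that no run produces. The known
-- running time of `M` cannot be invoked there, so the clock is computed inside the system and a
-- step is taken only while it is positive. The obstacle to constant growth is an oracle answer: it
-- may be as long as F^s of the current size, and counting it would iterate F^s once per query,
-- which no second-order polynomial bounds. But only the main tape and the query tapes are ever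
-- turned back into words. Answer and work tapes are merely scanned symbol by symbol, and symbols
-- have no size. A flag on each tape therefore makes the contents count or not, and a head lengthens
-- a counted tape by at most two cells per step. Likewise a logged query counts as one whatever its
-- length, because it is used only after being cut. Apart from those of `F` and `deltaᵘ`, the
-- left-hand sides depend neither on the machine nor on k and l, so linearity and absence of
-- overlaps are decided by evaluation.

data U : Set where
  leafᵘ pairᵘ nilᵘ cellᵘ tapeᵘ tapesᵘ histᵘ zeroᵘ sucᵘ : U
  addᵘ mulᵘ maxᵘ truncᵘ subᵘ lookᵘ pushᵘ declᵘ decrᵘ decᵘ : U
  readᵘ readsᵘ tailᵘ actᵘ actsᵘ nthᵘ updᵘ encᵘ deltaᵘ : U
  combᵘ noneᵘ execᵘ checkᵘ stepᵘ askᵘ : U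

symbols : Vec U 34
symbols =
  leafᵘ ∷ pairᵘ ∷ nilᵘ ∷ cellᵘ ∷ tapeᵘ ∷ tapesᵘ ∷ histᵘ ∷ zeroᵘ ∷ sucᵘ ∷
  addᵘ ∷ mulᵘ ∷ maxᵘ ∷ truncᵘ ∷ subᵘ ∷ lookᵘ ∷ pushᵘ ∷ declᵘ ∷ decrᵘ ∷ decᵘ ∷
  readᵘ ∷ readsᵘ ∷ tailᵘ ∷ actᵘ ∷ actsᵘ ∷ nthᵘ ∷ updᵘ ∷ encᵘ ∷ deltaᵘ ∷
  combᵘ ∷ noneᵘ ∷ execᵘ ∷ checkᵘ ∷ stepᵘ ∷ askᵘ ∷ []

-- `lookup symbols` undoes `code` by evaluation, so for each concrete `u` the type
-- `userType (code u)` of `⟨ u ⟩` reduces to `ty u`, while `STRS` still receives symbols indexed by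
-- a `Fin`.
code : U → Fin 34
code leafᵘ  = # 0
code pairᵘ  = # 1
code nilᵘ   = # 2
code cellᵘ  = # 3
code tapeᵘ  = # 4
code tapesᵘ = # 5
code histᵘ  = # 6
code zeroᵘ  = # 7
code sucᵘ   = # 8
code addᵘ   = # 9
code mulᵘ   = # 10
code maxᵘ   = # 11
code truncᵘ = # 12
code subᵘ   = # 13
code lookᵘ  = # 14
code pushᵘ  = # 15
code declᵘ  = # 16
code decrᵘ  = # 17
code decᵘ   = # 18
code readᵘ  = # 19
code readsᵘ = # 20
code tailᵘ  = # 21
code actᵘ   = # 22
code actsᵘ  = # 23
code nthᵘ   = # 24
code updᵘ   = # 25
code encᵘ   = # 26
code deltaᵘ = # 27
code combᵘ  = # 28
code noneᵘ  = # 29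
code execᵘ  = # 30
code checkᵘ = # 31
code stepᵘ  = # 32
code askᵘ   = # 33

-- 𝕊 carries finite control information, 𝔻 tapes, lists of actions and the query log,
-- ℂ the step counter.  The k oracles are passed around as one function of type 𝕊𝕎𝕎,
-- built with combᵘ; its 𝕊 argument is the index of the oracle.
𝕎 𝔹 𝕊 𝔻 ℂ 𝕎𝕎 𝕊𝕎𝕎 : Ty 3
𝕎 = base wordS
𝔹 = base bitS
𝕊 = base (ext zero)
𝔻 = base (ext (suc zero))
ℂ = base (ext (suc (suc zero)))
𝕎𝕎 = 𝕎 ⇒ 𝕎
𝕊𝕎𝕎 = 𝕊 ⇒ 𝕎 ⇒ 𝕎

ty : U → Ty 3
ty leafᵘ  = 𝕊
ty pairᵘ  = 𝕊 ⇒ 𝕊 ⇒ 𝕊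
ty nilᵘ   = 𝔻
ty cellᵘ  = 𝕊 ⇒ 𝔻 ⇒ 𝔻
ty tapeᵘ  = 𝔻 ⇒ 𝔻 ⇒ 𝔻 ⇒ 𝔻
ty tapesᵘ = 𝔻 ⇒ 𝔻 ⇒ 𝔻
ty histᵘ  = 𝕎 ⇒ 𝔻 ⇒ 𝔻
ty zeroᵘ  = ℂ
ty sucᵘ   = ℂ ⇒ ℂ
ty addᵘ   = 𝕎 ⇒ 𝕎 ⇒ 𝕎
ty mulᵘ   = 𝕎 ⇒ 𝕎 ⇒ 𝕎
ty maxᵘ   = 𝕎 ⇒ 𝕎 ⇒ 𝕎
ty truncᵘ = 𝕎 ⇒ 𝕎 ⇒ 𝕎
ty subᵘ   = 𝕎 ⇒ ℂ ⇒ 𝕎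
ty lookᵘ  = 𝕊𝕎𝕎 ⇒ 𝔻 ⇒ 𝕊 ⇒ 𝕎 ⇒ 𝕎
ty pushᵘ  = 𝕊 ⇒ 𝕎 ⇒ 𝕎
ty declᵘ  = 𝔻 ⇒ 𝕎
ty decrᵘ  = 𝔻 ⇒ 𝕎 ⇒ 𝕎
ty decᵘ   = 𝔻 ⇒ 𝕎
ty readᵘ  = 𝔻 ⇒ 𝕊
ty readsᵘ = 𝔻 ⇒ 𝕊
ty tailᵘ  = 𝔻 ⇒ 𝔻
ty actᵘ   = 𝕊 ⇒ 𝔻 ⇒ 𝔻
ty actsᵘ  = 𝔻 ⇒ 𝔻 ⇒ 𝔻
ty nthᵘ   = 𝕊 ⇒ 𝔻 ⇒ 𝔻
ty updᵘ   = 𝕊 ⇒ 𝔻 ⇒ 𝔻 ⇒ 𝔻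
ty encᵘ   = 𝕎 ⇒ 𝔻 ⇒ 𝔻
ty deltaᵘ = 𝕊 ⇒ 𝔻
ty combᵘ  = 𝕎𝕎 ⇒ 𝕊𝕎𝕎 ⇒ 𝕊 ⇒ 𝕎 ⇒ 𝕎
ty noneᵘ  = 𝕊𝕎𝕎
ty execᵘ  = 𝕊𝕎𝕎 ⇒ 𝕎 ⇒ ℂ ⇒ 𝕊 ⇒ 𝔻 ⇒ 𝔻 ⇒ 𝕎
ty checkᵘ = 𝕊𝕎𝕎 ⇒ 𝕎 ⇒ ℂ ⇒ 𝕊 ⇒ 𝔻 ⇒ 𝔻 ⇒ 𝕎 ⇒ 𝕎
ty stepᵘ  = 𝕊𝕎𝕎 ⇒ 𝕎 ⇒ ℂ ⇒ 𝔻 ⇒ 𝔻 ⇒ 𝔻 ⇒ 𝕎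
ty askᵘ   = 𝕊𝕎𝕎 ⇒ 𝕎 ⇒ ℂ ⇒ 𝕊 ⇒ 𝔻 ⇒ 𝔻 ⇒ 𝕎 ⇒ 𝕎

isCtorU : U → Bool
isCtorU leafᵘ  = true
isCtorU pairᵘ  = true
isCtorU nilᵘ   = true
isCtorU cellᵘ  = true
isCtorU tapeᵘ  = true
isCtorU tapesᵘ = true
isCtorU histᵘ  = true
isCtorU zeroᵘ  = true
isCtorU sucᵘ   = true
isCtorU _      = false

isCtor : Sym 34 → Bool
isCtor o       = true
isCtor i       = true
isCtor nil     = true
isCtor cons    = true
isCtor F       = false
isCtor (usr j) = isCtorU (lookup symbols j)

-- `F` gets 4 and `deltaᵘ` gets 5 + 27 = 32. Both reappear as literals in `definedHead`, which
-- separates the other rules from the rules of these two symbols.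
symIndex : Sym 34 → ℕ
symIndex o       = 0
symIndex i       = 1
symIndex nil     = 2
symIndex cons    = 3
symIndex F       = 4
symIndex (usr j) = 5 + toℕ j

userType : Fin 34 → Ty 3
userType j = ty (lookup symbols j)

userType-ord : ∀ j → ord (userType j) ≤ 2
userType-ord j = go (lookup symbols j)
  where
  go : ∀ u → ord (ty u) ≤ 2
  go leafᵘ  = z≤n
  go pairᵘ  = s≤s z≤n
  go nilᵘ   = z≤n
  go cellᵘ  = s≤s z≤n
  go tapeᵘ  = s≤s z≤n
  go tapesᵘ = s≤s z≤n
  go histᵘ  = s≤s z≤n
  go zeroᵘ  = z≤n
  go sucᵘ   = s≤s z≤n
  go addᵘ   = s≤s z≤n
  go mulᵘ   = s≤s z≤n
  go maxᵘ   = s≤s z≤n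
  go truncᵘ = s≤s z≤n
  go subᵘ   = s≤s z≤n
  go lookᵘ  = s≤s (s≤s z≤n)
  go pushᵘ  = s≤s z≤n
  go declᵘ  = s≤s z≤n
  go decrᵘ  = s≤s z≤n
  go decᵘ   = s≤s z≤n
  go readᵘ  = s≤s z≤n
  go readsᵘ = s≤s z≤n
  go tailᵘ  = s≤s z≤n
  go actᵘ   = s≤s z≤n
  go actsᵘ  = s≤s z≤n
  go nthᵘ   = s≤s z≤n
  go updᵘ   = s≤s z≤n
  go encᵘ   = s≤s z≤n
  go deltaᵘ = s≤s z≤n
  go combᵘ  = s≤s (s≤s z≤n)
  go noneᵘ  = s≤s z≤n
  go execᵘ  = s≤s (s≤s z≤n)
  go checkᵘ = s≤s (s≤s z≤n)
  go stepᵘ  = s≤s (s≤s z≤n)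
  go askᵘ   = s≤s (s≤s z≤n)

infixl 9 _·_
pattern _·_ s t = app s t

data 𝕊V : Set where
  leaf : 𝕊V
  pair : 𝕊V → 𝕊V → 𝕊V

data 𝔻V : Set where
  nil   : 𝔻V
  cell  : 𝕊V → 𝔻V → 𝔻V
  tape  : 𝔻V → 𝔻V → 𝔻V → 𝔻V
  tapes : 𝔻V → 𝔻V → 𝔻V

num : ℕ → 𝕊V
num zero    = leaf
num (suc n) = pair leaf (num n)

-- The rules whose number depends neither on the machine nor on k and l. The rule of `F` and the
-- transition table of `deltaᵘ` are added in `R`.
data RuleName : Set where
  add-nil add-cons mul-nil mul-cons max-nil max-cons-nil max-cons : RuleName
  trunc-nil trunc-cons-nil trunc-o trunc-i sub-zero sub-nil sub-cons : RuleName
  look-nil look-cons push-0 push-1 push-2 push-3 decl-nil decl-cell decr-nil decr-cell dec-tape : RuleName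
  read-nil read-cell reads-nil reads-cons tail-nil tail-cell : RuleName
  act-left-nil act-left-cell act-right act-stay acts-nil acts-cons : RuleName
  nth-zero nth-suc upd-zero upd-suc enc-nil enc-o enc-i comb-zero comb-suc : RuleName
  exec-rule check-stop check-run check-ask step-rule ask-rule : RuleName

module Terms {k l : ℕ} where

  RTm : List (Ty 3) → Ty 3 → Set
  RTm = Tm (symType k l userType)

  ⟨_⟩ : ∀ {Γ} (u : U) → RTm Γ (userType (code u))
  ⟨ u ⟩ = sym (usr (code u))

  𝕊⟦_⟧ : ∀ {Γ} → 𝕊V → RTm Γ 𝕊
  𝕊⟦ leaf ⟧     = ⟨ leafᵘ ⟩
  𝕊⟦ pair a b ⟧ = ⟨ pairᵘ ⟩ · 𝕊⟦ a ⟧ · 𝕊⟦ b ⟧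

  𝔻⟦_⟧ : ∀ {Γ} → 𝔻V → RTm Γ 𝔻
  𝔻⟦ nil ⟧        = ⟨ nilᵘ ⟩
  𝔻⟦ cell a d ⟧   = ⟨ cellᵘ ⟩ · 𝕊⟦ a ⟧ · 𝔻⟦ d ⟧
  𝔻⟦ tape f x y ⟧ = ⟨ tapeᵘ ⟩ · 𝔻⟦ f ⟧ · 𝔻⟦ x ⟧ · 𝔻⟦ y ⟧
  𝔻⟦ tapes x y ⟧  = ⟨ tapesᵘ ⟩ · 𝔻⟦ x ⟧ · 𝔻⟦ y ⟧

  wlit : ∀ {Γ} → ℕ → RTm Γ 𝕎
  wlit zero    = sym nil
  wlit (suc n) = sym cons · sym o · wlit n

  v0 : ∀ {Γ a} → RTm (a ∷ Γ) a
  v0 = var vz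
  v1 : ∀ {Γ a b} → RTm (b ∷ a ∷ Γ) a
  v1 = var (vs vz)
  v2 : ∀ {Γ a b c} → RTm (c ∷ b ∷ a ∷ Γ) a
  v2 = var (vs (vs vz))
  v3 : ∀ {Γ a b c d} → RTm (d ∷ c ∷ b ∷ a ∷ Γ) a
  v3 = var (vs (vs (vs vz)))
  v4 : ∀ {Γ a b c d e} → RTm (e ∷ d ∷ c ∷ b ∷ a ∷ Γ) a
  v4 = var (vs (vs (vs (vs vz))))
  v5 : ∀ {Γ a b c d e f} → RTm (f ∷ e ∷ d ∷ c ∷ b ∷ a ∷ Γ) a
  v5 = var (vs (vs (vs (vs (vs vz)))))
  v6 : ∀ {Γ a b c d e f g} → RTm (g ∷ f ∷ e ∷ d ∷ c ∷ b ∷ a ∷ Γ) a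
  v6 = var (vs (vs (vs (vs (vs (vs vz))))))
  v7 : ∀ {Γ a b c d e f g h} → RTm (h ∷ g ∷ f ∷ e ∷ d ∷ c ∷ b ∷ a ∷ Γ) a
  v7 = var (vs (vs (vs (vs (vs (vs (vs vz)))))))
  v8 : ∀ {Γ a b c d e f g h i} → RTm (i ∷ h ∷ g ∷ f ∷ e ∷ d ∷ c ∷ b ∷ a ∷ Γ) a
  v8 = var (vs (vs (vs (vs (vs (vs (vs (vs vz))))))))
  v9 : ∀ {Γ a b c d e f g h i j} → RTm (j ∷ i ∷ h ∷ g ∷ f ∷ e ∷ d ∷ c ∷ b ∷ a ∷ Γ) a
  v9 = var (vs (vs (vs (vs (vs (vs (vs (vs (vs vz)))))))))
  v10 : ∀ {Γ a b c d e f g h i j k} → RTm (k ∷ j ∷ i ∷ h ∷ g ∷ f ∷ e ∷ d ∷ c ∷ b ∷ a ∷ Γ) a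
  v10 = var (vs (vs (vs (vs (vs (vs (vs (vs (vs (vs vz))))))))))

  -- Every input length is replaced by the one word `x`, later the concatenation of all inputs. This
  -- over-estimates `P`, which is harmless: the clock may run too long but not too short.
  bound : ∀ {Γ} → SOP k l → RTm Γ 𝕊𝕎𝕎 → RTm Γ 𝕎 → RTm Γ 𝔻 → RTm Γ 𝕎
  bound (cst n)    g x h = wlit n
  bound (var j)    g x h = x
  bound (P ⊕ Q)    g x h = ⟨ addᵘ ⟩ · bound P g x h · bound Q g x h
  bound (P ⊛ Q)    g x h = ⟨ mulᵘ ⟩ · bound P g x h · bound Q g x h
  bound (fapp j Q) g x h = ⟨ lookᵘ ⟩ · g · h · 𝕊⟦ num (toℕ j) ⟧ · bound Q g x h

  record Raw : Set where
    constructor _∙_⟶_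
    field
      rctx : List (Ty 3)
      {rsort} : Sort 3
      rlhs rrhs : RTm rctx (base rsort)
  open Raw public

  infix 2 _∙_⟶_

  -- The two flags have sizes 1 and 0, so that `keep` in the size of `tapeᵘ` can count or discard
  -- the contents of the tape.
  kept unkept : ∀ {Γ} → RTm Γ 𝔻
  kept   = ⟨ cellᵘ ⟩ · ⟨ leafᵘ ⟩ · ⟨ nilᵘ ⟩
  unkept = ⟨ nilᵘ ⟩

  raw : SOP k l → RuleName → Raw
  raw P add-nil = (𝕎 ∷ []) ∙
    ⟨ addᵘ ⟩ · sym nil · v0 ⟶ v0
  raw P add-cons = (𝔹 ∷ 𝕎 ∷ 𝕎 ∷ []) ∙
    ⟨ addᵘ ⟩ · (sym cons · v0 · v1) · v2 ⟶ sym cons · v0 · (⟨ addᵘ ⟩ · v1 · v2)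
  raw P mul-nil = (𝕎 ∷ []) ∙
    ⟨ mulᵘ ⟩ · sym nil · v0 ⟶ sym nil
  raw P mul-cons = (𝔹 ∷ 𝕎 ∷ 𝕎 ∷ []) ∙
    ⟨ mulᵘ ⟩ · (sym cons · v0 · v1) · v2 ⟶ ⟨ addᵘ ⟩ · v2 · (⟨ mulᵘ ⟩ · v1 · v2)
  raw P max-nil = (𝕎 ∷ []) ∙
    ⟨ maxᵘ ⟩ · sym nil · v0 ⟶ v0
  raw P max-cons-nil = (𝔹 ∷ 𝕎 ∷ []) ∙
    ⟨ maxᵘ ⟩ · (sym cons · v0 · v1) · sym nil ⟶ sym cons · v0 · v1
  -- The bit v0 may have positive size; with v0 instead of o the size would exceed the maximum.
  raw P max-cons = (𝔹 ∷ 𝕎 ∷ 𝔹 ∷ 𝕎 ∷ []) ∙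
    ⟨ maxᵘ ⟩ · (sym cons · v0 · v1) · (sym cons · v2 · v3) ⟶ sym cons · sym o · (⟨ maxᵘ ⟩ · v1 · v3)
  raw P trunc-nil = (𝕎 ∷ []) ∙
    ⟨ truncᵘ ⟩ · sym nil · v0 ⟶ sym nil
  raw P trunc-cons-nil = (𝔹 ∷ 𝕎 ∷ []) ∙
    ⟨ truncᵘ ⟩ · (sym cons · v0 · v1) · sym nil ⟶ sym nil
  -- One rule per bit, since the size of a bit variable is not bounded by the second argument.
  raw P trunc-o = (𝕎 ∷ 𝔹 ∷ 𝕎 ∷ []) ∙
    ⟨ truncᵘ ⟩ · (sym cons · sym o · v0) · (sym cons · v1 · v2) ⟶ sym cons · sym o · (⟨ truncᵘ ⟩ · v0 · v2)
  raw P trunc-i = (𝕎 ∷ 𝔹 ∷ 𝕎 ∷ []) ∙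
    ⟨ truncᵘ ⟩ · (sym cons · sym i · v0) · (sym cons · v1 · v2) ⟶ sym cons · sym i · (⟨ truncᵘ ⟩ · v0 · v2)
  raw P sub-zero = (𝕎 ∷ []) ∙
    ⟨ subᵘ ⟩ · v0 · ⟨ zeroᵘ ⟩ ⟶ v0
  raw P sub-nil = (ℂ ∷ []) ∙
    ⟨ subᵘ ⟩ · sym nil · (⟨ sucᵘ ⟩ · v0) ⟶ sym nil
  raw P sub-cons = (𝔹 ∷ 𝕎 ∷ ℂ ∷ []) ∙
    ⟨ subᵘ ⟩ · (sym cons · v0 · v1) · (⟨ sucᵘ ⟩ · v2) ⟶ ⟨ subᵘ ⟩ · v1 · v2
  raw P look-nil = (𝕊𝕎𝕎 ∷ 𝕊 ∷ 𝕎 ∷ []) ∙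
    ⟨ lookᵘ ⟩ · v0 · ⟨ nilᵘ ⟩ · v1 · v2 ⟶ sym nil
  raw P look-cons = (𝕊𝕎𝕎 ∷ 𝕎 ∷ 𝔻 ∷ 𝕊 ∷ 𝕎 ∷ []) ∙
    ⟨ lookᵘ ⟩ · v0 · (⟨ histᵘ ⟩ · v1 · v2) · v3 · v4
      ⟶ ⟨ maxᵘ ⟩ · (v0 · v3 · (⟨ truncᵘ ⟩ · v1 · v4)) · (⟨ lookᵘ ⟩ · v0 · v2 · v3 · v4)
  raw P push-0 = (𝕎 ∷ []) ∙
    ⟨ pushᵘ ⟩ · 𝕊⟦ num 0 ⟧ · v0 ⟶ v0
  raw P push-1 = (𝕎 ∷ []) ∙
    ⟨ pushᵘ ⟩ · 𝕊⟦ num 1 ⟧ · v0 ⟶ sym cons · sym o · v0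
  raw P push-2 = (𝕎 ∷ []) ∙
    ⟨ pushᵘ ⟩ · 𝕊⟦ num 2 ⟧ · v0 ⟶ sym cons · sym i · v0
  -- Three nested pairs match `num n` for every n ≥ 3: the separator and the auxiliary symbols are
  -- dropped, as in `decBit`.
  raw P push-3 = (𝕊 ∷ 𝕊 ∷ 𝕎 ∷ []) ∙
    ⟨ pushᵘ ⟩ · (⟨ pairᵘ ⟩ · ⟨ leafᵘ ⟩ · (⟨ pairᵘ ⟩ · ⟨ leafᵘ ⟩ · (⟨ pairᵘ ⟩ · v0 · v1))) · v2 ⟶ v2
  raw P decl-nil = [] ∙
    ⟨ declᵘ ⟩ · ⟨ nilᵘ ⟩ ⟶ sym nil
  raw P decl-cell = (𝕊 ∷ 𝔻 ∷ []) ∙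
    ⟨ declᵘ ⟩ · (⟨ cellᵘ ⟩ · v0 · v1) ⟶ ⟨ pushᵘ ⟩ · v0 · (⟨ declᵘ ⟩ · v1)
  raw P decr-nil = (𝕎 ∷ []) ∙
    ⟨ decrᵘ ⟩ · ⟨ nilᵘ ⟩ · v0 ⟶ v0
  raw P decr-cell = (𝕊 ∷ 𝔻 ∷ 𝕎 ∷ []) ∙
    ⟨ decrᵘ ⟩ · (⟨ cellᵘ ⟩ · v0 · v1) · v2 ⟶ ⟨ decrᵘ ⟩ · v1 · (⟨ pushᵘ ⟩ · v0 · v2)
  -- Only tapes with a nonempty flag are decoded: the contents of the others do not count for their size.
  raw P dec-tape = (𝕊 ∷ 𝔻 ∷ 𝔻 ∷ 𝔻 ∷ []) ∙
    ⟨ decᵘ ⟩ · (⟨ tapeᵘ ⟩ · (⟨ cellᵘ ⟩ · v0 · v1) · v2 · v3) ⟶ ⟨ decrᵘ ⟩ · v2 · (⟨ declᵘ ⟩ · v3)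
  raw P read-nil = (𝔻 ∷ 𝔻 ∷ []) ∙
    ⟨ readᵘ ⟩ · (⟨ tapeᵘ ⟩ · v0 · v1 · ⟨ nilᵘ ⟩) ⟶ ⟨ leafᵘ ⟩
  raw P read-cell = (𝔻 ∷ 𝔻 ∷ 𝕊 ∷ 𝔻 ∷ []) ∙
    ⟨ readᵘ ⟩ · (⟨ tapeᵘ ⟩ · v0 · v1 · (⟨ cellᵘ ⟩ · v2 · v3)) ⟶ v2
  raw P reads-nil = [] ∙
    ⟨ readsᵘ ⟩ · ⟨ nilᵘ ⟩ ⟶ ⟨ leafᵘ ⟩
  raw P reads-cons = (𝔻 ∷ 𝔻 ∷ []) ∙
    ⟨ readsᵘ ⟩ · (⟨ tapesᵘ ⟩ · v0 · v1) ⟶ ⟨ pairᵘ ⟩ · (⟨ readᵘ ⟩ · v0) · (⟨ readsᵘ ⟩ · v1)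
  raw P tail-nil = [] ∙
    ⟨ tailᵘ ⟩ · ⟨ nilᵘ ⟩ ⟶ ⟨ nilᵘ ⟩
  raw P tail-cell = (𝕊 ∷ 𝔻 ∷ []) ∙
    ⟨ tailᵘ ⟩ · (⟨ cellᵘ ⟩ · v0 · v1) ⟶ v1
  raw P act-left-nil = (𝕊 ∷ 𝔻 ∷ 𝔻 ∷ []) ∙
    ⟨ actᵘ ⟩ · (⟨ pairᵘ ⟩ · v0 · 𝕊⟦ num 0 ⟧) · (⟨ tapeᵘ ⟩ · v1 · ⟨ nilᵘ ⟩ · v2)
      ⟶ ⟨ tapeᵘ ⟩ · v1 · ⟨ nilᵘ ⟩ · (⟨ cellᵘ ⟩ · ⟨ leafᵘ ⟩ · (⟨ cellᵘ ⟩ · v0 · (⟨ tailᵘ ⟩ · v2)))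
  raw P act-left-cell = (𝕊 ∷ 𝔻 ∷ 𝕊 ∷ 𝔻 ∷ 𝔻 ∷ []) ∙
    ⟨ actᵘ ⟩ · (⟨ pairᵘ ⟩ · v0 · 𝕊⟦ num 0 ⟧) · (⟨ tapeᵘ ⟩ · v1 · (⟨ cellᵘ ⟩ · v2 · v3) · v4)
      ⟶ ⟨ tapeᵘ ⟩ · v1 · v3 · (⟨ cellᵘ ⟩ · v2 · (⟨ cellᵘ ⟩ · v0 · (⟨ tailᵘ ⟩ · v4)))
  raw P act-right = (𝕊 ∷ 𝔻 ∷ 𝔻 ∷ 𝔻 ∷ []) ∙
    ⟨ actᵘ ⟩ · (⟨ pairᵘ ⟩ · v0 · 𝕊⟦ num 1 ⟧) · (⟨ tapeᵘ ⟩ · v1 · v2 · v3)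
      ⟶ ⟨ tapeᵘ ⟩ · v1 · (⟨ cellᵘ ⟩ · v0 · v2) · (⟨ tailᵘ ⟩ · v3)
  raw P act-stay = (𝕊 ∷ 𝔻 ∷ 𝔻 ∷ 𝔻 ∷ []) ∙
    ⟨ actᵘ ⟩ · (⟨ pairᵘ ⟩ · v0 · 𝕊⟦ num 2 ⟧) · (⟨ tapeᵘ ⟩ · v1 · v2 · v3)
      ⟶ ⟨ tapeᵘ ⟩ · v1 · v2 · (⟨ cellᵘ ⟩ · v0 · (⟨ tailᵘ ⟩ · v3))
  raw P acts-nil = [] ∙
    ⟨ actsᵘ ⟩ · ⟨ nilᵘ ⟩ · ⟨ nilᵘ ⟩ ⟶ ⟨ nilᵘ ⟩
  raw P acts-cons = (𝕊 ∷ 𝔻 ∷ 𝔻 ∷ 𝔻 ∷ []) ∙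
    ⟨ actsᵘ ⟩ · (⟨ cellᵘ ⟩ · v0 · v1) · (⟨ tapesᵘ ⟩ · v2 · v3)
      ⟶ ⟨ tapesᵘ ⟩ · (⟨ actᵘ ⟩ · v0 · v2) · (⟨ actsᵘ ⟩ · v1 · v3)
  raw P nth-zero = (𝔻 ∷ 𝔻 ∷ []) ∙
    ⟨ nthᵘ ⟩ · ⟨ leafᵘ ⟩ · (⟨ tapesᵘ ⟩ · v0 · v1) ⟶ v0
  raw P nth-suc = (𝕊 ∷ 𝕊 ∷ 𝔻 ∷ 𝔻 ∷ []) ∙
    ⟨ nthᵘ ⟩ · (⟨ pairᵘ ⟩ · v0 · v1) · (⟨ tapesᵘ ⟩ · v2 · v3) ⟶ ⟨ nthᵘ ⟩ · v1 · v3
  raw P upd-zero = (𝔻 ∷ 𝔻 ∷ 𝔻 ∷ []) ∙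
    ⟨ updᵘ ⟩ · ⟨ leafᵘ ⟩ · v0 · (⟨ tapesᵘ ⟩ · v1 · v2) ⟶ ⟨ tapesᵘ ⟩ · v0 · v2
  raw P upd-suc = (𝕊 ∷ 𝕊 ∷ 𝔻 ∷ 𝔻 ∷ 𝔻 ∷ []) ∙
    ⟨ updᵘ ⟩ · (⟨ pairᵘ ⟩ · v0 · v1) · v2 · (⟨ tapesᵘ ⟩ · v3 · v4)
      ⟶ ⟨ tapesᵘ ⟩ · v3 · (⟨ updᵘ ⟩ · v1 · v2 · v4)
  raw P enc-nil = (𝔻 ∷ []) ∙
    ⟨ encᵘ ⟩ · sym nil · v0 ⟶ v0
  raw P enc-o = (𝕎 ∷ 𝔻 ∷ []) ∙
    ⟨ encᵘ ⟩ · (sym cons · sym o · v0) · v1 ⟶ ⟨ cellᵘ ⟩ · 𝕊⟦ num 1 ⟧ · (⟨ encᵘ ⟩ · v0 · v1)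
  raw P enc-i = (𝕎 ∷ 𝔻 ∷ []) ∙
    ⟨ encᵘ ⟩ · (sym cons · sym i · v0) · v1 ⟶ ⟨ cellᵘ ⟩ · 𝕊⟦ num 2 ⟧ · (⟨ encᵘ ⟩ · v0 · v1)
  raw P comb-zero = (𝕎𝕎 ∷ 𝕊𝕎𝕎 ∷ 𝕎 ∷ []) ∙
    ⟨ combᵘ ⟩ · v0 · v1 · ⟨ leafᵘ ⟩ · v2 ⟶ v0 · v2
  raw P comb-suc = (𝕎𝕎 ∷ 𝕊𝕎𝕎 ∷ 𝕊 ∷ 𝕊 ∷ 𝕎 ∷ []) ∙
    ⟨ combᵘ ⟩ · v0 · v1 · (⟨ pairᵘ ⟩ · v2 · v3) · v4 ⟶ v1 · v3 · v4
  -- The bound is recomputed at every step since the log may have grown. Its difference with the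
  -- counter is a nonempty word exactly while the counter is below the bound.
  raw P exec-rule = (𝕊𝕎𝕎 ∷ 𝕎 ∷ ℂ ∷ 𝕊 ∷ 𝔻 ∷ 𝔻 ∷ []) ∙
    ⟨ execᵘ ⟩ · v0 · v1 · v2 · v3 · v4 · v5
      ⟶ ⟨ checkᵘ ⟩ · v0 · v1 · v2 · v3 · v4 · v5 · (⟨ subᵘ ⟩ · bound P v0 v1 v4 · v2)
  -- Halting is possible with any clock. The next two rules demand a nonempty one, and this is what
  -- makes the number of remaining steps decrease in the interpretation.
  raw P check-stop = (𝕊𝕎𝕎 ∷ 𝕎 ∷ ℂ ∷ 𝔻 ∷ 𝔻 ∷ 𝕎 ∷ []) ∙
    ⟨ checkᵘ ⟩ · v0 · v1 · v2 · ⟨ leafᵘ ⟩ · v3 · v4 · v5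
      ⟶ ⟨ decᵘ ⟩ · (⟨ nthᵘ ⟩ · ⟨ leafᵘ ⟩ · v4)
  raw P check-run = (𝕊𝕎𝕎 ∷ 𝕎 ∷ ℂ ∷ 𝕊 ∷ 𝔻 ∷ 𝔻 ∷ 𝔹 ∷ 𝕎 ∷ []) ∙
    ⟨ checkᵘ ⟩ · v0 · v1 · v2 · (⟨ pairᵘ ⟩ · ⟨ leafᵘ ⟩ · v3) · v4 · v5 · (sym cons · v6 · v7)
      ⟶ ⟨ stepᵘ ⟩ · v0 · v1 · (⟨ sucᵘ ⟩ · v2) · v4 · v5
           · (⟨ deltaᵘ ⟩ · (⟨ pairᵘ ⟩ · v3 · (⟨ readsᵘ ⟩ · v5)))
  -- The first component of the control code is `leaf` for an ordinary state and a pair for a query.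
  -- Here `v3` is the oracle, `v4` the state after the answer, `v5` and `v6` the positions of the
  -- query tape and of the answer tape.
  raw P check-ask = (𝕊𝕎𝕎 ∷ 𝕎 ∷ ℂ ∷ 𝕊 ∷ 𝕊 ∷ 𝕊 ∷ 𝕊 ∷ 𝔻 ∷ 𝔻 ∷ 𝔹 ∷ 𝕎 ∷ []) ∙
    ⟨ checkᵘ ⟩ · v0 · v1 · v2 · (⟨ pairᵘ ⟩ · (⟨ pairᵘ ⟩ · v3 · v4) · (⟨ pairᵘ ⟩ · v5 · v6)) · v7 · v8 · (sym cons · v9 · v10)
      ⟶ ⟨ askᵘ ⟩ · v0 · v1 · (⟨ sucᵘ ⟩ · v2) · (⟨ pairᵘ ⟩ · (⟨ pairᵘ ⟩ · v3 · v4) · (⟨ pairᵘ ⟩ · v5 · v6)) · v7 · v8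
           · (⟨ decᵘ ⟩ · (⟨ nthᵘ ⟩ · v5 · v8))
  raw P step-rule = (𝕊𝕎𝕎 ∷ 𝕎 ∷ ℂ ∷ 𝔻 ∷ 𝔻 ∷ 𝕊 ∷ 𝔻 ∷ []) ∙
    ⟨ stepᵘ ⟩ · v0 · v1 · v2 · v3 · v4 · (⟨ cellᵘ ⟩ · v5 · v6)
      ⟶ ⟨ execᵘ ⟩ · v0 · v1 · v2 · v5 · v3 · (⟨ actsᵘ ⟩ · v6 · v4)
  -- The answer goes to an `unkept` tape: it may be long and must not enter the size of the list of
  -- tapes.
  raw P ask-rule = (𝕊𝕎𝕎 ∷ 𝕎 ∷ ℂ ∷ 𝕊 ∷ 𝕊 ∷ 𝕊 ∷ 𝕊 ∷ 𝔻 ∷ 𝔻 ∷ 𝕎 ∷ []) ∙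
    ⟨ askᵘ ⟩ · v0 · v1 · v2 · (⟨ pairᵘ ⟩ · (⟨ pairᵘ ⟩ · v3 · v4) · (⟨ pairᵘ ⟩ · v5 · v6)) · v7 · v8 · v9
      ⟶ ⟨ execᵘ ⟩ · v0 · v1 · v2 · v4 · (⟨ histᵘ ⟩ · v9 · v7)
           · (⟨ updᵘ ⟩ · v5 · (⟨ tapeᵘ ⟩ · kept · ⟨ nilᵘ ⟩ · ⟨ nilᵘ ⟩)
                · (⟨ updᵘ ⟩ · v6 · (⟨ tapeᵘ ⟩ · unkept · ⟨ nilᵘ ⟩ · (⟨ encᵘ ⟩ · (v0 · v3 · v9) · ⟨ nilᵘ ⟩)) · v8))

-- Orthogonality

allRuleNames : List RuleName
allRuleNames =
  add-nil ∷ add-cons ∷ mul-nil ∷ mul-cons ∷ max-nil ∷ max-cons-nil ∷ max-cons ∷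
  trunc-nil ∷ trunc-cons-nil ∷ trunc-o ∷ trunc-i ∷ sub-zero ∷ sub-nil ∷ sub-cons ∷
  look-nil ∷ look-cons ∷ push-0 ∷ push-1 ∷ push-2 ∷ push-3 ∷ decl-nil ∷
  decl-cell ∷ decr-nil ∷ decr-cell ∷ dec-tape ∷ read-nil ∷ read-cell ∷ reads-nil ∷
  reads-cons ∷ tail-nil ∷ tail-cell ∷ act-left-nil ∷ act-left-cell ∷ act-right ∷ act-stay ∷
  acts-nil ∷ acts-cons ∷ nth-zero ∷ nth-suc ∷ upd-zero ∷ upd-suc ∷ enc-nil ∷
  enc-o ∷ enc-i ∷ comb-zero ∷ comb-suc ∷ exec-rule ∷ check-stop ∷ check-run ∷
  check-ask ∷ step-rule ∷ ask-rule ∷ []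

∈-allRuleNames : ∀ r → r ∈ allRuleNames
∈-allRuleNames add-nil        = ∈-lookup (# 0)
∈-allRuleNames add-cons       = ∈-lookup (# 1)
∈-allRuleNames mul-nil        = ∈-lookup (# 2)
∈-allRuleNames mul-cons       = ∈-lookup (# 3)
∈-allRuleNames max-nil        = ∈-lookup (# 4)
∈-allRuleNames max-cons-nil   = ∈-lookup (# 5)
∈-allRuleNames max-cons       = ∈-lookup (# 6)
∈-allRuleNames trunc-nil      = ∈-lookup (# 7)
∈-allRuleNames trunc-cons-nil = ∈-lookup (# 8)
∈-allRuleNames trunc-o        = ∈-lookup (# 9)
∈-allRuleNames trunc-i        = ∈-lookup (# 10)
∈-allRuleNames sub-zero       = ∈-lookup (# 11)
∈-allRuleNames sub-nil        = ∈-lookup (# 12)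
∈-allRuleNames sub-cons       = ∈-lookup (# 13)
∈-allRuleNames look-nil       = ∈-lookup (# 14)
∈-allRuleNames look-cons      = ∈-lookup (# 15)
∈-allRuleNames push-0         = ∈-lookup (# 16)
∈-allRuleNames push-1         = ∈-lookup (# 17)
∈-allRuleNames push-2         = ∈-lookup (# 18)
∈-allRuleNames push-3         = ∈-lookup (# 19)
∈-allRuleNames decl-nil       = ∈-lookup (# 20)
∈-allRuleNames decl-cell      = ∈-lookup (# 21)
∈-allRuleNames decr-nil       = ∈-lookup (# 22)
∈-allRuleNames decr-cell      = ∈-lookup (# 23)
∈-allRuleNames dec-tape       = ∈-lookup (# 24)
∈-allRuleNames read-nil       = ∈-lookup (# 25)
∈-allRuleNames read-cell      = ∈-lookup (# 26)
∈-allRuleNames reads-nil      = ∈-lookup (# 27)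
∈-allRuleNames reads-cons     = ∈-lookup (# 28)
∈-allRuleNames tail-nil       = ∈-lookup (# 29)
∈-allRuleNames tail-cell      = ∈-lookup (# 30)
∈-allRuleNames act-left-nil   = ∈-lookup (# 31)
∈-allRuleNames act-left-cell  = ∈-lookup (# 32)
∈-allRuleNames act-right      = ∈-lookup (# 33)
∈-allRuleNames act-stay       = ∈-lookup (# 34)
∈-allRuleNames acts-nil       = ∈-lookup (# 35)
∈-allRuleNames acts-cons      = ∈-lookup (# 36)
∈-allRuleNames nth-zero       = ∈-lookup (# 37)
∈-allRuleNames nth-suc        = ∈-lookup (# 38)
∈-allRuleNames upd-zero       = ∈-lookup (# 39)
∈-allRuleNames upd-suc        = ∈-lookup (# 40)
∈-allRuleNames enc-nil        = ∈-lookup (# 41)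
∈-allRuleNames enc-o          = ∈-lookup (# 42)
∈-allRuleNames enc-i          = ∈-lookup (# 43)
∈-allRuleNames comb-zero      = ∈-lookup (# 44)
∈-allRuleNames comb-suc       = ∈-lookup (# 45)
∈-allRuleNames exec-rule      = ∈-lookup (# 46)
∈-allRuleNames check-stop     = ∈-lookup (# 47)
∈-allRuleNames check-run      = ∈-lookup (# 48)
∈-allRuleNames check-ask      = ∈-lookup (# 49)
∈-allRuleNames step-rule      = ∈-lookup (# 50)
∈-allRuleNames ask-rule       = ∈-lookup (# 51)

T-∧₁ : ∀ {a b} → T (a ∧ b) → T a
T-∧₁ p = proj₁ (Equivalence.to T-∧ p)

T-∧₂ : ∀ {a b} → T (a ∧ b) → T b
T-∧₂ {a} p = proj₂ (Equivalence.to (T-∧ {a}) p)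

module _ {b} {A : Set} {τ : A → Ty b} where

  varIdx< : ∀ {Γ σ} (x : Var {b} Γ σ) → varIdx x < length Γ
  varIdx< vz     = s≤s z≤n
  varIdx< (vs x) = s≤s (varIdx< x)

  occ-outside : ∀ {Γ σ} n (t : Tm τ Γ σ) → length Γ ≤ n → occ n t ≡ 0
  occ-outside n (var x) le with varIdx x Data.Nat.≟ n
  ... | yes refl = ⊥-elim (<-irrefl refl (≤-trans (varIdx< x) le))
  ... | no  _    = refl
  occ-outside n (sym f)   le = refl
  occ-outside n (app s t) le = cong₂ _+_ (occ-outside n s le) (occ-outside n t le)

  -- Exactly once rather than at most once: this yields left-linearity and also vars(r) ⊆ vars(l)
  -- for every right-hand side over the same context (`occ-covers`).
  Linear : ∀ {Γ σ} → Tm τ Γ σ → Set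
  Linear {Γ} t = ∀ n → n < length Γ → occ n t ≡ 1

  occ≤1 : ∀ {Γ σ} (t : Tm τ Γ σ) → Linear t → ∀ n → occ n t ≤ 1
  occ≤1 {Γ} t lin n with n Data.Nat.<? length Γ
  ... | yes n< = ≤-reflexive (lin n n<)
  ... | no  n≮ = ≤-trans (≤-reflexive (occ-outside n t (≮⇒≥ n≮))) z≤n

  occ-covers : ∀ {Γ σ ρ} (t : Tm τ Γ σ) (u : Tm τ Γ ρ) → Linear t → ∀ n → 0 < occ n u → 0 < occ n t
  occ-covers {Γ} t u lin n 0<u with n Data.Nat.<? length Γ
  ... | yes n< = ≤-reflexive (≡sym (lin n n<))
  ... | no  n≮ = ⊥-elim (<-irrefl refl (≤-trans 0<u (≤-reflexive (occ-outside n u (≮⇒≥ n≮)))))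

  onceBelow : ∀ {Γ σ} → ℕ → Tm τ Γ σ → Bool
  onceBelow zero    t = true
  onceBelow (suc n) t = (occ n t ≡ᵇ 1) ∧ onceBelow n t

  onceBelow-sound : ∀ {Γ σ} N (t : Tm τ Γ σ) → T (onceBelow N t) → ∀ n → n < N → occ n t ≡ 1
  onceBelow-sound (suc N) t p n n<N with n Data.Nat.≟ N
  ... | yes refl = ≡ᵇ⇒≡ (occ n t) 1 (T-∧₁ p)
  ... | no  n≢N  = onceBelow-sound N t (T-∧₂ {occ N t ≡ᵇ 1} p) n (≤∧≢⇒< (≤-pred n<N) n≢N)

  symHead : ∀ {Γ σ} → Tm τ Γ σ → Bool
  symHead (var x)   = false
  symHead (sym f)   = true
  symHead (app s t) = symHead s

  symHead-sound : ∀ {Γ σ} (t : Tm τ Γ σ) → T (symHead t) → HeadIsSym t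
  symHead-sound (sym f)   p = tt
  symHead-sound (app s t) p = symHead-sound s p

  module _ (ctor : A → Bool) where

    ctorHead : ∀ {Γ σ} → Tm τ Γ σ → Bool
    ctorHead (var x)   = false
    ctorHead (sym f)   = ctor f
    ctorHead (app s t) = ctorHead s

    -- Rules have base type, so terms of arrow type are never redexes.
    irreducible : ∀ {Γ σ} → Tm τ Γ σ → Bool
    irreducible {σ = base _} t = ctorHead t
    irreducible {σ = _ ⇒ _}  t = true

    -- Accepted terms consist of variables, constructors and terms of arrow type, so their instances
    -- by values contain no redex. `patternArgs?` asks this of the proper subterms only, which is
    -- what an innermost step at the root requires.
    pattern? : ∀ {Γ σ} → Tm τ Γ σ → Bool
    pattern? (var x)   = true
    pattern? (sym f)   = irreducible {[]} (sym f)
    pattern? (app s t) = (pattern? s ∧ pattern? t) ∧ irreducible (app s t)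

    patternArgs? : ∀ {Γ σ} → Tm τ Γ σ → Bool
    patternArgs? (var x)   = false
    patternArgs? (sym f)   = true
    patternArgs? (app s t) = pattern? s ∧ pattern? t

-- Equations between typed terms resist pattern matching, because the type of `sym f` is the
-- computed `τ f`. Overlaps are therefore refuted on untyped shapes.
data Tree : Set where
  hole : Tree
  symT : ℕ → Tree
  appT : Tree → Tree → Tree

headT : Tree → Tree
headT (appT s t) = headT s
headT t          = t

module Clash {τ : Sym 34 → Ty 3} where

  erase : ∀ {Γ σ} → Tm τ Γ σ → Tree
  erase (var x)   = hole
  erase (sym f)   = symT (symIndex f)
  erase (app s t) = appT (erase s) (erase t)

  clash : ∀ {Γ Δ σ ρ} → Tm τ Γ σ → Tm τ Δ ρ → Bool
  clash (sym f)   (sym g)   = not (symIndex f ≡ᵇ symIndex g)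
  clash (sym f)   (app s t) = true
  clash (app s t) (sym f)   = true
  clash (app s t) (app u v) = clash s u ∨ clash t v
  clash (var x)   t         = false
  clash (sym f)   (var x)   = false
  clash (app s t) (var x)   = false

  symT-injective : ∀ {m n} → symT m ≡ symT n → m ≡ n
  symT-injective refl = refl

  appT-injective : ∀ {s t u v} → appT s t ≡ appT u v → s ≡ u × t ≡ v
  appT-injective refl = refl , refl

  clash-sound : ∀ {Γ Γ′ Δ σ ρ} (s : Tm τ Γ σ) (t : Tm τ Γ′ ρ) (γ : Subst Γ Δ) (δ : Subst Γ′ Δ) →
                T (clash s t) → erase (subst γ s) ≢ erase (subst δ t)
  clash-sound (sym f) (sym g) γ δ c e with symIndex f ≡ᵇ symIndex g | ≡⇒≡ᵇ (symIndex f) (symIndex g) (symT-injective e)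
  ... | true | _ = c
  clash-sound (sym f) (app t t₁) γ δ c ()
  clash-sound (app s s₁) (sym f) γ δ c ()
  clash-sound (app s u) (app t v) γ δ c e with clash s t in eq
  ... | true  = clash-sound s t γ δ (Equivalence.from T-≡ eq) (proj₁ (appT-injective e))
  ... | false = clash-sound u v γ δ c (proj₂ (appT-injective e))

  headIndex : ∀ {Γ σ} → Tm τ Γ σ → ℕ
  headIndex (var x)   = 0
  headIndex (sym f)   = symIndex f
  headIndex (app s t) = headIndex s

  headT-subst : ∀ {Γ Δ σ} (t : Tm τ Γ σ) (γ : Subst Γ Δ) → HeadIsSym t → headT (erase (subst γ t)) ≡ symT (headIndex t)
  headT-subst (sym f)   γ h = refl
  headT-subst (app s t) γ h = headT-subst s γ h

  NoOverlap : Rule {τ = τ} → Rule {τ = τ} → Set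
  NoOverlap ρ₁ ρ₂ = ¬ CommonInstance ρ₁ ρ₂

  noOverlap-sym : ∀ {ρ₁ ρ₂} → NoOverlap ρ₁ ρ₂ → NoOverlap ρ₂ ρ₁
  noOverlap-sym n (Δ , γ , δ , e) = n (Δ , δ , γ , ≡sym e)

  commonInstance-erase : ∀ ρ₁ ρ₂ → ((Δ , γ , δ , _) : CommonInstance ρ₁ ρ₂) →
                         erase (subst γ (lhs ρ₁)) ≡ erase (subst δ (lhs ρ₂))
  commonInstance-erase ρ₁ ρ₂ (Δ , γ , δ , e) = cong (λ p → erase (proj₂ p)) e

  clash⇒noOverlap : ∀ {ρ₁ ρ₂} → T (clash (lhs ρ₁) (lhs ρ₂)) → NoOverlap ρ₁ ρ₂
  clash⇒noOverlap {ρ₁} {ρ₂} c ci@(Δ , γ , δ , _) =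
    clash-sound (lhs ρ₁) (lhs ρ₂) γ δ c (commonInstance-erase ρ₁ ρ₂ ci)

  -- Complements `clash` where evaluation is blocked: the left-hand side of `F` has a shape
  -- depending on k and l, and the rules of `deltaᵘ` form a table depending on the machine.
  heads⇒noOverlap : ∀ {ρ₁ ρ₂} → headIndex (lhs ρ₁) ≢ headIndex (lhs ρ₂) → NoOverlap ρ₁ ρ₂
  heads⇒noOverlap {ρ₁} {ρ₂} n ci@(Δ , γ , δ , _) = n (symT-injective
    (trans (≡sym (headT-subst (lhs ρ₁) γ (headSym ρ₁)))
    (trans (cong headT (commonInstance-erase ρ₁ ρ₂ ci)) (headT-subst (lhs ρ₂) δ (headSym ρ₂)))))

  allPairs-lookup : ∀ rs → AllPairs NoOverlap rs → ∀ (m n : Fin (length rs)) → m ≢ n →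
                    NoOverlap (Data.List.lookup rs m) (Data.List.lookup rs n)
  allPairs-lookup (r ∷ rs) (p ∷ ps) zero    zero    ne = ⊥-elim (ne refl)
  allPairs-lookup (r ∷ rs) (p ∷ ps) zero    (suc n) ne = All.lookup p (∈-lookup n)
  allPairs-lookup (r ∷ rs) (p ∷ ps) (suc m) zero    ne =
    noOverlap-sym {r} {Data.List.lookup rs m} (All.lookup p (∈-lookup m))
  allPairs-lookup (r ∷ rs) (p ∷ ps) (suc m) (suc n) ne = allPairs-lookup rs ps m n (ne ∘ cong suc)

  mkRule : ∀ Γ {ι} (s t : Tm τ Γ (base ι)) → HeadIsSym s → Linear s → Rule {τ = τ}
  mkRule Γ s t h lin = record { ctx = Γ ; lhs = s ; rhs = t ; headSym = h ; varsOK = occ-covers s t lin }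

-- Codes for the finite data of the machine

allVecs : ∀ {A : Set} → List A → ∀ n → List (Vec A n)
allVecs xs zero    = [] ∷ []
allVecs xs (suc n) = cartesianProductWith _∷_ xs (allVecs xs n)

∈-allVecs : ∀ {A : Set} {xs : List A} → (∀ x → x ∈ xs) → ∀ {n} (v : Vec A n) → v ∈ allVecs xs n
∈-allVecs p []      = here refl
∈-allVecs p (x ∷ v) = ∈-cartesianProductWith⁺ _∷_ (p x) (∈-allVecs p v)

allVecs-unique : ∀ {A : Set} {xs : List A} → Unique xs → ∀ n → Unique (allVecs xs n)
allVecs-unique u zero    = [] ∷ []
allVecs-unique u (suc n) = Uniqueₚ.cartesianProductWith⁺ _∷_ (λ { refl → refl , refl }) u (allVecs-unique u n)

num-injective : ∀ {m n} → num m ≡ num n → m ≡ n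
num-injective {zero}  {zero}  e = refl
num-injective {suc m} {suc n} e = cong suc (num-injective (pair-injective₂ e))
  where
  pair-injective₂ : ∀ {a b c d} → pair a b ≡ pair c d → b ≡ d
  pair-injective₂ refl = refl

pair-injective : ∀ {a b c d} → pair a b ≡ pair c d → a ≡ c × b ≡ d
pair-injective refl = refl , refl

module Codes {e : ℕ} where

  symV : Sym⊤ e → 𝕊V
  symV a = num (toℕ a)

  symsV : List (Sym⊤ e) → 𝕊V
  symsV []       = leaf
  symsV (a ∷ as) = pair (symV a) (symsV as)

  symV-injective : ∀ {a b} → symV a ≡ symV b → a ≡ b
  symV-injective p = toℕ-injective (num-injective p)

  symsV-injective : ∀ {as bs} → symsV as ≡ symsV bs → as ≡ bs
  symsV-injective {[]}     {[]}     p = refl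
  symsV-injective {a ∷ as} {b ∷ bs} p =
    cong₂ _∷_ (symV-injective (proj₁ (pair-injective p))) (symsV-injective (proj₂ (pair-injective p)))

  cellsV : List (Sym⊤ e) → 𝔻V
  cellsV []       = nil
  cellsV (a ∷ as) = cell (symV a) (cellsV as)

  flagV : Bool → 𝔻V
  flagV true  = cell leaf nil
  flagV false = nil

  -- The flag tells whether the contents of the tape count for its size.
  tapeV : Bool × Tape (Sym⊤ e) → 𝔻V
  tapeV (f , tape x y) = tape (flagV f) (cellsV x) (cellsV y)

  mark : Bool → Tape (Sym⊤ e) → Bool × Tape (Sym⊤ e)
  mark f t = f , t

  tapesV : List (Bool × Tape (Sym⊤ e)) → 𝔻V
  tapesV []       = nil
  tapesV (t ∷ ts) = tapes (tapeV t) (tapesV ts)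

  moveV : Move → 𝕊V
  moveV mL = num 0
  moveV mR = num 1
  moveV mN = num 2

  actV : Sym⊤ e × Move → 𝕊V
  actV (a , d) = pair (symV a) (moveV d)

  actsV : List (Sym⊤ e × Move) → 𝔻V
  actsV []       = nil
  actsV (a ∷ as) = cell (actV a) (actsV as)

toList-++-injective : ∀ {A : Set} {n} (u v : Vec A n) {xs ys} → toList u ++ xs ≡ toList v ++ ys → u ≡ v × xs ≡ ys
toList-++-injective []      []      p = refl , p
toList-++-injective (x ∷ u) (y ∷ v) p with ∷-injective p
... | refl , p′ with toList-++-injective u v p′
...   | refl , q = refl , q

weakenVars : ∀ n {ρ : Ty 3} {Δ σ} → Var Δ σ → Var (replicate n ρ ++ Δ) σ
weakenVars zero    x = x
weakenVars (suc n) x = vs (weakenVars n x)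

firstVars : ∀ n {ρ : Ty 3} {Δ} → Vec (Var (replicate n ρ ++ Δ) ρ) n
firstVars zero    = []
firstVars (suc n) = vz ∷ vmap vs (firstVars n)

-- The rewriting system of a machine and its orthogonality

module Construction {k l : ℕ} (M : OTM k) (P : SOP k l) where
  open OTM M
  open Terms {k} {l}
  open Clash {symType k l userType}
  open Codes {nAux}

  Sy : Set
  Sy = Sym⊤ nAux

  -- The code of a query carries all numbers that the rules need, so that they compute none. In the
  -- list of tapes the main tape has position 0, query tape j position 1 + j and answer tape j
  -- position 1 + k + j.
  ctrlV : Ctrl nStates k → 𝕊V
  ctrlV stop    = leaf
  ctrlV (run q) = pair leaf (num (toℕ q))
  ctrlV (ask j) = pair (pair (num (toℕ j)) (ctrlV (run (ansState j))))
                       (pair (num (suc (toℕ j))) (num (suc (k + toℕ j))))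

  Input : Set
  Input = Fin nStates × Sy × Vec Sy nWork × Vec Sy k × Vec Sy k

  allInputs : List Input
  allInputs = cartesianProduct (allFin _) (cartesianProduct (allFin _)
    (cartesianProduct (allVecs (allFin _) _) (cartesianProduct (allVecs (allFin _) _) (allVecs (allFin _) _))))

  ∈-allInputs : ∀ x → x ∈ allInputs
  ∈-allInputs (s , a , vw , vq , va) =
    ∈-cartesianProduct⁺ (∈-allFin s) (∈-cartesianProduct⁺ (∈-allFin a)
      (∈-cartesianProduct⁺ (∈-allVecs ∈-allFin vw)
        (∈-cartesianProduct⁺ (∈-allVecs ∈-allFin vq) (∈-allVecs ∈-allFin va))))

  allInputs-unique : Unique allInputs
  allInputs-unique = Uniqueₚ.cartesianProduct⁺ (Uniqueₚ.allFin⁺ _) (Uniqueₚ.cartesianProduct⁺ (Uniqueₚ.allFin⁺ _)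
    (Uniqueₚ.cartesianProduct⁺ (vecs _) (Uniqueₚ.cartesianProduct⁺ (vecs _) (vecs _))))
    where
    vecs : ∀ n → Unique (allVecs (allFin _) n)
    vecs = allVecs-unique (Uniqueₚ.allFin⁺ _)

  inputV : Input → 𝕊V
  inputV (s , a , vw , vq , va) = pair (num (toℕ s)) (symsV (a ∷ toList vq ++ (toList va ++ toList vw)))

  -- The blocks of symbols have lengths fixed by the machine, so their concatenation can be cut in
  -- only one way. Orthogonality of the transition table rests on this.
  inputV-injective : ∀ {x y} → inputV x ≡ inputV y → x ≡ y
  inputV-injective {s , a , vw , vq , va} {s′ , a′ , vw′ , vq′ , va′} p with pair-injective p
  ... | p₁ , p₂ with toℕ-injective (num-injective p₁)
                   | toList-++-injective (a ∷ vq) (a′ ∷ vq′) (symsV-injective p₂)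
  ... | refl | refl , p₃ with toList-++-injective va va′ p₃
  ... | refl , p₄ with toList-++-injective vw vw′ {[]} {[]} (cong (_++ []) p₄)
  ... | refl , _ = refl

  outputV : Ctrl nStates k × (Sy × Move) × Vec (Sy × Move) nWork × Vec (Sy × Move) k × Vec (Sy × Move) k → 𝔻V
  outputV (c , a , aw , aq , aa) = cell (ctrlV c) (actsV (a ∷ toList aq ++ (toList aa ++ toList aw)))

  outcome : Input → 𝔻V
  outcome (s , a , vw , vq , va) = outputV (δ s a vw vq va)

  -- A query tape is decoded when its oracle is asked, so its contents must count. Answer and work
  -- tapes are only read at the head, and an answer tape may receive a word of any length.
  sideTapes : Vec (Tape Sy) nWork → Vec (Tape Sy) k → Vec (Tape Sy) k → List (Bool × Tape Sy)
  sideTapes ws qs as = map (mark true) (toList qs) ++ (map (mark false) (toList as) ++ map (mark false) (toList ws))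

  blankTapes : List (Bool × Tape Sy)
  blankTapes = sideTapes (tabulate (λ _ → emptyTape)) (tabulate (λ _ → emptyTape)) (tabulate (λ _ → emptyTape))

  applyX : ∀ {Γ} l′ → RTm Γ (WTy l′) → Vec (RTm Γ 𝕎) l′ → RTm Γ 𝕎
  applyX zero     t []       = t
  applyX (suc l′) t (x ∷ xs) = applyX l′ (t · x) xs

  applyFX : ∀ {Γ} k′ l′ → RTm Γ (FTy k′ l′) → Vec (RTm Γ 𝕎𝕎) k′ → Vec (RTm Γ 𝕎) l′ → RTm Γ 𝕎
  applyFX zero     l′ t []       xs = applyX l′ t xs
  applyFX (suc k′) l′ t (f ∷ fs) xs = applyFX k′ l′ (t · f) fs xs

  ctxF : List (Ty 3)
  ctxF = replicate k 𝕎𝕎 ++ (replicate l 𝕎 ++ [])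

  varsF : Vec (Var ctxF 𝕎𝕎) k
  varsF = firstVars k

  varsX : Vec (Var ctxF 𝕎) l
  varsX = vmap (weakenVars k) (firstVars l)

  combs : ∀ {Γ n} → Vec (RTm Γ 𝕎𝕎) n → RTm Γ 𝕊𝕎𝕎
  combs []       = ⟨ noneᵘ ⟩
  combs (f ∷ fs) = ⟨ combᵘ ⟩ · f · combs fs

  adds : ∀ {Γ n} → Vec (RTm Γ 𝕎) n → RTm Γ 𝕎
  adds []       = sym nil
  adds (x ∷ xs) = ⟨ addᵘ ⟩ · x · adds xs

  encs : ∀ {Γ n} → Vec (RTm Γ 𝕎) n → RTm Γ 𝔻
  encs []           = ⟨ nilᵘ ⟩
  encs (x ∷ [])     = ⟨ encᵘ ⟩ · x · ⟨ nilᵘ ⟩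
  -- `num 3` is the code of the separator.
  encs (x ∷ y ∷ xs) = ⟨ encᵘ ⟩ · x · (⟨ cellᵘ ⟩ · 𝕊⟦ num 3 ⟧ · encs (y ∷ xs))

  lhsF rhsF : RTm ctxF 𝕎
  lhsF = applyFX k l (sym F) (vmap var varsF) (vmap var varsX)
  rhsF = ⟨ execᵘ ⟩ · combs (vmap var varsF) · adds (vmap var varsX) · ⟨ zeroᵘ ⟩ · 𝕊⟦ ctrlV (run start) ⟧ · ⟨ nilᵘ ⟩
         · (⟨ tapesᵘ ⟩ · (⟨ tapeᵘ ⟩ · kept · ⟨ nilᵘ ⟩ · encs (vmap var varsX)) · 𝔻⟦ tapesV blankTapes ⟧)

  occs : ∀ {Γ n σ} → ℕ → Vec (Var Γ σ) n → ℕ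
  occs n []       = 0
  occs n (x ∷ xs) = occ {τ = symType k l userType} n (var x) + occs n xs

  occ-applyX : ∀ {Γ} n l′ (t : RTm Γ (WTy l′)) xs → occ n (applyX l′ t (vmap var xs)) ≡ occ n t + occs n xs
  occ-applyX n zero     t []       = ≡sym (+-identityʳ _)
  occ-applyX n (suc l′) t (x ∷ xs) = trans (occ-applyX n l′ (t · var x) xs) (+-assoc (occ n t) _ _)

  occ-applyFX : ∀ {Γ} n k′ l′ (t : RTm Γ (FTy k′ l′)) fs xs →
                occ n (applyFX k′ l′ t (vmap var fs) (vmap var xs)) ≡ occ n t + (occs n fs + occs n xs)
  occ-applyFX n zero     l′ t []       xs = occ-applyX n l′ t xs
  occ-applyFX n (suc k′) l′ t (f ∷ fs) xs = trans (occ-applyFX n k′ l′ (t · var f) fs xs)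
    (trans (+-assoc (occ n t) _ _) (cong (occ n t +_) (≡sym (+-assoc (occ {τ = symType k l userType} n (var f)) _ _))))

  occ-vs-suc : ∀ {Γ σ ρ} n (x : Var Γ σ) →
               occ {τ = symType k l userType} (suc n) (var (vs {ρ = ρ} x)) ≡ occ {τ = symType k l userType} n (var x)
  occ-vs-suc n x with suc (varIdx x) Data.Nat.≟ suc n | varIdx x Data.Nat.≟ n
  ... | yes p | yes q = refl
  ... | yes p | no q  = ⊥-elim (q (suc-injective p))
  ... | no p  | yes q = ⊥-elim (p (cong suc q))
  ... | no p  | no q  = refl

  occ-weaken-below : ∀ {Δ σ} m {ρ} n (x : Var Δ σ) → n < m →
                     occ {τ = symType k l userType} n (var (weakenVars m {ρ} x)) ≡ 0
  occ-weaken-below (suc m) zero    x lt = refl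
  occ-weaken-below (suc m) (suc n) x lt = trans (occ-vs-suc n (weakenVars m x)) (occ-weaken-below m n x (≤-pred lt))

  occ-weaken-above : ∀ {Δ σ} m {ρ} n (x : Var Δ σ) →
                     occ {τ = symType k l userType} (m + n) (var (weakenVars m {ρ} x)) ≡
                     occ {τ = symType k l userType} n (var x)
  occ-weaken-above zero    n x = refl
  occ-weaken-above (suc m) n x = trans (occ-vs-suc (m + n) (weakenVars m x)) (occ-weaken-above m n x)

  occs-map : ∀ {Γ Δ σ ρ} (f : Var Γ σ → Var Δ ρ) n m →
             (∀ x → occ {τ = symType k l userType} m (var (f x)) ≡ occ {τ = symType k l userType} n (var x)) →
             ∀ {j} (xs : Vec (Var Γ σ) j) → occs m (vmap f xs) ≡ occs n xs
  occs-map f n m p []       = refl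
  occs-map f n m p (x ∷ xs) = cong₂ _+_ (p x) (occs-map f n m p xs)

  occs-map-0 : ∀ {Γ Δ : List (Ty 3)} {σ ρ} (f : Var Γ σ → Var Δ ρ) m →
               (∀ x → occ {τ = symType k l userType} m (var (f x)) ≡ 0) →
               ∀ {j} (xs : Vec (Var Γ σ) j) → occs m (vmap f xs) ≡ 0
  occs-map-0 f m p []       = refl
  occs-map-0 f m p (x ∷ xs) = cong₂ _+_ (p x) (occs-map-0 f m p xs)

  occs-first-below : ∀ m {ρ Δ} n → n < m → occs n (firstVars m {ρ} {Δ}) ≡ 1
  occs-first-below (suc m) {ρ} {Δ} zero lt =
    cong suc (occs-map-0 (vs {Γ = replicate m ρ ++ Δ} {ρ} {ρ}) 0 (λ _ → refl) (firstVars m))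
  occs-first-below (suc m) {ρ} {Δ} (suc n) lt =
    trans (occs-map (vs {Γ = replicate m ρ ++ Δ} {ρ} {ρ}) n (suc n) (occ-vs-suc n) (firstVars m)) (occs-first-below m n (≤-pred lt))

  occs-first-above : ∀ m {ρ Δ} n → occs (m + n) (firstVars m {ρ} {Δ}) ≡ 0
  occs-first-above zero    n = refl
  occs-first-above (suc m) {ρ} {Δ} n =
    trans (occs-map (vs {Γ = replicate m ρ ++ Δ} {ρ} {ρ}) (m + n) (suc m + n) (occ-vs-suc (m + n)) (firstVars m)) (occs-first-above m n)

  length-replicate-++ : ∀ m {ρ : Ty 3} {Δ} → length (replicate m ρ ++ Δ) ≡ m + length Δ
  length-replicate-++ zero    = refl
  length-replicate-++ (suc m) = cong suc (length-replicate-++ m)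

  -- With k and l variable, occurrences cannot be counted by evaluation. Indices below k belong to
  -- the oracle variables, the others to the words; in either range one block contributes 1 and the
  -- other 0.
  lhsF-linear : Linear lhsF
  lhsF-linear n lt with n Data.Nat.<? k
  ... | yes n<k = trans (occ-applyFX n k l (sym F) varsF varsX)
    (cong₂ _+_ (occs-first-below k n n<k)
               (occs-map-0 (weakenVars k {𝕎𝕎} {replicate l 𝕎 ++ []} {𝕎}) n (λ x → occ-weaken-below k n x n<k) (firstVars l {𝕎} {[]})))
  ... | no n≮k = ≡subst (λ j → occ j lhsF ≡ 1) k+m≡n (trans (occ-applyFX (k + m) k l (sym F) varsF varsX)
    (cong₂ _+_ (occs-first-above k m)
      (trans (occs-map (weakenVars k {𝕎𝕎} {replicate l 𝕎 ++ []} {𝕎}) m (k + m) (occ-weaken-above k m) (firstVars l {𝕎} {[]})) (occs-first-below l m m<l))))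
    where
    m = n ∸ k
    k+m≡n : k + m ≡ n
    k+m≡n = m+[n∸m]≡n (≮⇒≥ n≮k)
    m<l : m < l
    m<l = ≤-trans (+-cancelˡ-≤ k _ _ (≤-trans (≤-reflexive (trans (+-suc k m) (cong suc k+m≡n)))
            (≤-trans lt (≤-reflexive (length-replicate-++ k)))))
            (≤-reflexive (trans (length-replicate-++ l) (+-identityʳ l)))

  lhsF-head : ∀ k′ l′ {Γ} (t : RTm Γ (FTy k′ l′)) fs xs → HeadIsSym t → HeadIsSym (applyFX k′ l′ t fs xs)
  lhsF-head zero     zero     t []       []       h = h
  lhsF-head zero     (suc l′) t []       (x ∷ xs) h = lhsF-head zero l′ (t · x) [] xs h
  lhsF-head (suc k′) l′       t (f ∷ fs) xs       h = lhsF-head k′ l′ (t · f) fs xs h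

  lhsF-headIndex : ∀ k′ l′ {Γ} (t : RTm Γ (FTy k′ l′)) fs xs → headIndex (applyFX k′ l′ t fs xs) ≡ headIndex t
  lhsF-headIndex zero     zero     t []       []       = refl
  lhsF-headIndex zero     (suc l′) t []       (x ∷ xs) = lhsF-headIndex zero l′ (t · x) [] xs
  lhsF-headIndex (suc k′) l′       t (f ∷ fs) xs       = lhsF-headIndex k′ l′ (t · f) fs xs

  ruleF : Rule
  ruleF = mkRule ctxF lhsF rhsF (lhsF-head k l (sym F) _ _ tt) lhsF-linear

  deltaRule : Input → Rule
  deltaRule x = mkRule [] (⟨ deltaᵘ ⟩ · 𝕊⟦ inputV x ⟧) 𝔻⟦ outcome x ⟧ tt (λ _ ())

  definedHead : Raw → Bool
  definedHead r = not (ctorHead isCtor (rlhs r)) ∧ (not (headIndex (rlhs r) ≡ᵇ 4) ∧ not (headIndex (rlhs r) ≡ᵇ 32))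

  wellFormed : Raw → Bool
  wellFormed r = (symHead (rlhs r) ∧ patternArgs? isCtor (rlhs r)) ∧ (onceBelow (length (rctx r)) (rlhs r) ∧ definedHead r)

  allTrue : ∀ {A : Set} (p : A → Bool) (xs : List A) → T (all p xs) → ∀ {x} → x ∈ xs → T (p x)
  allTrue p (x ∷ xs) t (here refl) = T-∧₁ t
  allTrue p (x ∷ xs) t (there m)   = allTrue p xs (T-∧₂ {p x} t) m

  -- The left-hand sides contain only fixed symbols, so the test evaluates to `true` on the whole
  -- list although k, l and `P` are variables; `tt` is then its proof.
  raw-wellFormed : ∀ r → T (wellFormed (raw P r))
  raw-wellFormed r = allTrue (λ r → wellFormed (raw P r)) allRuleNames tt (∈-allRuleNames r)

  rlhs-linear : ∀ r → Linear (rlhs (raw P r))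
  rlhs-linear r n lt = onceBelow-sound _ (rlhs (raw P r))
    (T-∧₁ (T-∧₂ {symHead (rlhs (raw P r)) ∧ patternArgs? isCtor (rlhs (raw P r))} (raw-wellFormed r))) n lt

  ruleOf : RuleName → Rule
  ruleOf r = mkRule (rctx (raw P r)) (rlhs (raw P r)) (rrhs (raw P r))
    (symHead-sound (rlhs (raw P r)) (T-∧₁ (T-∧₁ (raw-wellFormed r)))) (rlhs-linear r)

  R : STRS k l
  R = record { nSorts = 3 ; nSyms = 34 ; userTy = userType ; userOrd = userType-ord
             ; rules = ruleF ∷ (map ruleOf allRuleNames ++ map deltaRule allInputs) }

  -- All pairs of named rules are compared by evaluation; the witness is the `tt` passed to
  -- `clashAll-sound` in `orthogonal`.
  clashAll : List RuleName → Bool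
  clashAll []       = true
  clashAll (r ∷ rs) = all (λ r′ → clash (rlhs (raw P r)) (rlhs (raw P r′))) rs ∧ clashAll rs

  module _ {A : Set} {Q : Rule {τ = symType k l userType} → Set} (f : A → Rule {τ = symType k l userType}) where

    all-map : ∀ xs → (∀ {x} → x ∈ xs → Q (f x)) → All Q (map f xs)
    all-map []       q = []
    all-map (x ∷ xs) q = q (here refl) ∷ all-map xs (λ m → q (there m))

  clashAll-sound : ∀ rs → T (clashAll rs) → AllPairs NoOverlap (map ruleOf rs)
  clashAll-sound []       t = []
  clashAll-sound (r ∷ rs) t =
    all-map ruleOf rs (λ {r′} m → clash⇒noOverlap {ruleOf r} {ruleOf r′}
      (allTrue (λ r′ → clash (rlhs (raw P r)) (rlhs (raw P r′))) rs (T-∧₁ t) m))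
    ∷ clashAll-sound rs (T-∧₂ {all (λ r′ → clash (rlhs (raw P r)) (rlhs (raw P r′))) rs} t)

  raw-definedHead : ∀ r → T (definedHead (raw P r))
  raw-definedHead r = T-∧₂ {onceBelow (length (rctx (raw P r))) (rlhs (raw P r))}
    (T-∧₂ {symHead (rlhs (raw P r)) ∧ patternArgs? isCtor (rlhs (raw P r))} (raw-wellFormed r))

  T-not-≡ᵇ : ∀ m n → T (not (m ≡ᵇ n)) → m ≢ n
  T-not-≡ᵇ m n t e with m ≡ᵇ n | ≡⇒≡ᵇ m n e
  ... | true | _ = t

  raw-head≢F : ∀ r → headIndex (rlhs (raw P r)) ≢ 4
  raw-head≢F r = T-not-≡ᵇ _ 4 (T-∧₁ (T-∧₂ {not (ctorHead isCtor (rlhs (raw P r)))} (raw-definedHead r)))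

  raw-head≢delta : ∀ r → headIndex (rlhs (raw P r)) ≢ 32
  raw-head≢delta r = T-not-≡ᵇ _ 32 (T-∧₂ {not (headIndex (rlhs (raw P r)) ≡ᵇ 4)}
    (T-∧₂ {not (ctorHead isCtor (rlhs (raw P r)))} (raw-definedHead r)))

  erase-ground : ∀ {Γ Δ Δ′} (v : 𝕊V) (γ : Subst Γ Δ) → erase (subst γ 𝕊⟦ v ⟧) ≡ erase {Γ = Δ′} 𝕊⟦ v ⟧
  erase-ground leaf       γ = refl
  erase-ground (pair a b) γ = cong₂ appT (cong₂ appT refl (erase-ground a γ)) (erase-ground b γ)

  erase-injective : ∀ {v w} → erase {Γ = []} 𝕊⟦ v ⟧ ≡ erase {Γ = []} 𝕊⟦ w ⟧ → v ≡ w
  erase-injective {leaf}     {leaf}     e = refl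
  erase-injective {leaf}     {pair _ _} ()
  erase-injective {pair _ _} {leaf}     ()
  erase-injective {pair a b} {pair c d} e with appT-injective e
  ... | e₁ , e₂ = cong₂ pair (erase-injective (proj₂ (appT-injective e₁))) (erase-injective e₂)

  -- The left-hand sides are closed, so a common instance would be an equality of the two codes
  -- themselves.
  delta-noOverlap : ∀ {x y} → x ≢ y → NoOverlap (deltaRule x) (deltaRule y)
  delta-noOverlap {x} {y} n ci@(Δ , γ , δ , _) = n (inputV-injective (erase-injective
    (trans (≡sym (erase-ground (inputV x) γ)) (trans
      (proj₂ (appT-injective (commonInstance-erase (deltaRule x) (deltaRule y) ci)))
      (erase-ground (inputV y) δ)))))

  delta-pairs : ∀ {xs} → Unique xs → AllPairs NoOverlap (map deltaRule xs)
  delta-pairs []                = []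
  delta-pairs {x ∷ xs} (u ∷ us) =
    all-map deltaRule xs (λ {y} m → delta-noOverlap {x} {y} (All.lookup u m)) ∷ delta-pairs us

  lhsF-headIndex≡4 : headIndex lhsF ≡ 4
  lhsF-headIndex≡4 = lhsF-headIndex k l (sym F) _ _

  raws-deltas : ∀ rs xs → AllPairs NoOverlap (map ruleOf rs) → AllPairs NoOverlap (map deltaRule xs) →
                AllPairs NoOverlap (map ruleOf rs ++ map deltaRule xs)
  raws-deltas []       xs ps       qs = qs
  raws-deltas (r ∷ rs) xs (p ∷ ps) qs =
    Allₚ.++⁺ p (all-map deltaRule xs (λ {x} _ → heads⇒noOverlap {ruleOf r} {deltaRule x} (raw-head≢delta r)))
    ∷ raws-deltas rs xs ps qs

  ruleF-others : ∀ rs xs → All (NoOverlap ruleF) (map ruleOf rs ++ map deltaRule xs)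
  ruleF-others rs xs = Allₚ.++⁺
    (all-map ruleOf rs λ {r} _ → heads⇒noOverlap {ruleF} {ruleOf r}
      λ e → raw-head≢F r (trans (≡sym e) lhsF-headIndex≡4))
    (all-map deltaRule xs λ {x} _ → heads⇒noOverlap {ruleF} {deltaRule x}
      λ e → 4≢32 (trans (≡sym lhsF-headIndex≡4) e))
    where
    4≢32 : 4 ≢ 32
    4≢32 ()

  leftLinear : ∀ rs xs → All (LeftLinear {τ = symType k l userType}) (ruleF ∷ (map ruleOf rs ++ map deltaRule xs))
  leftLinear rs xs = occ≤1 lhsF lhsF-linear ∷ Allₚ.++⁺
    (all-map ruleOf rs λ {r} _ → occ≤1 (rlhs (raw P r)) (rlhs-linear r))
    (all-map deltaRule xs λ {x} _ → occ≤1 (lhs (deltaRule x)) (λ _ ()))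

  orthogonal : Orthogonal (rules R)
  orthogonal = (λ {ρ} → All.lookup {P = LeftLinear {τ = symType k l userType}} (leftLinear allRuleNames allInputs) {ρ})
             , allPairs-lookup (rules R) (ruleF-others allRuleNames allInputs
                 ∷ raws-deltas allRuleNames allInputs (clashAll-sound allRuleNames tt) (delta-pairs allInputs-unique))

-- Innermost rewriting

-- Except for the result of `truncW`, which is handed to an oracle, these words serve as unary
-- numbers: only their lengths matter.
mulW maxW truncW : W → W → W
mulW []      y = []
mulW (b ∷ x) y = y ++ mulW x y

maxW []      y       = y
maxW (b ∷ x) []      = b ∷ x
maxW (b ∷ x) (c ∷ y) = false ∷ maxW x y

truncW []      n       = []
truncW (b ∷ u) []      = []
truncW (b ∷ u) (c ∷ n) = b ∷ truncW u n

subW : W → ℕ → W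
subW p       zero    = p
subW []      (suc m) = []
subW (b ∷ p) (suc m) = subW p m

lookW : (W → W) → List W → W → W
lookW f []      n = []
lookW f (u ∷ H) n = maxW (f (truncW u n)) (lookW f H n)

boundW : ∀ {k l} → SOP k l → Vec (W → W) k → W → List W → W
boundW (cst n)    fs X H = replicate n false
boundW (var j)    fs X H = X
boundW (P ⊕ Q)    fs X H = boundW P fs X H ++ boundW Q fs X H
boundW (P ⊛ Q)    fs X H = mulW (boundW P fs X H) (boundW Q fs X H)
boundW (fapp j Q) fs X H = lookW (lookup fs j) H (boundW Q fs X H)

tailL : ∀ {A : Set} → List A → List A
tailL []       = []
tailL (a ∷ as) = as

actsL : ∀ {e} → List (Sym⊤ e × Move) → List (Bool × Tape (Sym⊤ e)) → List (Bool × Tape (Sym⊤ e))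
actsL []       ts             = ts
actsL (a ∷ as) []             = []
actsL (a ∷ as) ((f , t) ∷ ts) = (f , act a t) ∷ actsL as ts

pushW : ∀ {e} → Sym⊤ e → W → W
pushW zero                  w = w
pushW (suc zero)            w = false ∷ w
pushW (suc (suc zero))      w = true ∷ w
pushW (suc (suc (suc a)))   w = w

pushW-mapMaybe : ∀ {e} (a : Sym⊤ e) as → pushW a (mapMaybe decBit as) ≡ mapMaybe decBit (a ∷ as)
pushW-mapMaybe zero                as = refl
pushW-mapMaybe (suc zero)          as = refl
pushW-mapMaybe (suc (suc zero))    as = refl
pushW-mapMaybe (suc (suc (suc a))) as = refl

pushW-single : ∀ {e} (a : Sym⊤ e) w → pushW a w ≡ mapMaybe decBit (a ∷ []) ++ w
pushW-single zero                w = refl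
pushW-single (suc zero)          w = refl
pushW-single (suc (suc zero))    w = refl
pushW-single (suc (suc (suc a))) w = refl

-- Values, innermost steps and the auxiliary functions

module Rewriting {k l : ℕ} (M : OTM k) (P : SOP k l) (fs : Vec (W → W) k) where
  open OTM M
  open Terms {k} {l}
  open Codes {nAux}
  open Construction M P

  ETm : List (Ty 3) → Ty 3 → Set
  ETm = TmE R

  infix 2 _⟶¹_ _⟶*_
  _⟶¹_ _⟶*_ : ∀ {σ} → ETm [] σ → ETm [] σ → Set
  t ⟶¹ u = _⟶_ R fs t u
  _⟶*_ = Star _⟶¹_

  ctorE : Sym 34 ⊎ Fin k → Bool
  ctorE (inj₁ f) = isCtor f
  ctorE (inj₂ j) = false

  T⇒≢false : ∀ {b} → T b → b ≢ false
  T⇒≢false {true} t ()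

  ctorHead-defined : ∀ {Γ Δ σ} (t : RTm Γ σ) (γ : Subst {τ = extType R} Γ Δ) → HeadIsSym t →
                     ctorHead isCtor t ≡ false → ctorHead ctorE (subst γ (emb R t)) ≡ false
  ctorHead-defined (sym f)   γ h e = e
  ctorHead-defined (app s t) γ h e = ctorHead-defined s γ h e

  ctorHead-ctor : ∀ {Γ Δ σ} (t : RTm Γ σ) (γ : Subst {τ = extType R} Γ Δ) →
                  T (ctorHead isCtor t) → T (ctorHead ctorE (subst γ (emb R t)))
  ctorHead-ctor (sym f)   γ c = c
  ctorHead-ctor (app s t) γ c = ctorHead-ctor s γ c

  T-not : ∀ {b} → T (not b) → b ≡ false
  T-not {false} t = refl

  lhs-defined : ∀ rs xs → All (λ ρ → ctorHead isCtor (lhs ρ) ≡ false) (ruleF ∷ (map ruleOf rs ++ map deltaRule xs))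
  lhs-defined rs xs = lhsF-defined k l (sym F) _ _ refl ∷ Allₚ.++⁺
    (all-map ruleOf rs λ {r} _ → T-not (T-∧₁ (raw-definedHead r)))
    (all-map deltaRule xs λ _ → refl)
    where
    lhsF-defined : ∀ k′ l′ {Γ} (t : RTm Γ (FTy k′ l′)) fs xs → ctorHead isCtor t ≡ false →
                   ctorHead isCtor (applyFX k′ l′ t fs xs) ≡ false
    lhsF-defined zero     zero     t []       []       h = h
    lhsF-defined zero     (suc l′) t []       (x ∷ xs) h = lhsF-defined zero l′ (t · x) [] xs h
    lhsF-defined (suc k′) l′       t (f ∷ fs) xs       h = lhsF-defined k′ l′ (t · f) fs xs h

  -- Left-hand sides have base type and a defined head. Hence a term accepted by the syntactic test
  -- is no redex, and the negative condition of innermost rewriting can be replaced by a positive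
  -- certificate.
  rootStep-reducible : ∀ {σ} {t u : ETm [] σ} → RootStep R fs t u → irreducible ctorE t ≡ false
  rootStep-reducible (byRule {ρ} m γ) =
    ctorHead-defined (lhs ρ) γ (headSym ρ) (All.lookup (lhs-defined allRuleNames allInputs) m)
  rootStep-reducible (byOracle j u) = refl

  -- The certificate carries the test at every node, so it passes to subterms and gives `NF` by
  -- induction. An unapplied oracle symbol qualifies as a value because its type is an arrow.
  data Good : ∀ {σ} → ETm [] σ → Set where
    gsym : ∀ {f} → T (irreducible {τ = extType R} ctorE {[]} (sym f)) → Good (sym f)
    gapp : ∀ {σ ρ} {s : ETm [] (σ ⇒ ρ)} {t} → Good s → Good t → T (irreducible {τ = extType R} ctorE (app s t)) → Good (app s t)

  good-irreducible : ∀ {σ} {t : ETm [] σ} → Good t → T (irreducible ctorE t)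
  good-irreducible (gsym p)     = p
  good-irreducible (gapp _ _ p) = p

  good-NF : ∀ {σ} {t : ETm [] σ} → Good t → NF R fs t
  good-NF g s here (u , r) = T⇒≢false (good-irreducible g) (rootStep-reducible r)
  good-NF (gapp g h _) s (sleft q)  = good-NF g s q
  good-NF (gapp g h _) s (sright q) = good-NF h s q

  Val : Ty 3 → Set
  Val σ = Σ (ETm [] σ) Good

  data Env : List (Ty 3) → Set where
    []  : Env []
    _∷_ : ∀ {σ Γ} → Val σ → Env Γ → Env (σ ∷ Γ)

  look : ∀ {Γ} → Env Γ → Subst {τ = extType R} Γ []
  look (v ∷ γ) vz     = proj₁ v
  look (v ∷ γ) (vs x) = look γ x

  look-good : ∀ {Γ} (γ : Env Γ) {σ} (x : Var Γ σ) → Good (look γ x)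
  look-good (v ∷ γ) vz     = proj₂ v
  look-good (v ∷ γ) (vs x) = look-good γ x

  irreducible-subst : ∀ {Γ σ} (t : RTm Γ σ) (γ : Env Γ) → T (irreducible isCtor t) →
                      T (irreducible ctorE (subst (look γ) (emb R t)))
  irreducible-subst {σ = base _} t γ p = ctorHead-ctor t (look γ) p
  irreducible-subst {σ = _ ⇒ _}  t γ p = tt

  irreducible-transfer : ∀ {Γ Δ σ} (t : RTm Γ σ) (u : ETm Δ σ) → ctorHead isCtor t ≡ ctorHead ctorE u →
                         T (irreducible isCtor t) → T (irreducible ctorE u)
  irreducible-transfer {σ = base _} t u e p = ≡subst T e p
  irreducible-transfer {σ = _ ⇒ _}  t u e p = tt

  pattern-good : ∀ {Γ σ} (t : RTm Γ σ) (γ : Env Γ) → T (pattern? isCtor t) → Good (subst (look γ) (emb R t))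
  pattern-good (var x)   γ p = look-good γ x
  pattern-good (sym f)   γ p = gsym (irreducible-transfer {[]} (sym f) (sym (inj₁ f)) refl p)
  pattern-good (app s t) γ p = gapp
    (pattern-good s γ (T-∧₁ (T-∧₁ p))) (pattern-good t γ (T-∧₂ {pattern? isCtor s} (T-∧₁ p)))
    (irreducible-subst (app s t) γ (T-∧₂ {pattern? isCtor s ∧ pattern? isCtor t} p))

  GoodArgs : ∀ {σ} → ETm [] σ → Set
  GoodArgs (var x)   = ⊥
  GoodArgs (sym f)   = ⊤
  GoodArgs (app s t) = Good s × Good t

  ⊑-trans : ∀ {σ ρ π} {a : ETm [] σ} {b : ETm [] ρ} {c : ETm [] π} → a ⊑ b → b ⊑ c → a ⊑ c
  ⊑-trans p here       = p
  ⊑-trans p (sleft q)  = sleft (⊑-trans p q)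
  ⊑-trans p (sright q) = sright (⊑-trans p q)

  goodArgs-NF : ∀ {σ} {t : ETm [] σ} → GoodArgs t → ∀ {ρ} (s : ETm [] ρ) → s ⊏ t → NF R fs s
  goodArgs-NF {t = app _ _} (g , h) s (pleft q)  u r = good-NF g u (⊑-trans r q)
  goodArgs-NF {t = app _ _} (g , h) s (pright q) u r = good-NF h u (⊑-trans r q)

  patternArgs-good : ∀ {Γ σ} (t : RTm Γ σ) (γ : Env Γ) → T (patternArgs? isCtor t) →
                     GoodArgs (subst (look γ) (emb R t))
  patternArgs-good (sym f)   γ p = tt
  patternArgs-good (app s t) γ p = pattern-good s γ (T-∧₁ p) , pattern-good t γ (T-∧₂ {pattern? isCtor s} p)

  ruleOf-∈ : ∀ r → ruleOf r ∈ rules R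
  ruleOf-∈ r = there (∈-++⁺ˡ (∈-map⁺ ruleOf (∈-allRuleNames r)))

  deltaRule-∈ : ∀ x → deltaRule x ∈ rules R
  deltaRule-∈ x = there (∈-++⁺ʳ (map ruleOf allRuleNames) (∈-map⁺ deltaRule (∈-allInputs x)))

  -- Once the variables hold values, all proper subterms of the left-hand side are normal, so the
  -- step is innermost. The evaluated test `patternArgs?` settles this for all named rules at once.
  fire : ∀ r (γ : Env (rctx (raw P r))) →
         subst (look γ) (emb R (rlhs (raw P r))) ⟶¹ subst (look γ) (emb R (rrhs (raw P r)))
  fire r γ = root (byRule (ruleOf-∈ r) (look γ))
    (goodArgs-NF (patternArgs-good (rlhs (raw P r)) γ
      (T-∧₂ {symHead (rlhs (raw P r))} (T-∧₁ (raw-wellFormed r)))))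

  infixl 9 _·*_
  _·*_ : ∀ {σ ρ} {s s′ : ETm [] (σ ⇒ ρ)} {t t′ : ETm [] σ} → s ⟶* s′ → t ⟶* t′ → app s t ⟶* app s′ t′
  _·*_ {s′ = s′} {t = t} p q = gmap (λ u → app u t) appL p ◅◅ gmap (app s′) appR q

  ⟪_⟫ : ∀ {Γ} (u : U) → ETm Γ (userType (code u))
  ⟪ u ⟫ = sym (inj₁ (usr (code u)))

  subst-𝕊 : ∀ {Γ} (γ : Subst {τ = extType R} Γ []) v → subst γ (emb R 𝕊⟦ v ⟧) ≡ emb R 𝕊⟦ v ⟧
  subst-𝕊 γ leaf       = refl
  subst-𝕊 γ (pair a b) = cong₂ app (cong₂ app refl (subst-𝕊 γ a)) (subst-𝕊 γ b)

  subst-𝔻 : ∀ {Γ} (γ : Subst {τ = extType R} Γ []) v → subst γ (emb R 𝔻⟦ v ⟧) ≡ emb R 𝔻⟦ v ⟧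
  subst-𝔻 γ nil          = refl
  subst-𝔻 γ (cell a d)   = cong₂ app (cong₂ app refl (subst-𝕊 γ a)) (subst-𝔻 γ d)
  subst-𝔻 γ (tape f x y) = cong₂ app (cong₂ app (cong₂ app refl (subst-𝔻 γ f)) (subst-𝔻 γ x)) (subst-𝔻 γ y)
  subst-𝔻 γ (tapes x y)  = cong₂ app (cong₂ app refl (subst-𝔻 γ x)) (subst-𝔻 γ y)

  subst-wlit : ∀ {Γ} (γ : Subst {τ = extType R} Γ []) n → subst γ (emb R (wlit n)) ≡ wordTm R (replicate n false)
  subst-wlit γ zero    = refl
  subst-wlit γ (suc n) = cong₂ app refl (subst-wlit γ n)

  𝕊v : 𝕊V → Val 𝕊
  𝕊v v = emb R 𝕊⟦ v ⟧ , good v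
    where
    good : ∀ v → Good (emb R 𝕊⟦ v ⟧)
    good leaf       = gsym tt
    good (pair a b) = gapp (gapp (gsym tt) (good a) tt) (good b) tt

  𝔻v : 𝔻V → Val 𝔻
  𝔻v v = emb R 𝔻⟦ v ⟧ , good v
    where
    good : ∀ v → Good (emb R 𝔻⟦ v ⟧)
    good nil          = gsym tt
    good (cell a d)   = gapp (gapp (gsym tt) (proj₂ (𝕊v a)) tt) (good d) tt
    good (tape f x y) = gapp (gapp (gapp (gsym tt) (good f) tt) (good x) tt) (good y) tt
    good (tapes x y)  = gapp (gapp (gsym tt) (good x) tt) (good y) tt

  𝔹v : Bool → Val 𝔹
  𝔹v b = bitTm R b , good b
    where
    good : ∀ b → Good (bitTm R b)
    good false = gsym tt
    good true  = gsym tt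

  𝕎v : W → Val 𝕎
  𝕎v w = wordTm R w , good w
    where
    good : ∀ w → Good (wordTm R w)
    good []      = gsym tt
    good (b ∷ w) = gapp (gapp (gsym tt) (proj₂ (𝔹v b)) tt) (good w) tt

  counter : ℕ → ETm [] ℂ
  counter zero    = ⟪ zeroᵘ ⟫
  counter (suc m) = ⟪ sucᵘ ⟫ · counter m

  ℂv : ℕ → Val ℂ
  ℂv m = counter m , good m
    where
    good : ∀ m → Good (counter m)
    good zero    = gsym tt
    good (suc m) = gapp (gsym tt) (good m) tt

  history : List W → ETm [] 𝔻
  history []      = ⟪ nilᵘ ⟫
  history (u ∷ H) = ⟪ histᵘ ⟫ · wordTm R u · history H

  Hv : List W → Val 𝔻
  Hv H = history H , good H
    where
    good : ∀ H → Good (history H)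
    good []      = gsym tt
    good (u ∷ H) = gapp (gapp (gsym tt) (proj₂ (𝕎v u)) tt) (good H) tt

  oracle : Fin k → ETm [] 𝕎𝕎
  oracle j = sym (inj₂ j)

  -- `π` names the oracles that remain, so that `oracles*` can recurse on the tail of the list while
  -- the index drops by one.
  oracles : ∀ n → (Fin n → Fin k) → ETm [] 𝕊𝕎𝕎
  oracles zero    π = ⟪ noneᵘ ⟫
  oracles (suc n) π = ⟪ combᵘ ⟫ · oracle (π zero) · oracles n (π ∘ suc)

  oraclesv : ∀ n (π : Fin n → Fin k) → Val 𝕊𝕎𝕎
  oraclesv n π = oracles n π , good n π
    where
    good : ∀ n (π : Fin n → Fin k) → Good (oracles n π)
    good zero    π = gsym tt
    good (suc n) π = gapp (gapp (gsym tt) (gsym tt) tt) (good n (π ∘ suc)) tt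

  w⟨_⟩ : W → ETm [] 𝕎
  w⟨ w ⟩ = wordTm R w
  s⟨_⟩ : 𝕊V → ETm [] 𝕊
  s⟨ v ⟩ = emb R 𝕊⟦ v ⟧
  d⟨_⟩ : 𝔻V → ETm [] 𝔻
  d⟨ v ⟩ = emb R 𝔻⟦ v ⟧

  result-≡ : ∀ {t v w} → v ≡ w → t ⟶* w⟨ v ⟩ → t ⟶* w⟨ w ⟩
  result-≡ refl p = p

  add* : ∀ x y → ⟪ addᵘ ⟫ · w⟨ x ⟩ · w⟨ y ⟩ ⟶* w⟨ x ++ y ⟩
  add* []      y = fire add-nil (𝕎v y ∷ []) ◅ ε
  add* (b ∷ x) y = fire add-cons (𝔹v b ∷ 𝕎v x ∷ 𝕎v y ∷ []) ◅ ε ·* add* x y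

  mul* : ∀ x y → ⟪ mulᵘ ⟫ · w⟨ x ⟩ · w⟨ y ⟩ ⟶* w⟨ mulW x y ⟩
  mul* []      y = fire mul-nil (𝕎v y ∷ []) ◅ ε
  mul* (b ∷ x) y = fire mul-cons (𝔹v b ∷ 𝕎v x ∷ 𝕎v y ∷ []) ◅ ε ·* mul* x y ◅◅ add* y (mulW x y)

  max* : ∀ x y → ⟪ maxᵘ ⟫ · w⟨ x ⟩ · w⟨ y ⟩ ⟶* w⟨ maxW x y ⟩
  max* []      y       = fire max-nil (𝕎v y ∷ []) ◅ ε
  max* (b ∷ x) []      = fire max-cons-nil (𝔹v b ∷ 𝕎v x ∷ []) ◅ ε
  max* (b ∷ x) (c ∷ y) = fire max-cons (𝔹v b ∷ 𝕎v x ∷ 𝔹v c ∷ 𝕎v y ∷ []) ◅ ε ·* max* x y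

  trunc* : ∀ u n → ⟪ truncᵘ ⟫ · w⟨ u ⟩ · w⟨ n ⟩ ⟶* w⟨ truncW u n ⟩
  trunc* []          n       = fire trunc-nil (𝕎v n ∷ []) ◅ ε
  trunc* (b ∷ u)     []      = fire trunc-cons-nil (𝔹v b ∷ 𝕎v u ∷ []) ◅ ε
  trunc* (false ∷ u) (c ∷ n) = fire trunc-o (𝕎v u ∷ 𝔹v c ∷ 𝕎v n ∷ []) ◅ ε ·* trunc* u n
  trunc* (true ∷ u)  (c ∷ n) = fire trunc-i (𝕎v u ∷ 𝔹v c ∷ 𝕎v n ∷ []) ◅ ε ·* trunc* u n

  sub* : ∀ p m → ⟪ subᵘ ⟫ · w⟨ p ⟩ · counter m ⟶* w⟨ subW p m ⟩
  sub* p       zero    = fire sub-zero (𝕎v p ∷ []) ◅ ε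
  sub* []      (suc m) = fire sub-nil (ℂv m ∷ []) ◅ ε
  sub* (b ∷ p) (suc m) = fire sub-cons (𝔹v b ∷ 𝕎v p ∷ ℂv m ∷ []) ◅ sub* p m

  oracle* : ∀ j u → oracle j · w⟨ u ⟩ ⟶* w⟨ lookup fs j u ⟩
  oracle* j u = root (byOracle j u) (goodArgs-NF (gsym tt , proj₂ (𝕎v u))) ◅ ε

  oracles* : ∀ n (π : Fin n → Fin k) j u → oracles n π · s⟨ num (toℕ j) ⟩ · w⟨ u ⟩ ⟶* w⟨ lookup fs (π j) u ⟩
  oracles* (suc n) π zero    u =
    fire comb-zero ((oracle (π zero) , gsym tt) ∷ oraclesv n (π ∘ suc) ∷ 𝕎v u ∷ []) ◅ oracle* (π zero) u
  oracles* (suc n) π (suc j) u =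
    fire comb-suc ((oracle (π zero) , gsym tt) ∷ oraclesv n (π ∘ suc) ∷ 𝕊v leaf ∷ 𝕊v (num (toℕ j)) ∷ 𝕎v u ∷ [])
    ◅ oracles* n (π ∘ suc) j u

  Gv : Val 𝕊𝕎𝕎
  Gv = oraclesv k (λ j → j)

  G : ETm [] 𝕊𝕎𝕎
  G = proj₁ Gv

  look* : ∀ H j n → ⟪ lookᵘ ⟫ · G · history H · s⟨ num (toℕ j) ⟩ · w⟨ n ⟩ ⟶* w⟨ lookW (lookup fs j) H n ⟩
  look* []      j n = fire look-nil (Gv ∷ 𝕊v (num (toℕ j)) ∷ 𝕎v n ∷ []) ◅ ε
  look* (u ∷ H) j n =
    fire look-cons (Gv ∷ 𝕎v u ∷ Hv H ∷ 𝕊v (num (toℕ j)) ∷ 𝕎v n ∷ [])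
    ◅ ε ·* (ε ·* trunc* u n ◅◅ oracles* k (λ j → j) j (truncW u n)) ·* look* H j n
    ◅◅ max* (lookup fs j (truncW u n)) (lookW (lookup fs j) H n)

  push* : ∀ a w → ⟪ pushᵘ ⟫ · s⟨ symV a ⟩ · w⟨ w ⟩ ⟶* w⟨ pushW a w ⟩
  push* zero                w = fire push-0 (𝕎v w ∷ []) ◅ ε
  push* (suc zero)          w = fire push-1 (𝕎v w ∷ []) ◅ ε
  push* (suc (suc zero))    w = fire push-2 (𝕎v w ∷ []) ◅ ε
  push* (suc (suc (suc a))) w = fire push-3 (𝕊v leaf ∷ 𝕊v (num (toℕ a)) ∷ 𝕎v w ∷ []) ◅ ε

  decl* : ∀ as → ⟪ declᵘ ⟫ · d⟨ cellsV as ⟩ ⟶* w⟨ mapMaybe decBit as ⟩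
  decl* []       = fire decl-nil [] ◅ ε
  decl* (a ∷ as) = result-≡ (pushW-mapMaybe a as)
    (fire decl-cell (𝕊v (symV a) ∷ 𝔻v (cellsV as) ∷ []) ◅ ε ·* decl* as ◅◅ push* a (mapMaybe decBit as))

  -- The left half of a tape is stored nearest cell first, so prepending its cells one by one to the
  -- decoded right half restores the order of `content`.
  decr* : ∀ as w → ⟪ decrᵘ ⟫ · d⟨ cellsV as ⟩ · w⟨ w ⟩ ⟶* w⟨ mapMaybe decBit (reverse as) ++ w ⟩
  decr* []       w = fire decr-nil (𝕎v w ∷ []) ◅ ε
  decr* (a ∷ as) w = result-≡ eq
    (fire decr-cell (𝕊v (symV a) ∷ 𝔻v (cellsV as) ∷ 𝕎v w ∷ []) ◅ ε ·* push* a w ◅◅ decr* as (pushW a w))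
    where
    eq : mapMaybe decBit (reverse as) ++ pushW a w ≡ mapMaybe decBit (reverse (a ∷ as)) ++ w
    eq = trans (cong (mapMaybe decBit (reverse as) ++_) (pushW-single a w))
        (trans (≡sym (++-assoc (mapMaybe decBit (reverse as)) (mapMaybe decBit (a ∷ [])) w))
        (cong (_++ w) (trans (≡sym (mapMaybe-++ decBit (reverse as) (a ∷ [])))
                             (cong (mapMaybe decBit) (≡sym (unfold-reverse a as))))))

  dec* : ∀ t → ⟪ decᵘ ⟫ · d⟨ tapeV (true , t) ⟩ ⟶* w⟨ mapMaybe decBit (content t) ⟩
  dec* (tape x y) = result-≡ (≡sym (mapMaybe-++ decBit (reverse x) y))
    (fire dec-tape (𝕊v leaf ∷ 𝔻v nil ∷ 𝔻v (cellsV x) ∷ 𝔻v (cellsV y) ∷ []) ◅ ε ·* decl* y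
     ◅◅ decr* x (mapMaybe decBit y))

  read* : ∀ f t → ⟪ readᵘ ⟫ · d⟨ tapeV (f , t) ⟩ ⟶* s⟨ symV (readT t) ⟩
  read* f (tape x [])      = fire read-nil (𝔻v (flagV f) ∷ 𝔻v (cellsV x) ∷ []) ◅ ε
  read* f (tape x (a ∷ y)) = fire read-cell (𝔻v (flagV f) ∷ 𝔻v (cellsV x) ∷ 𝕊v (symV a) ∷ 𝔻v (cellsV y) ∷ []) ◅ ε

  reads* : ∀ ts → ⟪ readsᵘ ⟫ · d⟨ tapesV ts ⟩ ⟶* s⟨ symsV (map (λ t → readT (proj₂ t)) ts) ⟩
  reads* []             = fire reads-nil [] ◅ ε
  reads* ((f , t) ∷ ts) = fire reads-cons (𝔻v (tapeV (f , t)) ∷ 𝔻v (tapesV ts) ∷ []) ◅ ε ·* read* f t ·* reads* ts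

  tail* : ∀ as → ⟪ tailᵘ ⟫ · d⟨ cellsV as ⟩ ⟶* d⟨ cellsV (tailL as) ⟩
  tail* []       = fire tail-nil [] ◅ ε
  tail* (a ∷ as) = fire tail-cell (𝕊v (symV a) ∷ 𝔻v (cellsV as) ∷ []) ◅ ε

  -- On an exhausted right half the tail is empty too, so the rules of `actᵘ` need no separate case
  -- for writing on a blank beyond the end.
  writeT-tailL : ∀ (a : Sy) x y → writeT a (tape x y) ≡ tape x (a ∷ tailL y)
  writeT-tailL a x []      = refl
  writeT-tailL a x (b ∷ y) = refl

  act* : ∀ a f t → ⟪ actᵘ ⟫ · s⟨ actV a ⟩ · d⟨ tapeV (f , t) ⟩ ⟶* d⟨ tapeV (f , act a t) ⟩
  act* (a , d) f (tape x y) = ≡subst (λ t → ⟪ actᵘ ⟫ · s⟨ actV (a , d) ⟩ · d⟨ tapeV (f , tape x y) ⟩ ⟶* d⟨ tapeV (f , moveT d t) ⟩)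
    (≡sym (writeT-tailL a x y)) (go d x)
    where
    go : ∀ d x → ⟪ actᵘ ⟫ · s⟨ actV (a , d) ⟩ · d⟨ tapeV (f , tape x y) ⟩
               ⟶* d⟨ tapeV (f , moveT d (tape x (a ∷ tailL y))) ⟩
    go mL []      = fire act-left-nil (𝕊v (symV a) ∷ 𝔻v (flagV f) ∷ 𝔻v (cellsV y) ∷ [])
                    ◅ ε ·* (ε ·* (ε ·* tail* y))
    go mL (b ∷ x) = fire act-left-cell (𝕊v (symV a) ∷ 𝔻v (flagV f) ∷ 𝕊v (symV b) ∷ 𝔻v (cellsV x) ∷ 𝔻v (cellsV y) ∷ [])
                    ◅ ε ·* (ε ·* (ε ·* tail* y))
    go mR x       = fire act-right (𝕊v (symV a) ∷ 𝔻v (flagV f) ∷ 𝔻v (cellsV x) ∷ 𝔻v (cellsV y) ∷ [])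
                    ◅ ε ·* tail* y
    go mN x       = fire act-stay (𝕊v (symV a) ∷ 𝔻v (flagV f) ∷ 𝔻v (cellsV x) ∷ 𝔻v (cellsV y) ∷ [])
                    ◅ ε ·* (ε ·* tail* y)

  acts* : ∀ as ts → length as ≡ length ts → ⟪ actsᵘ ⟫ · d⟨ actsV as ⟩ · d⟨ tapesV ts ⟩ ⟶* d⟨ tapesV (actsL as ts) ⟩
  acts* []       []             e = fire acts-nil [] ◅ ε
  acts* (a ∷ as) ((f , t) ∷ ts) e =
    fire acts-cons (𝕊v (actV a) ∷ 𝔻v (actsV as) ∷ 𝔻v (tapeV (f , t)) ∷ 𝔻v (tapesV ts) ∷ [])
    ◅ ε ·* act* a f t ·* acts* as ts (suc-injective e)

  nth* : ∀ ts t us → ⟪ nthᵘ ⟫ · s⟨ num (length ts) ⟩ · d⟨ tapesV (ts ++ t ∷ us) ⟩ ⟶* d⟨ tapeV t ⟩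
  nth* []        t us = fire nth-zero (𝔻v (tapeV t) ∷ 𝔻v (tapesV us) ∷ []) ◅ ε
  nth* (t′ ∷ ts) t us =
    fire nth-suc (𝕊v leaf ∷ 𝕊v (num (length ts)) ∷ 𝔻v (tapeV t′) ∷ 𝔻v (tapesV (ts ++ t ∷ us)) ∷ []) ◅ nth* ts t us

  upd* : ∀ ts t us t′ → ⟪ updᵘ ⟫ · s⟨ num (length ts) ⟩ · d⟨ tapeV t′ ⟩ · d⟨ tapesV (ts ++ t ∷ us) ⟩
                        ⟶* d⟨ tapesV (ts ++ t′ ∷ us) ⟩
  upd* []         t us t′ = fire upd-zero (𝔻v (tapeV t′) ∷ 𝔻v (tapeV t) ∷ 𝔻v (tapesV us) ∷ []) ◅ ε
  upd* (t″ ∷ ts) t us t′ =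
    fire upd-suc (𝕊v leaf ∷ 𝕊v (num (length ts)) ∷ 𝔻v (tapeV t′) ∷ 𝔻v (tapeV t″) ∷ 𝔻v (tapesV (ts ++ t ∷ us)) ∷ [])
    ◅ ε ·* upd* ts t us t′

  enc* : ∀ w as → ⟪ encᵘ ⟫ · w⟨ w ⟩ · d⟨ cellsV as ⟩ ⟶* d⟨ cellsV (map encBit w ++ as) ⟩
  enc* []          as = fire enc-nil (𝔻v (cellsV as) ∷ []) ◅ ε
  enc* (false ∷ w) as = fire enc-o (𝕎v w ∷ 𝔻v (cellsV as) ∷ []) ◅ ε ·* enc* w as
  enc* (true ∷ w)  as = fire enc-i (𝕎v w ∷ 𝔻v (cellsV as) ∷ []) ◅ ε ·* enc* w as

  delta* : ∀ x → ⟪ deltaᵘ ⟫ · s⟨ inputV x ⟩ ⟶* d⟨ outcome x ⟩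
  delta* x = ≡subst₂ (λ t u → ⟪ deltaᵘ ⟫ · t ⟶* u) (subst-𝕊 (look []) (inputV x)) (subst-𝔻 (look []) (outcome x))
    (root (byRule (deltaRule-∈ x) (look [])) (goodArgs-NF (gsym tt
      , ≡subst Good (≡sym (subst-𝕊 (look []) (inputV x))) (proj₂ (𝕊v (inputV x))))) ◅ ε)

  module _ (X : W) (m : ℕ) (c : 𝕊V) (H : List W) (ts : 𝔻V) where

    execEnv : Env (rctx (raw P exec-rule))
    execEnv = Gv ∷ 𝕎v X ∷ ℂv m ∷ 𝕊v c ∷ Hv H ∷ 𝔻v ts ∷ []

    bound* : ∀ Q → subst (look execEnv) (emb R (bound Q v0 v1 v4)) ⟶* w⟨ boundW Q fs X H ⟩
    bound* (cst n)    = ≡subst (λ t → t ⟶* w⟨ replicate n false ⟩) (≡sym (subst-wlit (look execEnv) n)) ε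
    bound* (var j)    = ε
    bound* (P ⊕ Q)    = ε ·* bound* P ·* bound* Q ◅◅ add* (boundW P fs X H) (boundW Q fs X H)
    bound* (P ⊛ Q)    = ε ·* bound* P ·* bound* Q ◅◅ mul* (boundW P fs X H) (boundW Q fs X H)
    bound* (fapp j Q) = ≡subst (λ t → ⟪ lookᵘ ⟫ · G · history H · t · _ ⟶* w⟨ boundW (fapp j Q) fs X H ⟩)
      (≡sym (subst-𝕊 (look execEnv) (num (toℕ j))))
      (ε ·* bound* Q ◅◅ look* H j (boundW Q fs X H))

    exec* : ⟪ execᵘ ⟫ · G · w⟨ X ⟩ · counter m · s⟨ c ⟩ · history H · d⟨ ts ⟩
            ⟶* ⟪ checkᵘ ⟫ · G · w⟨ X ⟩ · counter m · s⟨ c ⟩ · history H · d⟨ ts ⟩ · w⟨ subW (boundW P fs X H) m ⟩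
    exec* = fire exec-rule execEnv ◅ ε ·* (ε ·* bound* P ·* ε ◅◅ sub* (boundW P fs X H) m)

-- Simulation of the machine

toList-split : ∀ {A : Set} {n} (v : Vec A n) (j : Fin n) →
               Σ (List A) λ xs → Σ (List A) λ ys →
                 toList v ≡ xs ++ lookup v j ∷ ys ×
                 (∀ x → toList (v [ j ]≔ x) ≡ xs ++ x ∷ ys) × toℕ j ≡ length xs
toList-split (x ∷ v) zero = [] , toList v , refl , (λ _ → refl) , refl
toList-split (x ∷ v) (suc j) with toList-split v j
... | xs , ys , p , q , r = x ∷ xs , ys , cong (x ∷_) p , (λ y → cong (x ∷_) (q y)) , cong suc r

_∈?_ : ∀ (u : W) (H : List W) → Dec (u ∈ H)
_∈?_ = DecMembership._∈?_ (≡-dec Boolₚ._≟_)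

-- Off the log the answer is `[]`, of length 0, so only logged words contribute to the norm. This
-- oracle occurs only in the argument that the clock is long enough; the rewriting itself calls `f`.
restrict : List W → (W → W) → W → W
restrict H f u with u ∈? H
... | yes _ = f u
... | no  _ = []

restrict-∈ : ∀ H f {u} → u ∈ H → restrict H f u ≡ f u
restrict-∈ H f {u} m with u ∈? H
... | yes _ = refl
... | no  n = ⊥-elim (n m)

length-maxW₁ : ∀ x y → length x ≤ length (maxW x y)
length-maxW₁ []      y       = z≤n
length-maxW₁ (b ∷ x) []      = ≤-refl
length-maxW₁ (b ∷ x) (c ∷ y) = s≤s (length-maxW₁ x y)

length-maxW₂ : ∀ x y → length y ≤ length (maxW x y)
length-maxW₂ []      y       = ≤-refl
length-maxW₂ (b ∷ x) []      = z≤n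
length-maxW₂ (b ∷ x) (c ∷ y) = s≤s (length-maxW₂ x y)

truncW-short : ∀ u n → length u ≤ length n → truncW u n ≡ u
truncW-short []      n       le = refl
truncW-short (b ∷ u) (c ∷ n) le = cong (b ∷_) (truncW-short u n (≤-pred le))

length-mulW : ∀ x y → length (mulW x y) ≡ length x * length y
length-mulW []      y = refl
length-mulW (b ∷ x) y = trans (length-++ y) (cong (length y +_) (length-mulW x y))

-- A logged word that is short enough survives the cut unchanged, so `f u` itself is one of the
-- words under the maximum.
lookW-∈ : ∀ f {H u} n → u ∈ H → length u ≤ length n → length (f u) ≤ length (lookW f H n)
lookW-∈ f {u ∷ H} n (here refl) le =
  ≤-trans (≤-reflexive (cong (length ∘ f) (≡sym (truncW-short u n le)))) (length-maxW₁ (f (truncW u n)) (lookW f H n))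
lookW-∈ f {v ∷ H} n (there m) le = ≤-trans (lookW-∈ f n m le) (length-maxW₂ (f (truncW v n)) (lookW f H n))

wordsOfLen-length : ∀ n → All (λ w → length w ≡ n) (wordsOfLen n)
wordsOfLen-length zero    = refl ∷ []
wordsOfLen-length (suc n) = Allₚ.concat⁺ (Allₚ.map⁺ (All.map (λ p → cong suc p ∷ cong suc p ∷ []) (wordsOfLen-length n)))

wordsUpTo-length : ∀ n → All (λ w → length w ≤ n) (wordsUpTo n)
wordsUpTo-length zero    = All.map ≤-reflexive (wordsOfLen-length zero)
wordsUpTo-length (suc n) = Allₚ.++⁺ (All.map ≤-reflexive (wordsOfLen-length (suc n)))
                                    (All.map m≤n⇒m≤1+n (wordsUpTo-length n))

maximum≤ : ∀ (f : W → ℕ) B ys → All (λ y → f y ≤ B) ys → foldr _⊔_ 0 (map f ys) ≤ B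
maximum≤ f B []       []       = z≤n
maximum≤ f B (y ∷ ys) (p ∷ ps) = ⊔-lub p (maximum≤ f B ys ps)

-- Words off the log contribute 0 and logged ones are covered by `lookW-∈`. The slack between n and
-- `length w` lets nested oracle applications be handled with over-estimated arguments.
restrict-norm : ∀ f H w n → n ≤ length w → ∣ restrict H f ∣₁ n ≤ length (lookW f H w)
restrict-norm f H w n le = maximum≤ _ _ (wordsUpTo n) (All.map bound (wordsUpTo-length n))
  where
  bound : ∀ {y} → length y ≤ n → length (restrict H f y) ≤ length (lookW f H w)
  bound {y} p with y ∈? H
  ... | yes m = lookW-∈ f w m (≤-trans p le)
  ... | no  _ = z≤n

length-replicate-false : ∀ n → length (replicate n false) ≡ n
length-replicate-false zero    = refl
length-replicate-false (suc n) = cong suc (length-replicate-false n)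

-- Only the logged queries are taken into account by boundW, so it bounds the running time of the
-- machine for the oracles that agree with fs on the log and answer [] elsewhere.
bound-restrict : ∀ {k l} (P : SOP k l) (fs : Vec (W → W) k) (xs : Vec W l) X H →
                 (∀ j → length (lookup xs j) ≤ length X) →
                 evalSOP P (vmap ∣_∣₁ (vmap (restrict H) fs)) (vmap length xs) ≤ length (boundW P fs X H)
bound-restrict (cst n) fs xs X H le = ≤-reflexive (≡sym (length-replicate-false n))
bound-restrict (var j) fs xs X H le = ≤-trans (≤-reflexive (lookup-map j length xs)) (le j)
bound-restrict (P ⊕ Q) fs xs X H le =
  ≤-trans (+-mono-≤ (bound-restrict P fs xs X H le) (bound-restrict Q fs xs X H le))
          (≤-reflexive (≡sym (length-++ (boundW P fs X H))))
bound-restrict (P ⊛ Q) fs xs X H le =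
  ≤-trans (*-mono-≤ (bound-restrict P fs xs X H le) (bound-restrict Q fs xs X H le))
          (≤-reflexive (≡sym (length-mulW (boundW P fs X H) (boundW Q fs X H))))
bound-restrict (fapp j Q) fs xs X H le =
  ≤-trans (≤-reflexive (cong (λ f → f q) (trans (lookup-map j ∣_∣₁ (vmap (restrict H) fs))
                                             (cong ∣_∣₁ (lookup-map j (restrict H) fs)))))
          (restrict-norm (lookup fs j) H (boundW Q fs X H) q (bound-restrict Q fs xs X H le))
  where q = evalSOP Q (vmap ∣_∣₁ (vmap (restrict H) fs)) (vmap length xs)

subW-cons : ∀ p m → m < length p → Σ Bool λ b → Σ W λ q → subW p m ≡ b ∷ q
subW-cons (b ∷ p) zero    lt = b , p , refl
subW-cons (b ∷ p) (suc m) lt = subW-cons p m (≤-pred lt)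

mapMaybe-blanks : ∀ {e} n → mapMaybe (decBit {e}) (replicate n blank) ≡ []
mapMaybe-blanks zero    = refl
mapMaybe-blanks (suc n) = mapMaybe-blanks n

mapMaybe-bits : ∀ {e} w → mapMaybe (decBit {e}) (map encBit w) ≡ w
mapMaybe-bits []          = refl
mapMaybe-bits (false ∷ w) = cong (false ∷_) (mapMaybe-bits w)
mapMaybe-bits (true ∷ w)  = cong (true ∷_) (mapMaybe-bits w)

module Runs {k : ℕ} (M : OTM k) where
  open OTM M

  stepsM-suc : ∀ gs m c → stepsM M gs (suc m) c ≡ stepM M gs (stepsM M gs m c)
  stepsM-suc gs zero    c = refl
  stepsM-suc gs (suc m) c = stepsM-suc gs m (stepM M gs c)

  stepsM-+ : ∀ gs t d c → stepsM M gs (t + d) c ≡ stepsM M gs d (stepsM M gs t c)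
  stepsM-+ gs zero    d c = refl
  stepsM-+ gs (suc t) d c = stepsM-+ gs t d (stepM M gs c)

  stepM-stop : ∀ gs c → Config.ctrl c ≡ stop → stepM M gs c ≡ c
  stepM-stop gs (cfg stop _ _ _ _) refl = refl

  stepsM-stop : ∀ gs d c → Config.ctrl c ≡ stop → stepsM M gs d c ≡ c
  stepsM-stop gs zero    c e = refl
  stepsM-stop gs (suc d) c e = trans (cong (stepsM M gs d) (stepM-stop gs c e)) (stepsM-stop gs d c e)

  Holds-decode : ∀ t w → Holds M t w → mapMaybe decBit (content t) ≡ w
  Holds-decode t w (a , b , e) =
    trans (cong (mapMaybe decBit) e)
    (trans (mapMaybe-++ decBit (replicate a blank) (map encBit w ++ replicate b blank))
    (trans (cong₂ _++_ (mapMaybe-blanks a) (mapMaybe-++ decBit (map encBit w) (replicate b blank)))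
    (trans (cong₂ _++_ (mapMaybe-bits w) (mapMaybe-blanks b)) (++-identityʳ w))))

module Simulation {k l : ℕ} (M : OTM k) (P : SOP k l) (fs : Vec (W → W) k) where
  open OTM M
  open Terms {k} {l}
  open Codes {nAux}
  open Construction M P
  open Rewriting M P fs
  open Runs M

  allTapes : Tape Sy → Vec (Tape Sy) nWork → Vec (Tape Sy) k → Vec (Tape Sy) k → List (Bool × Tape Sy)
  allTapes mn ws qs as = (true , mn) ∷ sideTapes ws qs as

  stateT : W → ℕ → List W → Config M → ETm [] 𝕎
  stateT X m H (cfg c mn ws qs as) =
    ⟪ execᵘ ⟫ · G · w⟨ X ⟩ · counter m · s⟨ ctrlV c ⟩ · history H · d⟨ tapesV (allTapes mn ws qs as) ⟩

  Output : Set
  Output = Ctrl nStates k × (Sy × Move) × Vec (Sy × Move) nWork × Vec (Sy × Move) k × Vec (Sy × Move) k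

  afterRun : Output → Tape Sy → Vec (Tape Sy) nWork → Vec (Tape Sy) k → Vec (Tape Sy) k → Config M
  afterRun (c , a , aw , aq , aa) mn ws qs as = cfg c (act a mn) (acts M aw ws) (acts M aq qs) (acts M aa as)

  -- `stepM` is stuck on its `with`. Naming the outcome of `δ` allows `step*` to be stated for an
  -- arbitrary outcome.
  stepM-run : ∀ q mn ws qs as → stepM M fs (cfg (run q) mn ws qs as) ≡
              afterRun (δ q (readT mn) (vmap readT ws) (vmap readT qs) (vmap readT as)) mn ws qs as
  stepM-run q mn ws qs as with δ q (readT mn) (vmap readT ws) (vmap readT qs) (vmap readT as)
  ... | _ = refl

  reads-flagged : ∀ {n} f (v : Vec (Tape Sy) n) →
                  map (λ t → readT (proj₂ t)) (map (mark f) (toList v)) ≡ toList (vmap readT v)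
  reads-flagged f []      = refl
  reads-flagged f (t ∷ v) = cong (readT t ∷_) (reads-flagged f v)

  reads-allTapes : ∀ mn ws qs as → map (λ t → readT (proj₂ t)) (allTapes mn ws qs as) ≡
    readT mn ∷ toList (vmap readT qs) ++ (toList (vmap readT as) ++ toList (vmap readT ws))
  reads-allTapes mn ws qs as = cong (readT mn ∷_)
    (trans (map-++ rd (map (mark true) (toList qs)) _) (cong₂ _++_ (reads-flagged true qs)
    (trans (map-++ rd (map (mark false) (toList as)) _) (cong₂ _++_ (reads-flagged false as) (reads-flagged false ws)))))
    where
    rd : Bool × Tape Sy → Sy
    rd t = readT (proj₂ t)

  actsL-flagged : ∀ {n} f (av : Vec (Sy × Move) n) tv as ts →
    actsL (toList av ++ as) (map (mark f) (toList tv) ++ ts) ≡ map (mark f) (toList (acts M av tv)) ++ actsL as ts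
  actsL-flagged f []       []       as ts = refl
  actsL-flagged f (a ∷ av) (t ∷ tv) as ts = cong ((f , act a t) ∷_) (actsL-flagged f av tv as ts)

  actsL-flagged′ : ∀ {n} f (av : Vec (Sy × Move) n) tv →
    actsL (toList av) (map (mark f) (toList tv)) ≡ map (mark f) (toList (acts M av tv))
  actsL-flagged′ f []       []       = refl
  actsL-flagged′ f (a ∷ av) (t ∷ tv) = cong ((f , act a t) ∷_) (actsL-flagged′ f av tv)

  actsL-allTapes : ∀ a (aw : Vec (Sy × Move) nWork) (aq aa : Vec (Sy × Move) k) mn ws qs as →
    actsL (a ∷ toList aq ++ (toList aa ++ toList aw)) (allTapes mn ws qs as) ≡
    allTapes (act a mn) (acts M aw ws) (acts M aq qs) (acts M aa as)
  actsL-allTapes a aw aq aa mn ws qs as = cong ((true , act a mn) ∷_)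
    (trans (actsL-flagged true aq qs _ _) (cong (map (mark true) (toList (acts M aq qs)) ++_)
    (trans (actsL-flagged false aa as _ _) (cong (map (mark false) (toList (acts M aa as)) ++_)
      (actsL-flagged′ false aw ws)))))

  length-flagged : ∀ {n} f (av : Vec (Sy × Move) n) (tv : Vec (Tape Sy) n) →
                   length (toList av) ≡ length (map (mark f) (toList tv))
  length-flagged f av tv = trans (length-toList av) (≡sym (trans (length-map (mark f) (toList tv)) (length-toList tv)))

  length-allTapes : ∀ a (aw : Vec (Sy × Move) nWork) (aq aa : Vec (Sy × Move) k) mn ws qs as →
    length (a ∷ toList aq ++ (toList aa ++ toList aw)) ≡ length (allTapes mn ws qs as)
  length-allTapes a aw aq aa mn ws qs as = cong suc
    (trans (length-++ (toList aq)) (trans (cong₂ _+_ (length-flagged true aq qs)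
      (trans (length-++ (toList aa)) (trans (cong₂ _+_ (length-flagged false aa as) (length-flagged false aw ws))
        (≡sym (length-++ (map (mark false) (toList as)))))))
      (≡sym (length-++ (map (mark true) (toList qs))))))

  module _ (X : W) (m : ℕ) (H : List W) {b : Bool} {p : W} (clock : subW (boundW P fs X H) m ≡ b ∷ p) where

    check* : ∀ c ts → ⟪ execᵘ ⟫ · G · w⟨ X ⟩ · counter m · s⟨ c ⟩ · history H · d⟨ ts ⟩
             ⟶* ⟪ checkᵘ ⟫ · G · w⟨ X ⟩ · counter m · s⟨ c ⟩ · history H · d⟨ ts ⟩ · w⟨ b ∷ p ⟩
    check* c ts = ≡subst (λ w → ⟪ execᵘ ⟫ · G · w⟨ X ⟩ · counter m · s⟨ c ⟩ · history H · d⟨ ts ⟩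
      ⟶* ⟪ checkᵘ ⟫ · G · w⟨ X ⟩ · counter m · s⟨ c ⟩ · history H · d⟨ ts ⟩ · w⟨ w ⟩) clock (exec* X m c H ts)

    step* : ∀ (out : Output) mn ws qs as →
      ⟪ stepᵘ ⟫ · G · w⟨ X ⟩ · counter (suc m) · history H · d⟨ tapesV (allTapes mn ws qs as) ⟩ · d⟨ outputV out ⟩
      ⟶* stateT X (suc m) H (afterRun out mn ws qs as)
    step* (c , a , aw , aq , aa) mn ws qs as =
      fire step-rule (Gv ∷ 𝕎v X ∷ ℂv (suc m) ∷ Hv H ∷ 𝔻v (tapesV (allTapes mn ws qs as)) ∷ 𝕊v (ctrlV c) ∷ 𝔻v (actsV al) ∷ [])
      ◅ ε ·* ≡subst (λ ts → ⟪ actsᵘ ⟫ · d⟨ actsV al ⟩ · d⟨ tapesV (allTapes mn ws qs as) ⟩ ⟶* d⟨ tapesV ts ⟩)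
               (actsL-allTapes a aw aq aa mn ws qs as)
               (acts* al (allTapes mn ws qs as) (length-allTapes a aw aq aa mn ws qs as))
      where
      al : List (Sy × Move)
      al = a ∷ toList aq ++ (toList aa ++ toList aw)

    run* : ∀ q mn ws qs as → stateT X m H (cfg (run q) mn ws qs as)
                            ⟶* stateT X (suc m) H (stepM M fs (cfg (run q) mn ws qs as))
    run* q mn ws qs as = ≡subst (λ c → stateT X m H (cfg (run q) mn ws qs as) ⟶* stateT X (suc m) H c)
      (≡sym (stepM-run q mn ws qs as))
      (check* (ctrlV (run q)) (tapesV ts) ◅◅
       fire check-run (Gv ∷ 𝕎v X ∷ ℂv m ∷ 𝕊v (num (toℕ q)) ∷ Hv H ∷ 𝔻v (tapesV ts) ∷ 𝔹v b ∷ 𝕎v p ∷ [])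
       ◅ (ε ·* (ε ·* (ε ·* reads′) ◅◅ delta* input))
       ◅◅ step* (δ q (readT mn) (vmap readT ws) (vmap readT qs) (vmap readT as)) mn ws qs as)
      where
      ts = allTapes mn ws qs as
      input : Input
      input = q , readT mn , vmap readT ws , vmap readT qs , vmap readT as
      reads′ : ⟪ readsᵘ ⟫ · d⟨ tapesV ts ⟩ ⟶* s⟨ symsV (readT mn ∷ toList (vmap readT qs) ++ (toList (vmap readT as) ++ toList (vmap readT ws))) ⟩
      reads′ = ≡subst (λ as → ⟪ readsᵘ ⟫ · d⟨ tapesV ts ⟩ ⟶* s⟨ symsV as ⟩) (reads-allTapes mn ws qs as) (reads* ts)

    nthAt : ∀ {n ts} us t ws′ → ts ≡ us ++ t ∷ ws′ → n ≡ length us →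
            ⟪ nthᵘ ⟫ · s⟨ num n ⟩ · d⟨ tapesV ts ⟩ ⟶* d⟨ tapeV t ⟩
    nthAt us t ws′ refl refl = nth* us t ws′

    updAt : ∀ {n ts ts′} us t ws′ t′ → ts ≡ us ++ t ∷ ws′ → ts′ ≡ us ++ t′ ∷ ws′ → n ≡ length us →
            ⟪ updᵘ ⟫ · s⟨ num n ⟩ · d⟨ tapeV t′ ⟩ · d⟨ tapesV ts ⟩ ⟶* d⟨ tapesV ts′ ⟩
    updAt us t ws′ t′ refl refl refl = upd* us t ws′ t′

    query : Fin k → Vec (Tape Sy) k → W
    query j qs = mapMaybe decBit (content (lookup qs j))

    ask* : ∀ j mn ws qs as → stateT X m H (cfg (ask j) mn ws qs as)
           ⟶* stateT X (suc m) (query j qs ∷ H) (stepM M fs (cfg (ask j) mn ws qs as))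
    ask* j mn ws qs as =
      check* (ctrlV (ask j)) (tapesV (allTapes mn ws qs as)) ◅◅
      fire check-ask (Gv ∷ 𝕎v X ∷ ℂv m ∷ 𝕊v (num (toℕ j)) ∷ 𝕊v c′ ∷ 𝕊v (num (suc (toℕ j))) ∷ 𝕊v (num (suc (k + toℕ j)))
                      ∷ Hv H ∷ 𝔻v (tapesV (allTapes mn ws qs as)) ∷ 𝔹v b ∷ 𝕎v p ∷ [])
      ◅ (ε ·* (ε ·* nth-query ◅◅ dec* (lookup qs j)))
      ◅◅ fire ask-rule (Gv ∷ 𝕎v X ∷ ℂv (suc m) ∷ 𝕊v (num (toℕ j)) ∷ 𝕊v c′ ∷ 𝕊v (num (suc (toℕ j))) ∷ 𝕊v (num (suc (k + toℕ j)))
                      ∷ Hv H ∷ 𝔻v (tapesV (allTapes mn ws qs as)) ∷ 𝕎v u ∷ [])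
      -- The answer is computed and encoded, the inner update stores it on the answer tape, and the
      -- outer update then clears the query tape.
      ◅ ε ·* (ε ·* (ε ·* (ε ·* enc-answer) ·* ε ◅◅ upd-answer) ◅◅ upd-query)
      where
      c′ = ctrlV (run (ansState j))
      u = query j qs
      answer : List Sy
      answer = map encBit (lookup fs j u)
      enc-answer : ⟪ encᵘ ⟫ · (G · s⟨ num (toℕ j) ⟩ · w⟨ u ⟩) · d⟨ nil ⟩ ⟶* d⟨ cellsV answer ⟩
      enc-answer = ε ·* oracles* k (λ j → j) j u ·* ε
        ◅◅ ≡subst (λ as → ⟪ encᵘ ⟫ · w⟨ lookup fs j u ⟩ · d⟨ nil ⟩ ⟶* d⟨ cellsV as ⟩) (++-identityʳ answer)
             (enc* (lookup fs j u) [])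
      as′ = as [ j ]≔ tape [] answer
      qs′ = qs [ j ]≔ emptyTape

      splitQ = toList-split qs j
      preQ  = proj₁ splitQ
      postQ = proj₁ (proj₂ splitQ)
      splitA = toList-split as j
      preA  = proj₁ splitA
      postA = proj₁ (proj₂ splitA)

      flag-split : ∀ f {ts us : List (Tape Sy)} {t ws′} rest → ts ≡ us ++ t ∷ ws′ →
                   map (mark f) ts ++ rest ≡ map (mark f) us ++ (f , t) ∷ (map (mark f) ws′ ++ rest)
      flag-split f {us = us} {t} {ws′} rest refl = trans (cong (_++ rest) (map-++ (mark f) us (t ∷ ws′)))
        (++-assoc (map (mark f) us) _ rest)

      restQ : Vec (Tape Sy) k → List (Bool × Tape Sy)
      restQ as = map (mark false) (toList as) ++ map (mark false) (toList ws)

      lenQ : suc (toℕ j) ≡ length ((true , mn) ∷ map (mark true) preQ)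
      lenQ = cong suc (trans (proj₂ (proj₂ (proj₂ (proj₂ splitQ)))) (≡sym (length-map (mark true) preQ)))

      nth-query : ⟪ nthᵘ ⟫ · s⟨ num (suc (toℕ j)) ⟩ · d⟨ tapesV (allTapes mn ws qs as) ⟩ ⟶* d⟨ tapeV (true , lookup qs j) ⟩
      nth-query = nthAt ((true , mn) ∷ map (mark true) preQ) (true , lookup qs j) (map (mark true) postQ ++ restQ as)
        (cong ((true , mn) ∷_) (flag-split true (restQ as) (proj₁ (proj₂ (proj₂ splitQ))))) lenQ

      upd-query : ⟪ updᵘ ⟫ · s⟨ num (suc (toℕ j)) ⟩ · d⟨ tapeV (true , emptyTape) ⟩ · d⟨ tapesV (allTapes mn ws qs as′) ⟩
                  ⟶* d⟨ tapesV (allTapes mn ws qs′ as′) ⟩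
      upd-query = updAt ((true , mn) ∷ map (mark true) preQ) (true , lookup qs j) (map (mark true) postQ ++ restQ as′)
        (true , emptyTape)
        (cong ((true , mn) ∷_) (flag-split true (restQ as′) (proj₁ (proj₂ (proj₂ splitQ)))))
        (cong ((true , mn) ∷_) (flag-split true (restQ as′) (proj₁ (proj₂ (proj₂ (proj₂ splitQ))) emptyTape))) lenQ

      preA′ : List (Bool × Tape Sy)
      preA′ = (true , mn) ∷ (map (mark true) (toList qs) ++ map (mark false) preA)

      ans-split : ∀ {ts t} → ts ≡ preA ++ t ∷ postA →
        (true , mn) ∷ (map (mark true) (toList qs) ++ (map (mark false) ts ++ map (mark false) (toList ws)))
        ≡ preA′ ++ (false , t) ∷ (map (mark false) postA ++ map (mark false) (toList ws))
      ans-split e = cong ((true , mn) ∷_) (trans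
        (cong (map (mark true) (toList qs) ++_) (flag-split false (map (mark false) (toList ws)) e))
        (≡sym (++-assoc (map (mark true) (toList qs)) (map (mark false) preA) _)))

      upd-answer : ⟪ updᵘ ⟫ · s⟨ num (suc (k + toℕ j)) ⟩ · d⟨ tapeV (false , tape [] answer) ⟩ · d⟨ tapesV (allTapes mn ws qs as) ⟩
                   ⟶* d⟨ tapesV (allTapes mn ws qs as′) ⟩
      upd-answer = updAt preA′ (false , lookup as j) (map (mark false) postA ++ map (mark false) (toList ws))
        (false , tape [] answer)
        (ans-split (proj₁ (proj₂ (proj₂ splitA))))
        (ans-split (proj₁ (proj₂ (proj₂ (proj₂ splitA))) (tape [] answer)))
        (cong suc (≡sym (trans (length-++ (map (mark true) (toList qs))) (cong₂ _+_
          (trans (length-map (mark true) (toList qs)) (length-toList qs))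
          (trans (length-map (mark false) preA) (≡sym (proj₂ (proj₂ (proj₂ (proj₂ splitA))))))))))

  stop* : ∀ X m H mn ws qs as → stateT X m H (cfg stop mn ws qs as) ⟶* w⟨ mapMaybe decBit (content mn) ⟩
  stop* X m H mn ws qs as =
    exec* X m leaf H (tapesV (allTapes mn ws qs as)) ◅◅
    fire check-stop (Gv ∷ 𝕎v X ∷ ℂv m ∷ Hv H ∷ 𝔻v (tapesV (allTapes mn ws qs as)) ∷ 𝕎v (subW (boundW P fs X H) m) ∷ [])
    ◅ ε ·* nth* [] (true , mn) (sideTapes ws qs as) ◅◅ dec* mn

  Agree : List W → Vec (W → W) k → Set
  Agree H gs = ∀ j {u} → u ∈ H → lookup gs j u ≡ lookup fs j u

  -- The invariant of the simulation. It speaks of all oracles agreeing with the log and not only of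
  -- `fs`, so that `running⇒clock` can instantiate it with the restricted ones.
  Reached : Config M → ℕ → List W → Config M → Set
  Reached c₀ m H c = ∀ gs → Agree H gs → stepsM M gs m c₀ ≡ c

  module _ (Ψ : Functional k l) (xs : Vec W l) (X : W) (X-long : ∀ j → length (lookup xs j) ≤ length X)
           (halts : ∀ gs → HaltsWithin M gs xs (evalSOP P (vmap ∣_∣₁ gs) (vmap length xs)) (Ψ gs xs)) where

    -- Suppose that the counter has reached the computed bound. With the oracles restricted to the
    -- log the time limit is at most that bound, so the machine has stopped by step m and stays
    -- stopped. By `Reached` its configuration at step m is `c`, which is still running.
    running⇒clock : ∀ m H c → Reached (initM M xs) m H c → Config.ctrl c ≢ stop → m < length (boundW P fs X H)
    running⇒clock m H c reached ns with m Data.Nat.<? length (boundW P fs X H)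
    ... | yes lt = lt
    ... | no  ≮  = ⊥-elim (ns (trans (cong Config.ctrl (≡sym c-eq)) stopped))
      where
      gs = vmap (restrict H) fs
      c-eq : stepsM M gs m (initM M xs) ≡ c
      c-eq = reached gs (λ j {u} u∈H → trans (cong (λ f → f u) (lookup-map j (restrict H) fs))
                                             (restrict-∈ H (lookup fs j) u∈H))
      t = proj₁ (halts gs)
      t≤m : t ≤ m
      t≤m = ≤-trans (proj₁ (proj₂ (halts gs))) (≤-trans (bound-restrict P fs xs X H X-long) (≮⇒≥ ≮))
      at-t : Config.ctrl (stepsM M gs t (initM M xs)) ≡ stop
      at-t = proj₁ (proj₂ (proj₂ (halts gs)))
      stopped : Config.ctrl (stepsM M gs m (initM M xs)) ≡ stop
      stopped = trans (cong (λ n → Config.ctrl (stepsM M gs n (initM M xs))) (≡sym (m+[n∸m]≡n t≤m)))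
        (trans (cong Config.ctrl (trans (stepsM-+ gs t (m ∸ t) (initM M xs)) (stepsM-stop gs (m ∸ t) _ at-t))) at-t)

    -- The recursion is on a number r of steps after which the machine with oracles `fs` has
    -- stopped; the clock is only shown to be nonempty along the way. For r = 0 the hypothesis on
    -- the control leaves only the halting case.
    loop : ∀ r m H c → Reached (initM M xs) m H c → Config.ctrl (stepsM M fs r c) ≡ stop →
           stateT X m H c ⟶* w⟨ mapMaybe decBit (content (Config.main (stepsM M fs r c))) ⟩
    loop r m H c@(cfg stop mn ws qs as) reached e =
      result-≡ (cong (λ c → mapMaybe decBit (content (Config.main c))) (≡sym (stepsM-stop fs r c refl)))
               (stop* X m H mn ws qs as)
    loop (suc r) m H c@(cfg (run q) mn ws qs as) reached e
      with subW-cons (boundW P fs X H) m (running⇒clock m H c reached (λ ()))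
    ... | b , p , clock = run* X m H clock q mn ws qs as ◅◅ loop r (suc m) H (stepM M fs c) reached′ e
      where
      reached′ : Reached (initM M xs) (suc m) H (stepM M fs c)
      reached′ gs ag = trans (stepsM-suc gs m _) (trans (cong (stepM M gs) (reached gs ag)) (stepM-run-any gs))
        where
        stepM-run-any : ∀ gs → stepM M gs c ≡ stepM M fs c
        stepM-run-any gs with δ q (readT mn) (vmap readT ws) (vmap readT qs) (vmap readT as)
        ... | _ = refl
    loop (suc r) m H c@(cfg (ask j) mn ws qs as) reached e
      with subW-cons (boundW P fs X H) m (running⇒clock m H c reached (λ ()))
    ... | b , p , clock = ask* X m H clock j mn ws qs as ◅◅ loop r (suc m) (u ∷ H) (stepM M fs c) reached′ e
      where
      u = mapMaybe decBit (content (lookup qs j))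
      reached′ : Reached (initM M xs) (suc m) (u ∷ H) (stepM M fs c)
      -- Agreement on the enlarged log includes the query just asked, so `gs` gives the same answer
      -- to it as `fs`.
      reached′ gs ag = trans (stepsM-suc gs m _) (trans (cong (stepM M gs) (reached gs (λ j m → ag j (there m))))
        (cong (λ w → cfg (run (ansState j)) mn ws (qs [ j ]≔ emptyTape) (as [ j ]≔ tape [] (map encBit w)))
              (ag j (here refl))))

-- The first rewrite step and the initial configuration

concatV : ∀ {n} → Vec W n → W
concatV []       = []
concatV (w ∷ ws) = w ++ concatV ws

length≤concatV : ∀ {n} (ws : Vec W n) j → length (lookup ws j) ≤ length (concatV ws)
length≤concatV (w ∷ ws) zero    = ≤-trans (m≤m+n _ _) (≤-reflexive (≡sym (length-++ w)))
length≤concatV (w ∷ ws) (suc j) =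
  ≤-trans (length≤concatV ws j) (≤-trans (m≤n+m _ _) (≤-reflexive (≡sym (length-++ w))))

module Initial {k l : ℕ} (M : OTM k) (P : SOP k l) (fs : Vec (W → W) k) where
  open OTM M
  open Terms {k} {l}
  open Codes {nAux}
  open Construction M P
  open Rewriting M P fs
  open Simulation M P fs
  open Runs M

  wordsEnv : ∀ {n} → Vec W n → Env (replicate n 𝕎 ++ [])
  wordsEnv []       = []
  wordsEnv (w ∷ ws) = 𝕎v w ∷ wordsEnv ws

  oraclesEnv : ∀ n → (Fin n → Fin k) → ∀ {Δ} → Env Δ → Env (replicate n 𝕎𝕎 ++ Δ)
  oraclesEnv zero    π γ = γ
  oraclesEnv (suc n) π γ = (oracle (π zero) , gsym tt) ∷ oraclesEnv n (π ∘ suc) γ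

  look-words : ∀ {n} (ws : Vec W n) j → look (wordsEnv ws) (lookup (firstVars n) j) ≡ w⟨ lookup ws j ⟩
  look-words (w ∷ ws) zero = refl
  look-words {suc n} (w ∷ ws) (suc j) =
    trans (cong (look (wordsEnv (w ∷ ws))) (lookup-map j vs (firstVars n))) (look-words ws j)

  look-oracles : ∀ n (π : Fin n → Fin k) {Δ} (γ : Env Δ) j →
                 look (oraclesEnv n π γ) (lookup (firstVars n) j) ≡ oracle (π j)
  look-oracles (suc n) π γ zero = refl
  look-oracles (suc n) π γ (suc j) =
    trans (cong (look (oraclesEnv (suc n) π γ)) (lookup-map j vs (firstVars n))) (look-oracles n (π ∘ suc) γ j)

  look-weaken : ∀ n (π : Fin n → Fin k) {Δ σ} (γ : Env Δ) (x : Var Δ σ) →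
                look (oraclesEnv n π γ) (weakenVars n x) ≡ look γ x
  look-weaken zero    π γ x = refl
  look-weaken (suc n) π γ x = look-weaken n (π ∘ suc) γ x

  ≡⇒⟶* : ∀ {σ} {t u : ETm [] σ} → t ≡ u → t ⟶* u
  ≡⇒⟶* refl = ε

  module _ {Γ : List (Ty 3)} (γ : Env Γ) where

    γ⟦_⟧ : ∀ {σ} → RTm Γ σ → ETm [] σ
    γ⟦ t ⟧ = subst (look γ) (emb R t)

    subst-combs : ∀ n (π : Fin n → Fin k) (fv : Vec (Var Γ 𝕎𝕎) n) → (∀ j → look γ (lookup fv j) ≡ oracle (π j)) →
                  γ⟦ combs (vmap var fv) ⟧ ≡ oracles n π
    subst-combs zero    π []       e = refl
    subst-combs (suc n) π (f ∷ fv) e =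
      cong₂ app (cong₂ app refl (e zero)) (subst-combs n (π ∘ suc) fv (e ∘ suc))

    adds* : ∀ {n} (xv : Vec (Var Γ 𝕎) n) ws → (∀ j → look γ (lookup xv j) ≡ w⟨ lookup ws j ⟩) →
            γ⟦ adds (vmap var xv) ⟧ ⟶* w⟨ concatV ws ⟩
    adds* []       []       e = ε
    adds* (x ∷ xv) (w ∷ ws) e = ε ·* ≡⇒⟶* (e zero) ·* adds* xv ws (e ∘ suc) ◅◅ add* w (concatV ws)

    tapeOf : ∀ {n} → Vec W n → List Sy
    tapeOf ws = intercalate (sep ∷ []) (map (map encBit) (toList ws))

    encs* : ∀ {n} (xv : Vec (Var Γ 𝕎) n) ws → (∀ j → look γ (lookup xv j) ≡ w⟨ lookup ws j ⟩) →
            γ⟦ encs (vmap var xv) ⟧ ⟶* d⟨ cellsV (tapeOf ws) ⟩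
    encs* [] [] e = ε
    encs* (x ∷ []) (w ∷ []) e = ε ·* ≡⇒⟶* (e zero) ·* ε ◅◅
      ≡subst (λ as → ⟪ encᵘ ⟫ · w⟨ w ⟩ · d⟨ nil ⟩ ⟶* d⟨ cellsV as ⟩) (++-identityʳ (map encBit w)) (enc* w [])
    encs* (x ∷ y ∷ xv) (w ∷ v ∷ ws) e =
      ε ·* ≡⇒⟶* (e zero) ·* (ε ·* encs* (y ∷ xv) (v ∷ ws) (e ∘ suc)) ◅◅ enc* w (sep ∷ tapeOf (v ∷ ws))

    subst-applyFX : ∀ k′ l′ (t : RTm Γ (FTy k′ l′)) fv xv ss ts →
      (∀ j → look γ (lookup fv j) ≡ lookup ss j) → (∀ j → look γ (lookup xv j) ≡ lookup ts j) →
      γ⟦ applyFX k′ l′ t (vmap var fv) (vmap var xv) ⟧ ≡ applyArgs R γ⟦ t ⟧ ss ts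
    subst-applyFX zero    zero     t [] [] [] [] e e′ = refl
    subst-applyFX zero    (suc l′) t [] (x ∷ xv) [] (u ∷ ts) e e′ =
      trans (subst-applyFX zero l′ (t · var x) [] xv [] ts e (e′ ∘ suc))
            (cong (λ u → applyArgs R (γ⟦ t ⟧ · u) [] ts) (e′ zero))
    subst-applyFX (suc k′) zero t (f ∷ fv) [] (s ∷ ss) [] e e′ =
      trans (subst-applyFX k′ zero (t · var f) fv [] ss [] (e ∘ suc) e′)
            (cong (λ u → applyArgs R (γ⟦ t ⟧ · u) ss []) (e zero))
    subst-applyFX (suc k′) (suc l′) t (f ∷ fv) xv@(_ ∷ _) (s ∷ ss) ts@(_ ∷ _) e e′ =
      trans (subst-applyFX k′ (suc l′) (t · var f) fv xv ss ts (e ∘ suc) e′)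
            (cong (λ u → applyArgs R (γ⟦ t ⟧ · u) ss ts) (e zero))

  goodArgs⇒good : ∀ {σ} {t : ETm [] σ} → GoodArgs t → T (irreducible ctorE t) → Good t
  goodArgs⇒good {t = sym f}   g       p = gsym p
  goodArgs⇒good {t = app s t} (g , h) p = gapp g h p

  goodArgs-applyArgs : ∀ k′ l′ {t : ETm [] (FTy k′ l′)} (ss : Vec (ETm [] 𝕎𝕎) k′) (ts : Vec (ETm [] 𝕎) l′) → GoodArgs t →
    (∀ j → Good (lookup ss j)) → (∀ j → Good (lookup ts j)) → GoodArgs (applyArgs R t ss ts)
  goodArgs-applyArgs zero    zero     [] [] g gs gt = g
  goodArgs-applyArgs zero    (suc l′) [] (u ∷ ts) g gs gt =
    goodArgs-applyArgs zero l′ [] ts (goodArgs⇒good g tt , gt zero) gs (gt ∘ suc)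
  goodArgs-applyArgs (suc k′) zero (s ∷ ss) [] g gs gt =
    goodArgs-applyArgs k′ zero ss [] (goodArgs⇒good g tt , gs zero) (gs ∘ suc) gt
  goodArgs-applyArgs (suc k′) (suc l′) (s ∷ ss) ts@(_ ∷ _) g gs gt =
    goodArgs-applyArgs k′ (suc l′) ss ts (goodArgs⇒good g tt , gs zero) (gs ∘ suc) gt

  module _ (ws : Vec W l) where

    γ : Env ctxF
    γ = oraclesEnv k (λ j → j) (wordsEnv ws)

    oracleTerms : Vec (ETm [] 𝕎𝕎) k
    oracleTerms = tabulate oracle

    look-varsF : ∀ j → look γ (lookup varsF j) ≡ oracle j
    look-varsF j = look-oracles k (λ j → j) (wordsEnv ws) j

    look-varsX : ∀ j → look γ (lookup varsX j) ≡ w⟨ lookup ws j ⟩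
    look-varsX j = trans (cong (look γ) (lookup-map j (weakenVars k) (firstVars l)))
      (trans (look-weaken k (λ j → j) (wordsEnv ws) (lookup (firstVars l) j)) (look-words ws j))

    start-good : GoodArgs (applyArgs R (sym (inj₁ F)) oracleTerms (vmap w⟨_⟩ ws))
    start-good = goodArgs-applyArgs k l oracleTerms (vmap w⟨_⟩ ws) tt
      (λ j → ≡subst Good (≡sym (lookup∘tabulate oracle j)) (gsym tt))
      (λ j → ≡subst Good (≡sym (lookup-map j w⟨_⟩ ws)) (proj₂ (𝕎v (lookup ws j))))

    start-step : applyArgs R (sym (inj₁ F)) oracleTerms (vmap w⟨_⟩ ws) ⟶¹ γ⟦_⟧ γ rhsF
    start-step = ≡subst (λ t → t ⟶¹ γ⟦_⟧ γ rhsF) eq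
      (root (byRule {ρ = ruleF} (here refl) (look γ)) (goodArgs-NF (≡subst GoodArgs (≡sym eq) start-good)))
      where
      eq : γ⟦_⟧ γ lhsF ≡ applyArgs R (sym (inj₁ F)) oracleTerms (vmap w⟨_⟩ ws)
      eq = subst-applyFX γ k l (sym F) varsF varsX oracleTerms (vmap w⟨_⟩ ws)
        (λ j → trans (look-varsF j) (≡sym (lookup∘tabulate oracle j)))
        (λ j → trans (look-varsX j) (≡sym (lookup-map j w⟨_⟩ ws)))

    start* : γ⟦_⟧ γ rhsF ⟶* stateT (concatV ws) 0 [] (initM M ws)
    start* =
      ε ·* ≡⇒⟶* (subst-combs γ k (λ j → j) varsF look-varsF) ·* adds* γ varsX ws look-varsX ·* ε
        ·* ≡⇒⟶* (subst-𝕊 (look γ) (ctrlV (run start))) ·* ε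
        ·* (ε ·* (ε ·* encs* γ varsX ws look-varsX) ·* ≡⇒⟶* (subst-𝔻 (look γ) (tapesV blankTapes)))

    ⟶¹-⟶*⇒⟶⁺ : ∀ {σ} {t u v : ETm [] σ} → t ⟶¹ u → u ⟶* v → _⟶⁺_ R fs t v
    ⟶¹-⟶*⇒⟶⁺ s ε        = [ s ]
    ⟶¹-⟶*⇒⟶⁺ s (r ◅ rs) = s ∷ ⟶¹-⟶*⇒⟶⁺ r rs

    computes-at : (Ψ : Functional k l) →
      (∀ gs → HaltsWithin M gs ws (evalSOP P (vmap ∣_∣₁ gs) (vmap length ws)) (Ψ gs ws)) →
      _⟶⁺_ R fs (applyArgs R (sym (inj₁ F)) oracleTerms (vmap w⟨_⟩ ws)) w⟨ Ψ fs ws ⟩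
    computes-at Ψ halts with halts fs
    ... | t , _ , stopped , holds = ⟶¹-⟶*⇒⟶⁺ start-step (start* ◅◅
      result-≡ (Holds-decode (Config.main (stepsM M fs t (initM M ws))) (Ψ fs ws) holds)
        (loop Ψ ws (concatV ws) (length≤concatV ws) halts t 0 [] (initM M ws) (λ _ _ → refl) stopped))

computes : ∀ {k l} (M : OTM k) (P : SOP k l) (Ψ : Functional k l) →
  (∀ fs ws → HaltsWithin M fs ws (evalSOP P (vmap ∣_∣₁ fs) (vmap length ws)) (Ψ fs ws)) →
  Computes (Construction.R M P) Ψ
computes M P Ψ halts fs ws = Initial.computes-at M P fs ws Ψ (λ gs → halts gs ws)

-- Cost-size interpretation

-- `𝟙` interprets `𝕊`, so control codes weigh nothing. Selecting or replacing a tape is therefore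
-- charged to the size of the list of tapes and not to the index.
𝟙 ℕ≤ : QO
𝟙  = record { Car = ⊤ ; _⊒_ = λ _ _ → ⊤ ; ⊒-refl = λ _ → tt ; ⊒-trans = λ _ _ → tt }
ℕ≤ = record { Car = ℕ ; _⊒_ = _≤_ ; ⊒-refl = λ x → ≤-refl ; ⊒-trans = ≤-trans }

-- The cost of a run decreases with the step counter, which is therefore ordered in reverse.
carrier : Fin 3 → QO
carrier zero             = 𝟙
carrier (suc zero)       = ℕ≥
carrier (suc (suc zero)) = ℕ≤

𝒮ᵗ 𝒞ᵗ : Ty 3 → QO
𝒮ᵗ = 𝒮 (sortQO carrier)
𝒞ᵗ = 𝒞 (sortQO carrier)

Args : List QO → Set
Args []       = ⊤
Args (A ∷ As) = Car A × Args As

Args⊒ : ∀ As → Args As → Args As → Set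
Args⊒ []       _        _        = ⊤
Args⊒ (A ∷ As) (x , xs) (y , ys) = _⊒_ A x y × Args⊒ As xs ys

Args⊒-refl : ∀ As xs → Args⊒ As xs xs
Args⊒-refl []       xs       = tt
Args⊒-refl (A ∷ As) (x , xs) = ⊒-refl A x , Args⊒-refl As xs

_⟹⋆_ : List QO → QO → QO
[]       ⟹⋆ B = B
(A ∷ As) ⟹⋆ B = A ⟹ (As ⟹⋆ B)

Monotone : ∀ As B → (Args As → Car B) → Set
Monotone As B f = ∀ {xs ys} → Args⊒ As xs ys → _⊒_ B (f xs) (f ys)

-- The interpretation sets demand monotonicity in each argument separately; here one proof for the
-- uncurried function suffices. `curryM⊒` supplies the comparison of two curried functions that
-- monotonicity in the first argument amounts to.
curryM  : ∀ As B (f : Args As → Car B) → Monotone As B f → Car (As ⟹⋆ B)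
curryM⊒ : ∀ As B f g (mf : Monotone As B f) (mg : Monotone As B g) →
          (∀ xs → _⊒_ B (f xs) (g xs)) → _⊒_ (As ⟹⋆ B) (curryM As B f mf) (curryM As B g mg)

curryM []       B f m = f tt
curryM (A ∷ As) B f m =
  (λ x → curryM As B (λ xs → f (x , xs)) (λ r → m (⊒-refl A x , r))) ,
  (λ {x} {y} q → curryM⊒ As B _ _ _ _ (λ xs → m (q , Args⊒-refl As xs)))

curryM⊒ []       B f g mf mg e = e tt
curryM⊒ (A ∷ As) B f g mf mg e = λ x → curryM⊒ As B _ _ _ _ (λ xs → e (x , xs))

-- A monotone substitute for a case distinction. In `tapeᵘ` the first argument is the flag of the
-- tape, in `checkᵘ` the clock.
keep : ℕ → ℕ → ℕ
keep zero    n = 0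
keep (suc _) n = n

keep-mono : ∀ {x x′ y y′} → x ≥ x′ → y ≥ y′ → keep x y ≥ keep x′ y′
keep-mono {x′ = zero}                p       q = z≤n
keep-mono {x = suc x} {x′ = suc x′} (s≤s p) q = q

Mon : (ℕ → ℕ) → Set
Mon f = ∀ {x y} → x ≥ y → f x ≥ f y

_≥¹_ : (ℕ → ℕ) → (ℕ → ℕ) → Set
f ≥¹ g = ∀ n → f n ≥ g n

≥-app : ∀ {f g : ℕ → ℕ} → Mon f → f ≥¹ g → ∀ {x y} → x ≥ y → f x ≥ g y
≥-app mf p {y = y} q = ≤-trans (p y) (mf q)

-- A log entry pays 1 for the rule, `gs n` + 1 for the maximum, `gc n` for the oracle and n + 1 for
-- the cut. The extra factor covers the end of the log.
lookCost : (gc gs : ℕ → ℕ) → ℕ → ℕ → ℕ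
lookCost gc gs h n = suc h * suc (suc (gs n) + gc n + suc n)

-- One function `gs` stands for every oracle, because an index of sort `𝕊` has no size that could
-- tell them apart. It is later the sum over all oracles.
pval : ∀ {k l} → SOP k l → (ℕ → ℕ) → ℕ → ℕ
pval (cst n)    gs X = n
pval (var j)    gs X = X
pval (P ⊕ Q)    gs X = pval P gs X + pval Q gs X
pval (P ⊛ Q)    gs X = pval P gs X * pval Q gs X
pval (fapp j Q) gs X = gs (pval Q gs X)

boundCost : ∀ {k l} → SOP k l → (gc gs : ℕ → ℕ) → ℕ → ℕ → ℕ
boundCost (cst n)    gc gs X h = 0
boundCost (var j)    gc gs X h = 0
boundCost (P ⊕ Q)    gc gs X h = suc (pval P gs X) + boundCost P gc gs X h + boundCost Q gc gs X h
boundCost (P ⊛ Q)    gc gs X h = suc (pval P gs X) * suc (suc (pval Q gs X)) + boundCost P gc gs X h + boundCost Q gc gs X h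
boundCost (fapp j Q) gc gs X h = lookCost gc gs h (pval Q gs X) + boundCost Q gc gs X h

lookCost-mono : ∀ {gc gc′ gs gs′ h h′ n n′} → Mon gc → Mon gs → gc ≥¹ gc′ → gs ≥¹ gs′ → h ≥ h′ → n ≥ n′ →
                lookCost gc gs h n ≥ lookCost gc′ gs′ h′ n′
lookCost-mono mc ms pc ps ph pn =
  *-mono-≤ (s≤s ph) (s≤s (+-mono-≤ (+-mono-≤ (s≤s (≥-app ms ps pn)) (≥-app mc pc pn)) (s≤s pn)))

pval-mono : ∀ {k l} (P : SOP k l) {gs gs′ X X′} → Mon gs → gs ≥¹ gs′ → X ≥ X′ → pval P gs X ≥ pval P gs′ X′
pval-mono (cst n)    ms ps px = ≤-refl
pval-mono (var j)    ms ps px = px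
pval-mono (P ⊕ Q)    ms ps px = +-mono-≤ (pval-mono P ms ps px) (pval-mono Q ms ps px)
pval-mono (P ⊛ Q)    ms ps px = *-mono-≤ (pval-mono P ms ps px) (pval-mono Q ms ps px)
pval-mono (fapp j Q) ms ps px = ≥-app ms ps (pval-mono Q ms ps px)

boundCost-mono : ∀ {k l} (P : SOP k l) {gc gc′ gs gs′ X X′ h h′} → Mon gc → Mon gs → gc ≥¹ gc′ → gs ≥¹ gs′ →
                 X ≥ X′ → h ≥ h′ → boundCost P gc gs X h ≥ boundCost P gc′ gs′ X′ h′
boundCost-mono (cst n)    mc ms pc ps px ph = z≤n
boundCost-mono (var j)    mc ms pc ps px ph = z≤n
boundCost-mono (P ⊕ Q)    mc ms pc ps px ph =
  +-mono-≤ (+-mono-≤ (s≤s (pval-mono P ms ps px)) (boundCost-mono P mc ms pc ps px ph)) (boundCost-mono Q mc ms pc ps px ph)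
boundCost-mono (P ⊛ Q)    mc ms pc ps px ph =
  +-mono-≤ (+-mono-≤ (*-mono-≤ (s≤s (pval-mono P ms ps px)) (s≤s (s≤s (pval-mono Q ms ps px))))
    (boundCost-mono P mc ms pc ps px ph)) (boundCost-mono Q mc ms pc ps px ph)
boundCost-mono (fapp j Q) mc ms pc ps px ph =
  +-mono-≤ (lookCost-mono mc ms pc ps ph (pval-mono Q ms ps px)) (boundCost-mono Q mc ms pc ps px ph)

-- The cost of a run as a function of the clock

module Clock {k l : ℕ} (P : SOP k l) (D : ℕ) where

  -- `D` is the size of an entry of the transition table. An ordinary step enlarges the tapes by at
  -- most `D + D`, two cells per action. A query adds 3: one log entry and two new tapes of size 1,
  -- the replaced ones not being subtracted.
  K : ℕ
  K = D + D + 3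

  -- Exactly the price of halting: 1 for the rule, t for selecting the main tape and 2t + 1 for
  -- decoding it.
  base₀ : ℕ → ℕ
  base₀ t = 2 + (t + t + t)

  work : (gc gs : ℕ → ℕ) → ℕ → ℕ
  work gc gs t = 3 + (D + D + D) + (t + t) + (gs t + gc t)

  perStep : (gc gs : ℕ → ℕ) → ℕ → ℕ → ℕ
  perStep gc gs X s = 1 + boundCost P gc gs X s + suc (pval P gs X) + base₀ s + work gc gs s

  -- r is the number of remaining steps; s bounds the sizes of the log and of the tapes,
  -- which together grow by at most K per step.
  remaining : (gc gs : ℕ → ℕ) → ℕ → ℕ → ℕ → ℕ
  remaining gc gs X r s = suc r * perStep gc gs X (s + r * K)

  execCost : (gc gs : ℕ → ℕ) → ℕ → ℕ → ℕ → ℕ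
  execCost gc gs X m s = remaining gc gs X (pval P gs X ∸ m) s

  -- At an empty clock only halting has to be paid, which lets `exec-check` end at 0 remaining
  -- steps.
  checkCost : (gc gs : ℕ → ℕ) → ℕ → ℕ → ℕ → ℕ → ℕ → ℕ
  checkCost gc gs X m h t p = base₀ t + keep p (work gc gs t + execCost gc gs X (suc m) (h + t + K))

  stepCost : (gc gs : ℕ → ℕ) → ℕ → ℕ → ℕ → ℕ → ℕ → ℕ
  stepCost gc gs X m h t a = 2 + (a + a + a) + execCost gc gs X m (h + (a + a + t))

  -- The answer is paid for once, by `gs u` for encoding it, but does not reach the size given to
  -- `execCost`: its tape is unflagged and has size 1.
  askCost : (gc gs : ℕ → ℕ) → ℕ → ℕ → ℕ → ℕ → ℕ → ℕ
  askCost gc gs X m h t u = 3 + (t + t) + (gs u + gc u) + execCost gc gs X m (suc h + suc (suc t))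

  module _ {gc gc′ gs gs′ : ℕ → ℕ} {X X′ : ℕ} (mc : Mon gc) (ms : Mon gs) (pc : gc ≥¹ gc′) (ps : gs ≥¹ gs′) (px : X ≥ X′) where

    base₀-mono : ∀ {t t′} → t ≥ t′ → base₀ t ≥ base₀ t′
    base₀-mono pt = s≤s (s≤s (+-mono-≤ (+-mono-≤ pt pt) pt))

    work-mono : ∀ {t t′} → t ≥ t′ → work gc gs t ≥ work gc′ gs′ t′
    work-mono pt = +-mono-≤ (+-mono-≤ (≤-refl {3 + (D + D + D)}) (+-mono-≤ pt pt))
      (+-mono-≤ (≥-app ms ps pt) (≥-app mc pc pt))

    perStep-mono : ∀ {s s′} → s ≥ s′ → perStep gc gs X s ≥ perStep gc′ gs′ X′ s′
    perStep-mono q = +-mono-≤ (+-mono-≤ (+-mono-≤ (s≤s (boundCost-mono P mc ms pc ps px q))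
      (s≤s (pval-mono P ms ps px))) (base₀-mono q)) (work-mono q)

    remaining-mono : ∀ {r r′ s s′} → r ≥ r′ → s ≥ s′ → remaining gc gs X r s ≥ remaining gc′ gs′ X′ r′ s′
    remaining-mono pr q = *-mono-≤ (s≤s pr) (perStep-mono (+-mono-≤ q (*-mono-≤ pr (≤-refl {K}))))

    execCost-mono : ∀ {m m′ s s′} → m ≤ m′ → s ≥ s′ → execCost gc gs X m s ≥ execCost gc′ gs′ X′ m′ s′
    execCost-mono pm q = remaining-mono (∸-mono (pval-mono P ms ps px) pm) q

    checkCost-mono : ∀ {m m′ h h′ t t′ p p′} → m ≤ m′ → h ≥ h′ → t ≥ t′ → p ≥ p′ →
                     checkCost gc gs X m h t p ≥ checkCost gc′ gs′ X′ m′ h′ t′ p′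
    checkCost-mono pm ph pt pp = +-mono-≤ (base₀-mono pt) (keep-mono pp
      (+-mono-≤ (work-mono pt) (execCost-mono (s≤s pm) (+-mono-≤ (+-mono-≤ ph pt) (≤-refl {K})))))

    stepCost-mono : ∀ {m m′ h h′ t t′ a a′} → m ≤ m′ → h ≥ h′ → t ≥ t′ → a ≥ a′ →
                    stepCost gc gs X m h t a ≥ stepCost gc′ gs′ X′ m′ h′ t′ a′
    stepCost-mono pm ph pt pa = +-mono-≤ (s≤s (s≤s (+-mono-≤ (+-mono-≤ pa pa) pa)))
      (execCost-mono pm (+-mono-≤ ph (+-mono-≤ (+-mono-≤ pa pa) pt)))

    askCost-mono : ∀ {m m′ h h′ t t′ u u′} → m ≤ m′ → h ≥ h′ → t ≥ t′ → u ≥ u′ →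
                   askCost gc gs X m h t u ≥ askCost gc′ gs′ X′ m′ h′ t′ u′
    askCost-mono pm ph pt pu = +-mono-≤ (+-mono-≤ (s≤s (s≤s (s≤s (+-mono-≤ pt pt))))
      (+-mono-≤ (≥-app ms ps pu) (≥-app mc pc pu))) (execCost-mono pm (+-mono-≤ (s≤s ph) (s≤s (s≤s pt))))

Fun1 Fun2 : Set
Fun1 = Car (ℕ≥ ⟹ ℕ≥)
Fun2 = Car (𝟙 ⟹ (ℕ≥ ⟹ ℕ≥))

val : Fun2 → ℕ → ℕ
val g n = proj₁ (proj₁ g tt) n

val-mon : ∀ g → Mon (val g)
val-mon g = proj₂ (proj₁ g tt)

-- The size of a running configuration is interpreted by its cost formula with oracle cost 0, since
-- sizes must not depend on costs. The same inequalities then prove both halves of compatibility.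
zero¹ : ℕ → ℕ
zero¹ _ = 0

module Interpretation {k l : ℕ} (P : SOP k l) (D : ℕ) where
  open Clock P D

  SizeU : (u : U) → Car (𝒮ᵗ (ty u))
  SizeU leafᵘ  = tt
  SizeU pairᵘ  = curryM (𝟙 ∷ 𝟙 ∷ []) 𝟙 (λ _ → tt) (λ _ → tt)
  SizeU nilᵘ   = 0
  SizeU cellᵘ  = curryM (𝟙 ∷ ℕ≥ ∷ []) ℕ≥ (λ (_ , d , _) → suc d) (λ (_ , p , _) → s≤s p)
  SizeU tapeᵘ  = curryM (ℕ≥ ∷ ℕ≥ ∷ ℕ≥ ∷ []) ℕ≥ (λ (f , x , y , _) → suc (keep f (x + y)))
                   (λ (p , q , r , _) → s≤s (keep-mono p (+-mono-≤ q r)))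
  SizeU tapesᵘ = curryM (ℕ≥ ∷ ℕ≥ ∷ []) ℕ≥ (λ (x , y , _) → suc (x + y)) (λ (p , q , _) → s≤s (+-mono-≤ p q))
  SizeU histᵘ  = curryM (ℕ≥ ∷ ℕ≥ ∷ []) ℕ≥ (λ (_ , h , _) → suc h) (λ (_ , p , _) → s≤s p)
  SizeU zeroᵘ  = 0
  SizeU sucᵘ   = curryM (ℕ≤ ∷ []) ℕ≤ (λ (m , _) → suc m) (λ (p , _) → s≤s p)
  SizeU addᵘ   = curryM (ℕ≥ ∷ ℕ≥ ∷ []) ℕ≥ (λ (x , y , _) → x + y) (λ (p , q , _) → +-mono-≤ p q)
  SizeU mulᵘ   = curryM (ℕ≥ ∷ ℕ≥ ∷ []) ℕ≥ (λ (x , y , _) → x * y) (λ (p , q , _) → *-mono-≤ p q)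
  SizeU maxᵘ   = curryM (ℕ≥ ∷ ℕ≥ ∷ []) ℕ≥ (λ (x , y , _) → x ⊔ y) (λ (p , q , _) → ⊔-mono-≤ p q)
  SizeU truncᵘ = curryM (ℕ≥ ∷ ℕ≥ ∷ []) ℕ≥ (λ (_ , n , _) → n) (λ (_ , p , _) → p)
  SizeU subᵘ   = curryM (ℕ≥ ∷ ℕ≤ ∷ []) ℕ≥ (λ (p , m , _) → p ∸ m) (λ (p , q , _) → ∸-mono p q)
  SizeU lookᵘ  = curryM (𝒮ᵗ 𝕊𝕎𝕎 ∷ ℕ≥ ∷ 𝟙 ∷ ℕ≥ ∷ []) ℕ≥ (λ (g , _ , _ , n , _) → val g n)
                   (λ {(g , _)} (p , _ , _ , q , _) → ≥-app (val-mon g) (p tt) q)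
  SizeU pushᵘ  = curryM (𝟙 ∷ ℕ≥ ∷ []) ℕ≥ (λ (_ , w , _) → suc w) (λ (_ , p , _) → s≤s p)
  SizeU declᵘ  = curryM (ℕ≥ ∷ []) ℕ≥ (λ (d , _) → d) (λ (p , _) → p)
  SizeU decrᵘ  = curryM (ℕ≥ ∷ ℕ≥ ∷ []) ℕ≥ (λ (d , w , _) → d + w) (λ (p , q , _) → +-mono-≤ p q)
  SizeU decᵘ   = curryM (ℕ≥ ∷ []) ℕ≥ (λ (d , _) → d) (λ (p , _) → p)
  SizeU readᵘ  = curryM (ℕ≥ ∷ []) 𝟙 (λ _ → tt) (λ _ → tt)
  SizeU readsᵘ = curryM (ℕ≥ ∷ []) 𝟙 (λ _ → tt) (λ _ → tt)
  SizeU tailᵘ  = curryM (ℕ≥ ∷ []) ℕ≥ (λ (d , _) → d) (λ (p , _) → p)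
  -- The worst case is a left move off the end: it adds a blank and the written symbol, and `tailᵘ`
  -- is not credited with the dropped cell.
  SizeU actᵘ   = curryM (𝟙 ∷ ℕ≥ ∷ []) ℕ≥ (λ (_ , t , _) → 2 + t) (λ (_ , p , _) → s≤s (s≤s p))
  SizeU actsᵘ  = curryM (ℕ≥ ∷ ℕ≥ ∷ []) ℕ≥ (λ (a , t , _) → a + a + t) (λ (p , q , _) → +-mono-≤ (+-mono-≤ p p) q)
  SizeU nthᵘ   = curryM (𝟙 ∷ ℕ≥ ∷ []) ℕ≥ (λ (_ , t , _) → t) (λ (_ , p , _) → p)
  SizeU updᵘ   = curryM (𝟙 ∷ ℕ≥ ∷ ℕ≥ ∷ []) ℕ≥ (λ (_ , t , d , _) → t + d) (λ (_ , p , q , _) → +-mono-≤ p q)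
  SizeU encᵘ   = curryM (ℕ≥ ∷ ℕ≥ ∷ []) ℕ≥ (λ (w , d , _) → w + d) (λ (p , q , _) → +-mono-≤ p q)
  SizeU deltaᵘ = curryM (𝟙 ∷ []) ℕ≥ (λ _ → D) (λ _ → ≤-refl)
  -- The interpretation cannot see which oracle is selected; the sum dominates each of them and is
  -- still expressible as a second-order polynomial.
  SizeU combᵘ  = curryM (𝒮ᵗ 𝕎𝕎 ∷ 𝒮ᵗ 𝕊𝕎𝕎 ∷ 𝟙 ∷ ℕ≥ ∷ []) ℕ≥ (λ (f , g , _ , n , _) → proj₁ f n + val g n)
                   (λ {(f , g , _)} (p , q , _ , r , _) → +-mono-≤ (≥-app (proj₂ f) p r) (≥-app (val-mon g) (q tt) r))
  SizeU noneᵘ  = curryM (𝟙 ∷ ℕ≥ ∷ []) ℕ≥ (λ _ → 0) (λ _ → z≤n)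
  SizeU execᵘ  = curryM (𝒮ᵗ 𝕊𝕎𝕎 ∷ ℕ≥ ∷ ℕ≤ ∷ 𝟙 ∷ ℕ≥ ∷ ℕ≥ ∷ []) ℕ≥
                   (λ (g , X , m , _ , h , t , _) → execCost zero¹ (val g) X m (h + t))
                   (λ {(g , _)} (p , x , m , _ , h , t , _) →
                     execCost-mono (λ _ → z≤n) (val-mon g) (λ _ → z≤n) (p tt) x m (+-mono-≤ h t))
  SizeU checkᵘ = curryM (𝒮ᵗ 𝕊𝕎𝕎 ∷ ℕ≥ ∷ ℕ≤ ∷ 𝟙 ∷ ℕ≥ ∷ ℕ≥ ∷ ℕ≥ ∷ []) ℕ≥
                   (λ (g , X , m , _ , h , t , p , _) → checkCost zero¹ (val g) X m h t p)
                   (λ {(g , _)} (p , x , m , _ , h , t , q , _) →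
                     checkCost-mono (λ _ → z≤n) (val-mon g) (λ _ → z≤n) (p tt) x m h t q)
  SizeU stepᵘ  = curryM (𝒮ᵗ 𝕊𝕎𝕎 ∷ ℕ≥ ∷ ℕ≤ ∷ ℕ≥ ∷ ℕ≥ ∷ ℕ≥ ∷ []) ℕ≥
                   (λ (g , X , m , h , t , a , _) → stepCost zero¹ (val g) X m h t a)
                   (λ {(g , _)} (p , x , m , h , t , q , _) →
                     stepCost-mono (λ _ → z≤n) (val-mon g) (λ _ → z≤n) (p tt) x m h t q)
  SizeU askᵘ   = curryM (𝒮ᵗ 𝕊𝕎𝕎 ∷ ℕ≥ ∷ ℕ≤ ∷ 𝟙 ∷ ℕ≥ ∷ ℕ≥ ∷ ℕ≥ ∷ []) ℕ≥
                   (λ (g , X , m , _ , h , t , u , _) → askCost zero¹ (val g) X m h t u)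
                   (λ {(g , _)} (p , x , m , _ , h , t , q , _) →
                     askCost-mono (λ _ → z≤n) (val-mon g) (λ _ → z≤n) (p tt) x m h t q)

  CostU : (u : U) → Car (𝒞ᵗ (ty u))
  CostU leafᵘ  = 0
  CostU pairᵘ  = curryM (𝟙 ∷ 𝟙 ∷ []) ℕ≥ (λ _ → 0) (λ _ → z≤n)
  CostU nilᵘ   = 0
  CostU cellᵘ  = curryM (𝟙 ∷ ℕ≥ ∷ []) ℕ≥ (λ _ → 0) (λ _ → z≤n)
  CostU tapeᵘ  = curryM (ℕ≥ ∷ ℕ≥ ∷ ℕ≥ ∷ []) ℕ≥ (λ _ → 0) (λ _ → z≤n)
  CostU tapesᵘ = curryM (ℕ≥ ∷ ℕ≥ ∷ []) ℕ≥ (λ _ → 0) (λ _ → z≤n)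
  CostU histᵘ  = curryM (ℕ≥ ∷ ℕ≥ ∷ []) ℕ≥ (λ _ → 0) (λ _ → z≤n)
  CostU zeroᵘ  = 0
  CostU sucᵘ   = curryM (ℕ≤ ∷ []) ℕ≥ (λ _ → 0) (λ _ → z≤n)
  CostU addᵘ   = curryM (ℕ≥ ∷ ℕ≥ ∷ []) ℕ≥ (λ (x , _ , _) → suc x) (λ (p , _) → s≤s p)
  -- Each letter of the first factor pays 1 for the rule and y + 1 for an addition.
  CostU mulᵘ   = curryM (ℕ≥ ∷ ℕ≥ ∷ []) ℕ≥ (λ (x , y , _) → suc x * suc (suc y))
                   (λ (p , q , _) → *-mono-≤ (s≤s p) (s≤s (s≤s q)))
  CostU maxᵘ   = curryM (ℕ≥ ∷ ℕ≥ ∷ []) ℕ≥ (λ (x , _ , _) → suc x) (λ (p , _) → s≤s p)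
  CostU truncᵘ = curryM (ℕ≥ ∷ ℕ≥ ∷ []) ℕ≥ (λ (_ , n , _) → suc n) (λ (_ , p , _) → s≤s p)
  CostU subᵘ   = curryM (ℕ≥ ∷ ℕ≤ ∷ []) ℕ≥ (λ (p , _ , _) → suc p) (λ (p , _) → s≤s p)
  CostU lookᵘ  = curryM (𝒞ᵗ 𝕊𝕎𝕎 ∷ 𝒮ᵗ 𝕊𝕎𝕎 ∷ ℕ≥ ∷ 𝟙 ∷ ℕ≥ ∷ []) ℕ≥ (λ (c , g , h , _ , n , _) → lookCost (val c) (val g) h n)
                   (λ {(c , g , _)} (p , q , h , _ , n , _) → lookCost-mono (val-mon c) (val-mon g) (p tt) (q tt) h n)
  CostU pushᵘ  = curryM (𝟙 ∷ ℕ≥ ∷ []) ℕ≥ (λ _ → 1) (λ _ → ≤-refl)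
  CostU declᵘ  = curryM (ℕ≥ ∷ []) ℕ≥ (λ (d , _) → suc (d + d)) (λ (p , _) → s≤s (+-mono-≤ p p))
  CostU decrᵘ  = curryM (ℕ≥ ∷ ℕ≥ ∷ []) ℕ≥ (λ (d , _ , _) → suc (d + d)) (λ (p , _) → s≤s (+-mono-≤ p p))
  CostU decᵘ   = curryM (ℕ≥ ∷ []) ℕ≥ (λ (d , _) → suc (d + d)) (λ (p , _) → s≤s (+-mono-≤ p p))
  CostU readᵘ  = curryM (ℕ≥ ∷ []) ℕ≥ (λ _ → 1) (λ _ → ≤-refl)
  CostU readsᵘ = curryM (ℕ≥ ∷ []) ℕ≥ (λ (d , _) → suc (d + d)) (λ (p , _) → s≤s (+-mono-≤ p p))
  CostU tailᵘ  = curryM (ℕ≥ ∷ []) ℕ≥ (λ _ → 1) (λ _ → ≤-refl)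
  CostU actᵘ   = curryM (𝟙 ∷ ℕ≥ ∷ []) ℕ≥ (λ _ → 2) (λ _ → ≤-refl)
  -- Per action, 2 for `actᵘ` with its `tailᵘ` and 1 for the rule.
  CostU actsᵘ  = curryM (ℕ≥ ∷ ℕ≥ ∷ []) ℕ≥ (λ (a , _ , _) → suc (a + a + a)) (λ (p , _) → s≤s (+-mono-≤ (+-mono-≤ p p) p))
  CostU nthᵘ   = curryM (𝟙 ∷ ℕ≥ ∷ []) ℕ≥ (λ (_ , t , _) → t) (λ (_ , p , _) → p)
  CostU updᵘ   = curryM (𝟙 ∷ ℕ≥ ∷ ℕ≥ ∷ []) ℕ≥ (λ (_ , _ , d , _) → d) (λ (_ , _ , p , _) → p)
  CostU encᵘ   = curryM (ℕ≥ ∷ ℕ≥ ∷ []) ℕ≥ (λ (w , _ , _) → suc w) (λ (p , _) → s≤s p)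
  CostU deltaᵘ = curryM (𝟙 ∷ []) ℕ≥ (λ _ → 1) (λ _ → ≤-refl)
  CostU combᵘ  = curryM (𝒞ᵗ 𝕎𝕎 ∷ 𝒮ᵗ 𝕎𝕎 ∷ 𝒞ᵗ 𝕊𝕎𝕎 ∷ 𝒮ᵗ 𝕊𝕎𝕎 ∷ 𝟙 ∷ ℕ≥ ∷ []) ℕ≥
                   (λ (f , _ , g , _ , _ , n , _) → suc (proj₁ f n + val g n))
                   (λ {(f , _ , g , _)} (p , _ , q , _ , _ , r , _) →
                     s≤s (+-mono-≤ (≥-app (proj₂ f) p r) (≥-app (val-mon g) (q tt) r)))
  CostU noneᵘ  = curryM (𝟙 ∷ ℕ≥ ∷ []) ℕ≥ (λ _ → 0) (λ _ → z≤n)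
  CostU execᵘ  = curryM (𝒞ᵗ 𝕊𝕎𝕎 ∷ 𝒮ᵗ 𝕊𝕎𝕎 ∷ ℕ≥ ∷ ℕ≤ ∷ 𝟙 ∷ ℕ≥ ∷ ℕ≥ ∷ []) ℕ≥
                   (λ (c , g , X , m , _ , h , t , _) → execCost (val c) (val g) X m (h + t))
                   (λ {(c , g , _)} (p , q , x , m , _ , h , t , _) →
                     execCost-mono (val-mon c) (val-mon g) (p tt) (q tt) x m (+-mono-≤ h t))
  CostU checkᵘ = curryM (𝒞ᵗ 𝕊𝕎𝕎 ∷ 𝒮ᵗ 𝕊𝕎𝕎 ∷ ℕ≥ ∷ ℕ≤ ∷ 𝟙 ∷ ℕ≥ ∷ ℕ≥ ∷ ℕ≥ ∷ []) ℕ≥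
                   (λ (c , g , X , m , _ , h , t , p , _) → checkCost (val c) (val g) X m h t p)
                   (λ {(c , g , _)} (p , q , x , m , _ , h , t , r , _) →
                     checkCost-mono (val-mon c) (val-mon g) (p tt) (q tt) x m h t r)
  CostU stepᵘ  = curryM (𝒞ᵗ 𝕊𝕎𝕎 ∷ 𝒮ᵗ 𝕊𝕎𝕎 ∷ ℕ≥ ∷ ℕ≤ ∷ ℕ≥ ∷ ℕ≥ ∷ ℕ≥ ∷ []) ℕ≥
                   (λ (c , g , X , m , h , t , a , _) → stepCost (val c) (val g) X m h t a)
                   (λ {(c , g , _)} (p , q , x , m , h , t , r , _) →
                     stepCost-mono (val-mon c) (val-mon g) (p tt) (q tt) x m h t r)
  CostU askᵘ   = curryM (𝒞ᵗ 𝕊𝕎𝕎 ∷ 𝒮ᵗ 𝕊𝕎𝕎 ∷ ℕ≥ ∷ ℕ≤ ∷ 𝟙 ∷ ℕ≥ ∷ ℕ≥ ∷ ℕ≥ ∷ []) ℕ≥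
                   (λ (c , g , X , m , _ , h , t , u , _) → askCost (val c) (val g) X m h t u)
                   (λ {(c , g , _)} (p , q , x , m , _ , h , t , r , _) →
                     askCost-mono (val-mon c) (val-mon g) (p tt) (q tt) x m h t r)

-- The interpretation of `F` is a parameter: no named rule contains `F`, so their compatibility can
-- be proved before it is chosen.
module Interp {k l : ℕ} (P : SOP k l) (D : ℕ) (SF : Car (𝒮ᵗ (FTy k l))) (CF : Car (𝒞ᵗ (FTy k l))) where
  open Clock P D
  open Interpretation P D
  open Terms {k} {l}

  Js : (f : Sym 34) → Car (𝒮ᵗ (symType k l userType f))
  Js o       = 0
  Js i       = 0
  Js nil     = 0
  Js cons    = curryM (ℕ≥ ∷ ℕ≥ ∷ []) ℕ≥ (λ (b , w , _) → b + w + 1) (λ (p , q , _) → +-mono-≤ (+-mono-≤ p q) (≤-refl {1}))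
  Js F       = SF
  Js (usr j) = SizeU (lookup symbols j)

  Jc : (f : Sym 34) → Car (𝒞ᵗ (symType k l userType f))
  Jc o       = 0
  Jc i       = 0
  Jc nil     = 0
  Jc cons    = curryM (ℕ≥ ∷ ℕ≥ ∷ []) ℕ≥ (λ _ → 0) (λ _ → z≤n)
  Jc F       = CF
  Jc (usr j) = CostU (lookup symbols j)

  CompatibleRaw : Raw → Set
  CompatibleRaw r =
    ∀ (α : ∀ {σ} → Var (rctx r) σ → Car (𝒮ᵗ σ)) (ζ : ∀ {σ} → Var (rctx r) σ → Car (𝒞ᵗ σ)) →
      sumCost (sortQO carrier) Js Jc α ζ (rrhs r) < cost (sortQO carrier) Js Jc α ζ (rlhs r) ×
      _⊒_ (sortQO carrier (rsort r)) (size (sortQO carrier) Js Jc α ζ (rlhs r)) (size (sortQO carrier) Js Jc α ζ (rrhs r))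

  -- Turns an inequality into a ring identity by naming its slack.
  by : ∀ {a b} d → a + d ≡ b → a ≤ b
  by {a} d e = ≤-trans (m≤m+n a d) (≤-reflexive e)

  sum-numeral : ∀ {Γ} (α : ∀ {σ} → Var Γ σ → Car (𝒮ᵗ σ)) (ζ : ∀ {σ} → Var Γ σ → Car (𝒞ᵗ σ)) v →
                sumCost (sortQO carrier) Js Jc α ζ 𝕊⟦ v ⟧ ≡ 0
  sum-numeral α ζ leaf       = refl
  sum-numeral α ζ (pair a b) = cong₂ _+_ (sum-numeral α ζ a) (sum-numeral α ζ b)

  module _ {Γ : List (Ty 3)} (α : ∀ {σ} → Var Γ σ → Car (𝒮ᵗ σ)) (ζ : ∀ {σ} → Var Γ σ → Car (𝒞ᵗ σ))
           (g : Var Γ 𝕊𝕎𝕎) (x : Var Γ 𝕎) (h : Var Γ 𝔻) where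

    size-wlit : ∀ n → size (sortQO carrier) Js Jc α ζ (wlit n) ≡ n
    size-wlit zero    = refl
    size-wlit (suc n) = trans (+-comm _ 1) (cong suc (size-wlit n))

    sum-wlit : ∀ n → sumCost (sortQO carrier) Js Jc α ζ (wlit n) ≡ 0
    sum-wlit zero    = refl
    sum-wlit (suc n) = sum-wlit n

    size-bound : ∀ Q → size (sortQO carrier) Js Jc α ζ (bound Q (var g) (var x) (var h)) ≡ pval Q (val (α g)) (α x)
    size-bound (cst n)    = size-wlit n
    size-bound (var j)    = refl
    size-bound (P ⊕ Q)    = cong₂ _+_ (size-bound P) (size-bound Q)
    size-bound (P ⊛ Q)    = cong₂ _*_ (size-bound P) (size-bound Q)
    size-bound (fapp j Q) = cong (val (α g)) (size-bound Q)

    sum-bound : ∀ Q → sumCost (sortQO carrier) Js Jc α ζ (bound Q (var g) (var x) (var h))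
                      ≡ boundCost Q (val (ζ g)) (val (α g)) (α x) (α h)
    sum-bound (cst n)    = sum-wlit n
    sum-bound (var j)    = refl
    sum-bound (P ⊕ Q)    = cong₂ _+_ (cong₂ _+_ (cong suc (size-bound P)) (sum-bound P)) (sum-bound Q)
    sum-bound (P ⊛ Q)    = cong₂ _+_ (cong₂ _+_ (cong₂ (λ p q → suc p * suc (suc q)) (size-bound P) (size-bound Q))
                             (sum-bound P)) (sum-bound Q)
    sum-bound (fapp j Q) = cong₂ _+_ (trans (cong₂ _+_ (cong (lookCost (val (ζ g)) (val (α g)) (α h)) (size-bound Q))
                             (sum-numeral α ζ (num (toℕ j)))) (+-identityʳ _)) (sum-bound Q)

  module _ {gc gs : ℕ → ℕ} (mc : Mon gc) (ms : Mon gs) where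

    private
      refl¹ : ∀ {f : ℕ → ℕ} → f ≥¹ f
      refl¹ n = ≤-refl

      perStep-lower : ∀ X h t z → h + t ≤ z →
        1 + boundCost P gc gs X h + suc (pval P gs X) + base₀ t + work gc gs t ≤ perStep gc gs X z
      perStep-lower X h t z le = +-mono-≤ (+-mono-≤ (+-mono-≤
          (s≤s (boundCost-mono P mc ms refl¹ refl¹ ≤-refl (m+n≤o⇒m≤o h le))) (≤-refl {suc (pval P gs X)}))
          (base₀-mono mc ms refl¹ refl¹ (≤-refl {X}) (m+n≤o⇒n≤o h le)))
        (work-mono mc ms refl¹ refl¹ (≤-refl {X}) (m+n≤o⇒n≤o h le))

    execCost-mono-s : ∀ X m {s s′} → s′ ≤ s → execCost gc gs X m s′ ≤ execCost gc gs X m s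
    execCost-mono-s X m le = execCost-mono mc ms refl¹ refl¹ (≤-refl {X}) (≤-refl {m}) le

    -- The central inequality. With clock value 0 one `perStep` pays for evaluating the bound and
    -- halting. With clock value 1 + r, one `perStep` pays for the present step and the other 1 + r
    -- for the rest of the run.
    exec-check : ∀ X m h t sB scB → sB ≡ pval P gs X → scB ≡ boundCost P gc gs X h →
      suc (checkCost gc gs X m h t (sB ∸ m) + 0 + (suc sB + scB + 0)) ≤ execCost gc gs X m (h + t)
    exec-check X m h t sB scB refl refl with pval P gs X ∸ m in eq
    ... | zero = ≤-trans (by (work gc gs t) (arith (base₀ t) (work gc gs t) (pval P gs X) (boundCost P gc gs X h)))
                   (≤-trans (perStep-lower X h t (h + t + 0) (≤-reflexive (≡sym (+-identityʳ _))))
                     (≤-reflexive (≡sym (+-identityʳ _))))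
      where
      arith : ∀ b w p c → suc (b + 0 + 0 + (suc p + c + 0)) + w ≡ 1 + c + suc p + b + w
      arith = solve-∀
    -- Since s + (1 + r) K = (s + K) + r K, one step fewer and a size larger by K lead to the same
    -- argument z of `perStep` as before.
    ... | suc r = ≤-trans (≤-reflexive (arith (base₀ t) (work gc gs t) (pval P gs X) (boundCost P gc gs X h) E₁))
                   (+-mono-≤ (perStep-lower X h t z h+t≤z) (≤-reflexive E₁≡))
      where
      z = h + t + (K + r * K)
      h+t≤z : h + t ≤ z
      h+t≤z = m≤m+n (h + t) _
      E₁ = execCost gc gs X (suc m) (h + t + K)
      r≡ : pval P gs X ∸ suc m ≡ r
      r≡ = trans (≡sym (pred[m∸n]≡m∸[1+n] (pval P gs X) m)) (cong Data.Nat.pred eq)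
      E₁≡ : E₁ ≡ suc r * perStep gc gs X z
      E₁≡ = trans (cong (λ r → remaining gc gs X r (h + t + K)) r≡)
                  (cong (λ z → suc r * perStep gc gs X z) (+-assoc (h + t) K (r * K)))
      arith : ∀ b w p c E → suc (b + (w + E) + 0 + (suc p + c + 0)) ≡ 1 + c + suc p + b + w + E
      arith = solve-∀

    keep-cons : ∀ b p n → keep (b + p + 1) n ≡ n
    keep-cons b p n = cong (λ q → keep q n) (+-comm (b + p) 1)

    check-step : ∀ X m h t b p → suc (stepCost gc gs X (suc m) h t D + 0 + suc (suc (t + t) + 0 + 0))
                                 ≤ checkCost gc gs X m h t (b + p + 1)
    check-step X m h t b p = ≤-trans (by (t + t + t + (gs t + gc t)) (arith t D E₁ (gs t + gc t)))
      (≤-trans (+-monoʳ-≤ (base₀ t) (+-monoʳ-≤ (work gc gs t) (execCost-mono-s X (suc m) le)))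
        (≤-reflexive (cong (base₀ t +_) (≡sym (keep-cons b p _)))))
      where
      E₁ = execCost gc gs X (suc m) (h + (D + D + t))
      le : h + (D + D + t) ≤ h + t + K
      le = by 3 (arith′ h t D)
        where
        arith′ : ∀ h t D → h + (D + D + t) + 3 ≡ h + t + (D + D + 3)
        arith′ = solve-∀
      arith : ∀ t D E w → suc (2 + (D + D + D) + E + 0 + suc (suc (t + t) + 0 + 0)) + (t + t + t + w)
                        ≡ 2 + (t + t + t) + (3 + (D + D + D) + (t + t) + w + E)
      arith = solve-∀

    -- The last argument of `askCost` is the query. It is decoded from one of the tapes, so its
    -- interpreted size is that of the whole list, t.
    check-ask′ : ∀ X m h t b p → suc (askCost gc gs X (suc m) h t t + 0 + (suc (t + t) + 0 + (t + 0 + 0)))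
                                 ≤ checkCost gc gs X m h t (b + p + 1)
    check-ask′ X m h t b p = ≤-trans (≤-reflexive (arith t D E₁ (gs t + gc t)))
      (≤-trans (≤-trans (m≤m+n _ (D + D + D)) (≤-reflexive (arith₂ (base₀ t) D (t + t) (gs t + gc t) E₁)))
      (≤-trans (+-monoʳ-≤ (base₀ t) (+-monoʳ-≤ (work gc gs t) (execCost-mono-s X (suc m) le)))
        (≤-reflexive (cong (base₀ t +_) (≡sym (keep-cons b p _))))))
      where
      E₁ = execCost gc gs X (suc m) (suc h + suc (suc t))
      le : suc h + suc (suc t) ≤ h + t + K
      le = by (D + D) (arith′ h t D)
        where
        arith′ : ∀ h t D → suc h + suc (suc t) + (D + D) ≡ h + t + (D + D + 3)
        arith′ = solve-∀
      arith : ∀ t D E w → suc (3 + (t + t) + w + E + 0 + (suc (t + t) + 0 + (t + 0 + 0)))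
                        ≡ 2 + (t + t + t) + (3 + (t + t) + w + E)
      arith = solve-∀
      arith₂ : ∀ b D t w E → b + (3 + t + w + E) + (D + D + D) ≡ b + (3 + (D + D + D) + t + w + E)
      arith₂ = solve-∀

    step-exec : ∀ X m h t a → suc (execCost gc gs X m (h + (a + a + t)) + 0 + (suc (a + a + a) + 0 + 0))
                              ≤ stepCost gc gs X m h t (suc a)
    step-exec X m h t a = ≤-trans (by 3 (arith a E₁))
      (+-monoʳ-≤ (2 + (suc a + suc a + suc a)) (execCost-mono-s X m (+-monoʳ-≤ h (+-monoˡ-≤ t (+-mono-≤ (n≤1+n a) (n≤1+n a))))))
      where
      E₁ = execCost gc gs X m (h + (a + a + t))
      arith : ∀ a E → suc (E + 0 + (suc (a + a + a) + 0 + 0)) + 3 ≡ 2 + (suc a + suc a + suc a) + E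
      arith = solve-∀

    ask-exec : ∀ X m h t u →
      suc (execCost gc gs X m (suc h + suc (suc t)) + 0 + (suc t + 0 + (t + (suc (gs u) + (gc u + 0 + 0) + 0) + 0)))
      ≤ askCost gc gs X m h t u
    ask-exec X m h t u = ≤-reflexive (arith t (gs u) (gc u) (execCost gc gs X m (suc h + suc (suc t))))
      where
      arith : ∀ t a b E → suc (E + 0 + (suc t + 0 + (t + (suc a + (b + 0 + 0) + 0) + 0))) ≡ 3 + (t + t) + (a + b) + E
      arith = solve-∀

  -- With oracle cost 0, the first summand in the cost of such a right-hand side is its size;
  -- dropping the others gives the size condition.
  first-≤ : ∀ {a b c} → suc (a + 0 + b) ≤ c → a ≤ c
  first-≤ {a} {b} p = ≤-trans (≤-trans (≤-reflexive (≡sym (+-identityʳ a))) (m≤m+n (a + 0) b)) (≤-trans (n≤1+n _) p)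

  mono₀ : Mon zero¹
  mono₀ _ = z≤n

  -- An unflagged tape has size 1 whatever is written on it; a flagged one has room for `d` more
  -- cells.
  tape-≤ : ∀ f x y d → y ≤ x + d → suc (keep f y) ≤ suc (d + keep f x)
  tape-≤ zero    x y d le = s≤s z≤n
  tape-≤ (suc f) x y d le = s≤s (≤-trans le (≤-reflexive (+-comm x d)))

  private
    n00 : ∀ n → n + 0 + 0 ≡ n
    n00 n = trans (+-identityʳ _) (+-identityʳ n)

    cons-cost : ∀ b x → suc (suc (x + 0 + 0)) ≤ suc (b + x + 1)
    cons-cost b x = by b (arith b x)
      where
      arith : ∀ b x → suc (suc (x + 0 + 0)) + b ≡ suc (b + x + 1)
      arith = solve-∀

    +1≤suc : ∀ x → x + 1 ≤ suc x
    +1≤suc x = ≤-reflexive (+-comm x 1)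

    skip-cost : ∀ a x → suc (x + 0 + 0) ≤ suc (a + x)
    skip-cost a x = s≤s (≤-trans (≤-reflexive (n00 x)) (m≤n+m x a))

    double-cost : ∀ a x → suc (suc (suc (x + x + 0 + 0))) ≤ suc (suc (a + x + suc (a + x)))
    double-cost a x = by (a + a) (arith a x)
      where
      arith : ∀ a x → suc (suc (suc (x + x + 0 + 0))) + (a + a) ≡ suc (suc (a + x + suc (a + x)))
      arith = solve-∀

  compatible-raw : ∀ r → CompatibleRaw (raw P r)
  compatible-raw add-nil α ζ = ≤-refl , ≤-refl
  compatible-raw add-cons α ζ = cons-cost _ (α (vs vz)) , ≤-reflexive (arith (α vz) (α (vs vz)) (α (vs (vs vz))))
    where
    arith : ∀ b x y → b + (x + y) + 1 ≡ b + x + 1 + y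
    arith = solve-∀
  compatible-raw mul-nil α ζ = s≤s z≤n , ≤-refl
  compatible-raw mul-cons α ζ = by (α vz * suc (suc (α (vs (vs vz))))) (arith (α vz) (α (vs vz)) (α (vs (vs vz))))
                              , by (α vz * α (vs (vs vz))) (arith′ (α vz) (α (vs vz)) (α (vs (vs vz))))
    where
    arith : ∀ b x y → suc (suc (y + 0 + suc (suc (y + x * suc (suc y) + 0 + 0)))) + b * suc (suc y)
                      ≡ suc (suc (y + (b + x + 1) * suc (suc y)))
    arith = solve-∀
    arith′ : ∀ b x y → y + x * y + b * y ≡ (b + x + 1) * y
    arith′ = solve-∀
  compatible-raw max-nil α ζ = ≤-refl , ≤-refl
  compatible-raw max-cons-nil α ζ = s≤s z≤n , m≤m⊔n _ 0
  compatible-raw max-cons α ζ = cons-cost _ (α (vs vz))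
    , ≤-trans (≤-reflexive (+-distribʳ-⊔ 1 (α (vs vz)) (α (vs (vs (vs vz))))))
        (⊔-mono-≤ (+-monoˡ-≤ 1 (m≤n+m _ (α vz))) (+-monoˡ-≤ 1 (m≤n+m _ (α (vs (vs vz))))))
  compatible-raw trunc-nil α ζ = s≤s z≤n , z≤n
  compatible-raw trunc-cons-nil α ζ = ≤-refl , ≤-refl
  compatible-raw trunc-o α ζ = cons-cost _ (α (vs (vs vz))) , +-monoˡ-≤ 1 (m≤n+m _ (α (vs vz)))
  compatible-raw trunc-i α ζ = cons-cost _ (α (vs (vs vz))) , +-monoˡ-≤ 1 (m≤n+m _ (α (vs vz)))
  compatible-raw sub-zero α ζ = s≤s z≤n , ≤-refl
  compatible-raw sub-nil α ζ = ≤-refl , ≤-refl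
  compatible-raw sub-cons α ζ = cons-cost _ (α (vs vz))
    , ≤-trans (∸-monoˡ-≤ (α (vs (vs vz))) (m≤n+m _ (α vz)))
        (≤-reflexive (cong (_∸ suc (α (vs (vs vz)))) (+-comm 1 (α vz + α (vs vz)))))
  compatible-raw look-nil α ζ = s≤s z≤n , z≤n
  compatible-raw look-cons α ζ =
    ≤-reflexive (arith (val (α vz) (α (vs (vs (vs (vs vz)))))) (val (ζ vz) (α (vs (vs (vs (vs vz)))))) (α (vs (vs (vs (vs vz))))) (α (vs (vs vz))))
    -- Both words under the maximum have size `val (α vz) n`, n the size of the cut. Idempotence
    -- keeps the size of a lookup independent of the length of the log.
    , ≤-reflexive (⊔-idem _)
    where
    arith : ∀ a b n h → suc (suc a + (b + 0 + suc (n + 0 + 0)) + (suc h * suc (suc a + b + suc n) + 0 + 0))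
                        ≡ suc (suc h) * suc (suc a + b + suc n)
    arith = solve-∀
  compatible-raw push-0 α ζ = ≤-refl , n≤1+n _
  compatible-raw push-1 α ζ = ≤-refl , +1≤suc (α vz)
  compatible-raw push-2 α ζ = ≤-refl , +1≤suc (α vz)
  compatible-raw push-3 α ζ = ≤-refl , n≤1+n _
  compatible-raw decl-nil α ζ = ≤-refl , ≤-refl
  compatible-raw decl-cell α ζ = double-cost 0 (α (vs vz)) , ≤-refl
  compatible-raw decr-nil α ζ = ≤-refl , ≤-refl
  compatible-raw decr-cell α ζ = ≤-reflexive (cong (λ n → suc (suc n)) (arith (α (vs vz)))) , ≤-reflexive (+-suc (α (vs vz)) (α (vs (vs vz))))
    where
    arith : ∀ x → x + x + 0 + 1 ≡ x + suc x
    arith = solve-∀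
  compatible-raw dec-tape α ζ = ≤-reflexive (cong (λ n → suc (suc n)) (arith (α (vs (vs vz))) (α (vs (vs (vs vz)))))) , n≤1+n _
    where
    arith : ∀ x y → x + x + 0 + suc (y + y + 0 + 0) ≡ x + y + suc (x + y)
    arith = solve-∀
  compatible-raw read-nil α ζ = ≤-refl , tt
  compatible-raw read-cell α ζ = ≤-refl , tt
  compatible-raw reads-nil α ζ = ≤-refl , tt
  compatible-raw reads-cons α ζ = double-cost (α vz) (α (vs vz)) , tt
  compatible-raw tail-nil α ζ = ≤-refl , ≤-refl
  compatible-raw tail-cell α ζ = ≤-refl , n≤1+n _
  compatible-raw act-left-nil α ζ = ≤-refl , tape-≤ (α (vs vz)) _ _ 2 (≤-reflexive (+-comm 2 _))
  compatible-raw act-left-cell α ζ = ≤-refl ,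
    tape-≤ (α (vs vz)) _ _ 2 (by 1 (arith (α (vs (vs (vs vz)))) (α (vs (vs (vs (vs vz)))))))
    where
    arith : ∀ x y → x + suc (suc y) + 1 ≡ suc (x + y) + 2
    arith = solve-∀
  compatible-raw act-right α ζ = ≤-refl , tape-≤ (α (vs vz)) _ _ 2 (≤-trans (n≤1+n _) (≤-reflexive (+-comm 2 (α (vs (vs vz)) + α (vs (vs (vs vz)))))))
  compatible-raw act-stay α ζ = ≤-refl ,
    tape-≤ (α (vs vz)) _ _ 2 (by 1 (arith (α (vs (vs vz))) (α (vs (vs (vs vz))))))
    where
    arith : ∀ x y → x + suc y + 1 ≡ x + y + 2
    arith = solve-∀
  compatible-raw acts-nil α ζ = ≤-refl , ≤-refl
  compatible-raw acts-cons α ζ = ≤-reflexive (cong (λ n → suc (suc n)) (arith (α (vs vz))))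
    , ≤-reflexive (cong suc (arith′ (α (vs vz)) (α (vs (vs vz))) (α (vs (vs (vs vz))))))
    where
    arith : ∀ a → suc (suc (a + a + a + 0 + 0)) ≡ a + suc a + suc a
    arith = solve-∀
    arith′ : ∀ a t u → suc (suc (t + (a + a + u))) ≡ a + suc a + suc (t + u)
    arith′ = solve-∀
  compatible-raw nth-zero α ζ = s≤s z≤n , ≤-trans (m≤m+n _ _) (n≤1+n _)
  compatible-raw nth-suc α ζ = skip-cost (α (vs (vs vz))) (α (vs (vs (vs vz)))) , ≤-trans (m≤n+m _ (α (vs (vs vz)))) (n≤1+n _)
  compatible-raw upd-zero α ζ = s≤s z≤n , by (α (vs vz)) (arith (α vz) (α (vs vz)) (α (vs (vs vz))))
    where
    arith : ∀ x y z → suc (x + z) + y ≡ x + suc (y + z)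
    arith = solve-∀
  compatible-raw upd-suc α ζ = skip-cost (α (vs (vs (vs vz)))) (α (vs (vs (vs (vs vz)))))
    , ≤-reflexive (arith (α (vs (vs vz))) (α (vs (vs (vs vz)))) (α (vs (vs (vs (vs vz))))))
    where
    arith : ∀ x y z → suc (y + (x + z)) ≡ x + suc (y + z)
    arith = solve-∀
  compatible-raw enc-nil α ζ = ≤-refl , ≤-refl
  compatible-raw enc-o α ζ = cons-cost 0 (α vz) , ≤-reflexive (cong (_+ α (vs vz)) (+-comm 1 (α vz)))
  compatible-raw enc-i α ζ = cons-cost 0 (α vz) , ≤-reflexive (cong (_+ α (vs vz)) (+-comm 1 (α vz)))
  compatible-raw comb-zero α ζ = s≤s (≤-trans (≤-reflexive (n00 _)) (m≤m+n _ _)) , m≤m+n _ _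
  compatible-raw comb-suc α ζ = s≤s (≤-trans (≤-reflexive (n00 _)) (m≤n+m _ _)) , m≤n+m _ _
  compatible-raw exec-rule α ζ =
    exec-check (val-mon (ζ vz)) (val-mon (α vz)) (α (vs vz)) (α (vs (vs vz))) (α (vs (vs (vs (vs vz))))) (α (vs (vs (vs (vs (vs vz))))))
      _ _ (size-bound α ζ vz (vs vz) (vs (vs (vs (vs vz)))) P) (sum-bound α ζ vz (vs vz) (vs (vs (vs (vs vz)))) P)
    , first-≤ (exec-check mono₀ (val-mon (α vz)) (α (vs vz)) (α (vs (vs vz))) (α (vs (vs (vs (vs vz))))) (α (vs (vs (vs (vs (vs vz))))))
        _ _ (size-bound α ζ vz (vs vz) (vs (vs (vs (vs vz)))) P) refl)
  compatible-raw check-stop α ζ =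
    ≤-trans (≤-reflexive (arith (α (vs (vs (vs (vs vz))))))) (m≤m+n _ _)
    , ≤-trans (≤-trans (m≤n+m _ (α (vs (vs (vs (vs vz)))) + α (vs (vs (vs (vs vz)))))) (m≤n+m _ 2)) (m≤m+n _ _)
    where
    arith : ∀ t → suc (suc (t + t + 0 + (t + 0 + 0))) ≡ 2 + (t + t + t)
    arith = solve-∀
  compatible-raw check-run α ζ =
    check-step (val-mon (ζ vz)) (val-mon (α vz)) (α (vs vz)) (α (vs (vs vz))) (α (vs (vs (vs (vs vz)))))
      (α (vs (vs (vs (vs (vs vz)))))) (α (vs (vs (vs (vs (vs (vs vz))))))) (α (vs (vs (vs (vs (vs (vs (vs vz))))))))
    , first-≤ (check-step mono₀ (val-mon (α vz)) (α (vs vz)) (α (vs (vs vz))) (α (vs (vs (vs (vs vz)))))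
      (α (vs (vs (vs (vs (vs vz)))))) (α (vs (vs (vs (vs (vs (vs vz))))))) (α (vs (vs (vs (vs (vs (vs (vs vz)))))))))
  compatible-raw check-ask α ζ =
    check-ask′ (val-mon (ζ vz)) (val-mon (α vz)) (α (vs vz)) (α (vs (vs vz))) (α (vs (vs (vs (vs (vs (vs (vs vz))))))))
      (α (vs (vs (vs (vs (vs (vs (vs (vs vz))))))))) (α (vs (vs (vs (vs (vs (vs (vs (vs (vs vz)))))))))) (α (vs (vs (vs (vs (vs (vs (vs (vs (vs (vs vz)))))))))))
    , first-≤ (check-ask′ mono₀ (val-mon (α vz)) (α (vs vz)) (α (vs (vs vz))) (α (vs (vs (vs (vs (vs (vs (vs vz))))))))
      (α (vs (vs (vs (vs (vs (vs (vs (vs vz))))))))) (α (vs (vs (vs (vs (vs (vs (vs (vs (vs vz)))))))))) (α (vs (vs (vs (vs (vs (vs (vs (vs (vs (vs vz))))))))))))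
  compatible-raw step-rule α ζ =
    step-exec (val-mon (ζ vz)) (val-mon (α vz)) (α (vs vz)) (α (vs (vs vz))) (α (vs (vs (vs vz)))) (α (vs (vs (vs (vs vz)))))
      (α (vs (vs (vs (vs (vs (vs vz)))))))
    , first-≤ (step-exec mono₀ (val-mon (α vz)) (α (vs vz)) (α (vs (vs vz))) (α (vs (vs (vs vz)))) (α (vs (vs (vs (vs vz)))))
      (α (vs (vs (vs (vs (vs (vs vz))))))))
  compatible-raw ask-rule α ζ =
    ask-exec (val-mon (ζ vz)) (val-mon (α vz)) (α (vs vz)) (α (vs (vs vz))) (α (vs (vs (vs (vs (vs (vs (vs vz))))))))
      (α (vs (vs (vs (vs (vs (vs (vs (vs vz))))))))) (α (vs (vs (vs (vs (vs (vs (vs (vs (vs vz))))))))))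
    , first-≤ (ask-exec mono₀ (val-mon (α vz)) (α (vs vz)) (α (vs (vs vz))) (α (vs (vs (vs (vs (vs (vs (vs vz))))))))
      (α (vs (vs (vs (vs (vs (vs (vs (vs vz))))))))) (α (vs (vs (vs (vs (vs (vs (vs (vs (vs vz)))))))))))

-- The rule for F and the second-order polynomial bound

sumV : ∀ {n} → Vec ℕ n → ℕ
sumV []       = 0
sumV (x ∷ xs) = x + sumV xs

combSize combCost : ∀ {n} → Vec Fun1 n → ℕ → ℕ
combSize []       n = 0
combSize (f ∷ fs) n = proj₁ f n + combSize fs n
combCost []       n = 0
combCost (f ∷ fs) n = suc (proj₁ f n + combCost fs n)

combSize-mon : ∀ {n} (fs : Vec Fun1 n) → Mon (combSize fs)
combSize-mon []       p = z≤n
combSize-mon (f ∷ fs) p = +-mono-≤ (proj₂ f p) (combSize-mon fs p)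

combCost-mon : ∀ {n} (fs : Vec Fun1 n) → Mon (combCost fs)
combCost-mon []       p = z≤n
combCost-mon (f ∷ fs) p = s≤s (+-mono-≤ (proj₂ f p) (combCost-mon fs p))

Vec⊒ : ∀ (A : QO) {n} → Vec (Car A) n → Vec (Car A) n → Set
Vec⊒ A []       []       = ⊤
Vec⊒ A (x ∷ xs) (y ∷ ys) = _⊒_ A x y × Vec⊒ A xs ys

Vec⊒-refl : ∀ (A : QO) {n} (xs : Vec (Car A) n) → Vec⊒ A xs xs
Vec⊒-refl A []       = tt
Vec⊒-refl A (x ∷ xs) = ⊒-refl A x , Vec⊒-refl A xs

sumV-mono : ∀ {n} {xs ys : Vec ℕ n} → Vec⊒ ℕ≥ xs ys → sumV xs ≥ sumV ys
sumV-mono {xs = []}     {[]}     _       = z≤n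
sumV-mono {xs = x ∷ xs} {y ∷ ys} (p , q) = +-mono-≤ p (sumV-mono q)

combSize-mono : ∀ {n} {fs gs : Vec Fun1 n} → Vec⊒ (ℕ≥ ⟹ ℕ≥) fs gs → combSize fs ≥¹ combSize gs
combSize-mono {fs = []}     {[]}     _       n = z≤n
combSize-mono {fs = f ∷ fs} {g ∷ gs} (p , q) n = +-mono-≤ (p n) (combSize-mono q n)

combCost-mono : ∀ {n} {fs gs : Vec Fun1 n} → Vec⊒ (ℕ≥ ⟹ ℕ≥) fs gs → combCost fs ≥¹ combCost gs
combCost-mono {fs = []}     {[]}     _       n = z≤n
combCost-mono {fs = f ∷ fs} {g ∷ gs} (p , q) n = s≤s (+-mono-≤ (p n) (combCost-mono q n))

MonX : ∀ l → (Vec ℕ l → ℕ) → Set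
MonX l f = ∀ {xs ys} → Vec⊒ ℕ≥ xs ys → f xs ≥ f ys

-- `curryM` does not apply, since `WTy l` and `FTy k l` do not unfold for variable k and l. The same
-- currying is therefore repeated by recursion on them.
curryXˢ  : ∀ l f → MonX l f → Car (𝒮ᵗ (WTy l))
curryXˢ⊒ : ∀ l f g (mf : MonX l f) (mg : MonX l g) → (∀ xs → f xs ≥ g xs) →
           _⊒_ (𝒮ᵗ (WTy l)) (curryXˢ l f mf) (curryXˢ l g mg)
curryXˢ zero    f m = f []
curryXˢ (suc l) f m = (λ x → curryXˢ l (λ xs → f (x ∷ xs)) (λ q → m (≤-refl , q)))
                    , (λ p → curryXˢ⊒ l _ _ _ _ (λ xs → m (p , Vec⊒-refl ℕ≥ xs)))
curryXˢ⊒ zero    f g mf mg e = e []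
curryXˢ⊒ (suc l) f g mf mg e = λ x → curryXˢ⊒ l _ _ _ _ (λ xs → e (x ∷ xs))

curryXᶜ  : ∀ l f → MonX l f → Car (𝒞ᵗ (WTy l))
curryXᶜ⊒ : ∀ l f g (mf : MonX l f) (mg : MonX l g) → (∀ xs → f xs ≥ g xs) →
           _⊒_ (𝒞ᵗ (WTy l)) (curryXᶜ l f mf) (curryXᶜ l g mg)
curryXᶜ zero    f m = f []
curryXᶜ (suc l) f m = (λ x → curryXᶜ l (λ xs → f (x ∷ xs)) (λ q → m (≤-refl , q)))
                    , (λ p → curryXᶜ⊒ l _ _ _ _ (λ xs → m (p , Vec⊒-refl ℕ≥ xs)))
curryXᶜ⊒ zero    f g mf mg e = e []
curryXᶜ⊒ (suc l) f g mf mg e = λ x → curryXᶜ⊒ l _ _ _ _ (λ xs → e (x ∷ xs))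

MonFˢ : ∀ k l → (Vec Fun1 k → Vec ℕ l → ℕ) → Set
MonFˢ k l f = ∀ {Ss Ts xs ys} → Vec⊒ (ℕ≥ ⟹ ℕ≥) Ss Ts → Vec⊒ ℕ≥ xs ys → f Ss xs ≥ f Ts ys

curryFˢ  : ∀ k l f → MonFˢ k l f → Car (𝒮ᵗ (FTy k l))
curryFˢ⊒ : ∀ k l f g (mf : MonFˢ k l f) (mg : MonFˢ k l g) → (∀ Ss xs → f Ss xs ≥ g Ss xs) →
           _⊒_ (𝒮ᵗ (FTy k l)) (curryFˢ k l f mf) (curryFˢ k l g mg)
curryFˢ zero    l f m = curryXˢ l (f []) (m tt)
curryFˢ (suc k) l f m = (λ s → curryFˢ k l (λ Ss → f (s ∷ Ss)) (λ q → m ((λ _ → ≤-refl) , q)))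
                      , (λ p → curryFˢ⊒ k l _ _ _ _ (λ Ss xs → m (p , Vec⊒-refl (ℕ≥ ⟹ ℕ≥) Ss) (Vec⊒-refl ℕ≥ xs)))
curryFˢ⊒ zero    l f g mf mg e = curryXˢ⊒ l _ _ _ _ (e [])
curryFˢ⊒ (suc k) l f g mf mg e = λ s → curryFˢ⊒ k l _ _ _ _ (λ Ss → e (s ∷ Ss))

MonFᶜ : ∀ k l → (Vec Fun1 k → Vec Fun1 k → Vec ℕ l → ℕ) → Set
MonFᶜ k l f = ∀ {Cs Ds Ss Ts xs ys} → Vec⊒ (ℕ≥ ⟹ ℕ≥) Cs Ds → Vec⊒ (ℕ≥ ⟹ ℕ≥) Ss Ts → Vec⊒ ℕ≥ xs ys → f Cs Ss xs ≥ f Ds Ts ys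

curryFᶜ  : ∀ k l f → MonFᶜ k l f → Car (𝒞ᵗ (FTy k l))
curryFᶜ⊒ : ∀ k l f g (mf : MonFᶜ k l f) (mg : MonFᶜ k l g) → (∀ Cs Ss xs → f Cs Ss xs ≥ g Cs Ss xs) →
           _⊒_ (𝒞ᵗ (FTy k l)) (curryFᶜ k l f mf) (curryFᶜ k l g mg)
curryFᶜ zero    l f m = curryXᶜ l (f [] []) (m tt tt)
curryFᶜ (suc k) l f m =
  (λ c → (λ s → curryFᶜ k l (λ Cs Ss → f (c ∷ Cs) (s ∷ Ss)) (λ p q → m ((λ _ → ≤-refl) , p) ((λ _ → ≤-refl) , q)))
       , (λ p → curryFᶜ⊒ k l _ _ _ _ (λ Cs Ss xs → m (Vec⊒-refl (ℕ≥ ⟹ ℕ≥) (c ∷ Cs)) (p , Vec⊒-refl (ℕ≥ ⟹ ℕ≥) Ss) (Vec⊒-refl ℕ≥ xs))))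
  , (λ p s → curryFᶜ⊒ k l _ _ _ _ (λ Cs Ss xs → m (p , Vec⊒-refl (ℕ≥ ⟹ ℕ≥) Cs) (Vec⊒-refl (ℕ≥ ⟹ ℕ≥) (s ∷ Ss)) (Vec⊒-refl ℕ≥ xs)))
curryFᶜ⊒ zero    l f g mf mg e = curryXᶜ⊒ l _ _ _ _ (e [] [])
curryFᶜ⊒ (suc k) l f g mf mg e = λ c s → curryFᶜ⊒ k l _ _ _ _ (λ Cs Ss → e (c ∷ Cs) (s ∷ Ss))

applyXˢ : ∀ l → Car (𝒮ᵗ (WTy l)) → Vec ℕ l → ℕ
applyXˢ zero    J []       = J
applyXˢ (suc l) J (x ∷ xs) = applyXˢ l (proj₁ J x) xs

applyFˢ : ∀ k l → Car (𝒮ᵗ (FTy k l)) → Vec Fun1 k → Vec ℕ l → ℕ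
applyFˢ zero    l J []       xs = applyXˢ l J xs
applyFˢ (suc k) l J (s ∷ Ss) xs = applyFˢ k l (proj₁ J s) Ss xs

apply-curryXˢ : ∀ l f (m : MonX l f) xs → applyXˢ l (curryXˢ l f m) xs ≡ f xs
apply-curryXˢ zero    f m []       = refl
apply-curryXˢ (suc l) f m (x ∷ xs) = apply-curryXˢ l _ _ xs

apply-curryFˢ : ∀ k l f (m : MonFˢ k l f) Ss xs → applyFˢ k l (curryFˢ k l f m) Ss xs ≡ f Ss xs
apply-curryFˢ zero    l f m []       xs = apply-curryXˢ l _ _ xs
apply-curryFˢ (suc k) l f m (s ∷ Ss) xs = apply-curryFˢ k l _ _ Ss xs

apply-curryXᶜ : ∀ l f (m : MonX l f) xs → applyW carrier l (curryXᶜ l f m) xs ≡ f xs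
apply-curryXᶜ zero    f m []       = refl
apply-curryXᶜ (suc l) f m (x ∷ xs) = apply-curryXᶜ l _ _ xs

apply-curryFᶜ : ∀ k l f (m : MonFᶜ k l f) Cs Ss xs → applyF carrier k l (curryFᶜ k l f m) Cs Ss xs ≡ f Cs Ss xs
apply-curryFᶜ zero    l f m []       []       xs = apply-curryXᶜ l _ _ xs
apply-curryFᶜ (suc k) l f m (c ∷ Cs) (s ∷ Ss) xs = apply-curryFᶜ k l _ _ Cs Ss xs

size𝔻 : 𝔻V → ℕ
size𝔻 nil          = 0
size𝔻 (cell a d)   = suc (size𝔻 d)
size𝔻 (tape f x y) = suc (keep (size𝔻 f) (size𝔻 x + size𝔻 y))
size𝔻 (tapes x y)  = suc (size𝔻 x + size𝔻 y)

-- Syntactic copies of the cost formulas. `GC` and `GS` act on expressions because the oracle bound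
-- is a sum over all oracles and not a single function symbol.
module SOPs {k l : ℕ} (P : SOP k l) (D c₀ : ℕ) {m n : ℕ} (GC GS : SOP m n → SOP m n) (XE : SOP m n) where
  open Clock P D

  pvalE : SOP k l → SOP m n
  pvalE (cst n)    = cst n
  pvalE (var j)    = XE
  pvalE (P ⊕ Q)    = pvalE P ⊕ pvalE Q
  pvalE (P ⊛ Q)    = pvalE P ⊛ pvalE Q
  pvalE (fapp j Q) = GS (pvalE Q)

  boundCostE : SOP k l → SOP m n → SOP m n
  boundCostE (cst n)    H = cst 0
  boundCostE (var j)    H = cst 0
  boundCostE (P ⊕ Q)    H = ((cst 1 ⊕ pvalE P) ⊕ boundCostE P H) ⊕ boundCostE Q H
  boundCostE (P ⊛ Q)    H = (((cst 1 ⊕ pvalE P) ⊛ (cst 2 ⊕ pvalE Q)) ⊕ boundCostE P H) ⊕ boundCostE Q H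
  boundCostE (fapp j Q) H =
    ((cst 1 ⊕ H) ⊛ (cst 1 ⊕ (((cst 1 ⊕ GS (pvalE Q)) ⊕ GC (pvalE Q)) ⊕ (cst 1 ⊕ pvalE Q)))) ⊕ boundCostE Q H

  perStepE : SOP m n → SOP m n
  perStepE S = (((cst 1 ⊕ boundCostE P S) ⊕ (cst 1 ⊕ pvalE P)) ⊕ (cst 2 ⊕ ((S ⊕ S) ⊕ S)))
               ⊕ ((cst (3 + (D + D + D)) ⊕ (S ⊕ S)) ⊕ (GS S ⊕ GC S))

  -- Second-order polynomials have no subtraction. None is needed here: the run starts with counter
  -- 0, where the number of remaining steps is `pvalE P` itself.
  runE : SOP m n
  runE = cst 1 ⊕ (((cst 1 ⊕ pvalE P) ⊛ perStepE ((cst c₀ ⊕ XE) ⊕ (pvalE P ⊛ cst K)))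
                  ⊕ ((XE ⊕ cst l) ⊕ (XE ⊕ cst l)))

  module _ (Fs : Vec (ℕ → ℕ) m) (xs : Vec ℕ n) (gc gs : ℕ → ℕ) (X : ℕ)
           (GC-eval : ∀ e → evalSOP (GC e) Fs xs ≡ gc (evalSOP e Fs xs))
           (GS-eval : ∀ e → evalSOP (GS e) Fs xs ≡ gs (evalSOP e Fs xs))
           (X-eval : evalSOP XE Fs xs ≡ X) where

    ⟦_⟧ : SOP m n → ℕ
    ⟦ e ⟧ = evalSOP e Fs xs

    pvalE-eval : ∀ P → ⟦ pvalE P ⟧ ≡ pval P gs X
    pvalE-eval (cst n)    = refl
    pvalE-eval (var j)    = X-eval
    pvalE-eval (P ⊕ Q)    = cong₂ _+_ (pvalE-eval P) (pvalE-eval Q)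
    pvalE-eval (P ⊛ Q)    = cong₂ _*_ (pvalE-eval P) (pvalE-eval Q)
    pvalE-eval (fapp j Q) = trans (GS-eval (pvalE Q)) (cong gs (pvalE-eval Q))

    boundCostE-eval : ∀ P H → ⟦ boundCostE P H ⟧ ≡ boundCost P gc gs X ⟦ H ⟧
    boundCostE-eval (cst n)    H = refl
    boundCostE-eval (var j)    H = refl
    boundCostE-eval (P ⊕ Q)    H =
      cong₂ _+_ (cong₂ _+_ (cong suc (pvalE-eval P)) (boundCostE-eval P H)) (boundCostE-eval Q H)
    boundCostE-eval (P ⊛ Q)    H = cong₂ _+_ (cong₂ _+_ (cong₂ _*_ (cong suc (pvalE-eval P))
      (cong (λ n → suc (suc n)) (pvalE-eval Q))) (boundCostE-eval P H)) (boundCostE-eval Q H)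
    boundCostE-eval (fapp j Q) H = cong₂ _+_ (cong (suc ⟦ H ⟧ *_) (cong suc (cong₂ _+_ (cong₂ _+_
      (cong suc (trans (GS-eval (pvalE Q)) (cong gs (pvalE-eval Q))))
      (trans (GC-eval (pvalE Q)) (cong gc (pvalE-eval Q)))) (cong suc (pvalE-eval Q))))) (boundCostE-eval Q H)

    perStepE-eval : ∀ S → ⟦ perStepE S ⟧ ≡ perStep gc gs X ⟦ S ⟧
    perStepE-eval S = cong₂ _+_ (cong₂ _+_ (cong₂ _+_ (cong suc (boundCostE-eval P S)) (cong suc (pvalE-eval P))) refl)
      (cong₂ _+_ {x = 3 + (D + D + D) + (⟦ S ⟧ + ⟦ S ⟧)} refl (cong₂ _+_ (GS-eval S) (GC-eval S)))

    runE-eval : ⟦ runE ⟧ ≡ suc (execCost gc gs X 0 (c₀ + X) + (X + l + (X + l)))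
    runE-eval = cong suc (cong₂ _+_ (cong₂ _*_ (cong suc (pvalE-eval P))
        (trans (perStepE-eval ((cst c₀ ⊕ XE) ⊕ (pvalE P ⊛ cst K)))
          (cong (perStep gc gs X) (cong₂ _+_ (cong (c₀ +_) X-eval) (cong (_* K) (pvalE-eval P))))))
      (cong₂ _+_ (cong (_+ l) X-eval) (cong (_+ l) X-eval)))

-- `c` is 0 for sizes and 1 for costs, where every oracle adds the price of one `combᵘ` step.
sumFapps : ∀ {m n j} → ℕ → Vec (Fin m) j → SOP m n → SOP m n
sumFapps c []       e = cst 0
sumFapps c (p ∷ ps) e = cst c ⊕ (fapp p e ⊕ sumFapps c ps e)

sumFapps-size : ∀ {m n j} (ps : Vec (Fin m) j) (Ss : Vec Fun1 j) Fs (xs : Vec ℕ n) →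
                (∀ q → lookup Fs (lookup ps q) ≡ proj₁ (lookup Ss q)) →
                ∀ e → evalSOP (sumFapps 0 ps e) Fs xs ≡ combSize Ss (evalSOP e Fs xs)
sumFapps-size []       []       Fs xs eq e = refl
sumFapps-size (p ∷ ps) (s ∷ Ss) Fs xs eq e =
  cong₂ _+_ (cong (λ f → f (evalSOP e Fs xs)) (eq zero)) (sumFapps-size ps Ss Fs xs (eq ∘ suc) e)

sumFapps-cost : ∀ {m n j} (ps : Vec (Fin m) j) (Cs : Vec Fun1 j) Fs (xs : Vec ℕ n) →
                (∀ q → lookup Fs (lookup ps q) ≡ proj₁ (lookup Cs q)) →
                ∀ e → evalSOP (sumFapps 1 ps e) Fs xs ≡ combCost Cs (evalSOP e Fs xs)
sumFapps-cost []       []       Fs xs eq e = refl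
sumFapps-cost (p ∷ ps) (c ∷ Cs) Fs xs eq e =
  cong suc (cong₂ _+_ (cong (λ f → f (evalSOP e Fs xs)) (eq zero)) (sumFapps-cost ps Cs Fs xs (eq ∘ suc) e))

sumVars : ∀ {m n j} → Vec (Fin n) j → SOP m n
sumVars []       = cst 0
sumVars (p ∷ ps) = var p ⊕ sumVars ps

sumVars-eval : ∀ {m n j} (ps : Vec (Fin n) j) ys (Fs : Vec (ℕ → ℕ) m) (xs : Vec ℕ n) →
               (∀ q → lookup xs (lookup ps q) ≡ lookup ys q) → evalSOP (sumVars ps) Fs xs ≡ sumV ys
sumVars-eval []       []       Fs xs eq = refl
sumVars-eval (p ∷ ps) (y ∷ ys) Fs xs eq = cong₂ _+_ (eq zero) (sumVars-eval ps ys Fs xs (eq ∘ suc))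

module Final {k l : ℕ} (M : OTM k) (P : SOP k l) where
  open OTM M using (nWork; start; δ; nAux; nStates)
  open Construction M P
  open Codes {nAux}
  open Terms {k} {l}

  -- A transition outcome has one cell for the control and one for each of the 1 + k + k + `nWork`
  -- actions. In `c₀` the 2 stands for the main tape and the list node holding it, and l bounds the
  -- number of separators in the input.
  D c₀ : ℕ
  D  = suc (suc (k + (k + nWork)))
  c₀ = 2 + size𝔻 (tapesV blankTapes) + l

  open Clock P D

  -- Besides the run itself, X + l pays for concatenating the inputs and another X + l for writing
  -- them on the main tape.
  total : (gc gs : ℕ → ℕ) → ℕ → ℕ
  total gc gs X = suc (execCost gc gs X 0 (c₀ + X) + (X + l + (X + l)))

  total-mono : ∀ {gc gc′ gs gs′ X X′} → Mon gc → Mon gs → gc ≥¹ gc′ → gs ≥¹ gs′ → X ≥ X′ →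
               total gc gs X ≥ total gc′ gs′ X′
  total-mono mc ms pc ps px = s≤s (+-mono-≤ (execCost-mono mc ms pc ps px (≤-refl {0}) (+-monoʳ-≤ c₀ px))
    (+-mono-≤ (+-monoˡ-≤ l px) (+-monoˡ-≤ l px)))

  totalˢ : Vec Fun1 k → Vec ℕ l → ℕ
  totalˢ Ss xs = total zero¹ (combSize Ss) (sumV xs)

  totalᶜ : Vec Fun1 k → Vec Fun1 k → Vec ℕ l → ℕ
  totalᶜ Cs Ss xs = total (combCost Cs) (combSize Ss) (sumV xs)

  totalˢ-mono : MonFˢ k l totalˢ
  totalˢ-mono {Ss} q r = total-mono (λ _ → z≤n) (combSize-mon Ss) (λ _ → z≤n) (combSize-mono q) (sumV-mono r)

  totalᶜ-mono : MonFᶜ k l totalᶜ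
  totalᶜ-mono {Cs} {_} {Ss} p q r =
    total-mono (combCost-mon Cs) (combSize-mon Ss) (combCost-mono p) (combSize-mono q) (sumV-mono r)

  open Interpretation P D
  open Interp P D (curryFˢ k l totalˢ totalˢ-mono) (curryFᶜ k l totalᶜ totalᶜ-mono)

  Sb : Sort 3 → QO
  Sb = sortQO carrier

  module _ {Γ : List (Ty 3)} (α : ∀ {σ} → Var Γ σ → Car (𝒮ᵗ σ)) (ζ : ∀ {σ} → Var Γ σ → Car (𝒞ᵗ σ)) where

    sizeT : ∀ {σ} → RTm Γ σ → Car (𝒮ᵗ σ)
    sizeT = size Sb Js Jc α ζ
    costT : ∀ {σ} → RTm Γ σ → Car (𝒞ᵗ σ)
    costT = cost Sb Js Jc α ζ
    sumT : ∀ {σ} → RTm Γ σ → ℕ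
    sumT = sumCost Sb Js Jc α ζ

    size-𝔻 : ∀ v → sizeT 𝔻⟦ v ⟧ ≡ size𝔻 v
    size-𝔻 nil          = refl
    size-𝔻 (cell a d)   = cong suc (size-𝔻 d)
    size-𝔻 (tape f x y) = cong suc (cong₂ keep (size-𝔻 f) (cong₂ _+_ (size-𝔻 x) (size-𝔻 y)))
    size-𝔻 (tapes x y)  = cong suc (cong₂ _+_ (size-𝔻 x) (size-𝔻 y))

    sum-𝔻 : ∀ v → sumT 𝔻⟦ v ⟧ ≡ 0
    sum-𝔻 nil          = refl
    sum-𝔻 (cell a d)   = cong₂ _+_ (sum-numeral α ζ a) (sum-𝔻 d)
    sum-𝔻 (tape f x y) = cong₂ _+_ (cong₂ _+_ (sum-𝔻 f) (sum-𝔻 x)) (sum-𝔻 y)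
    sum-𝔻 (tapes x y)  = cong₂ _+_ (sum-𝔻 x) (sum-𝔻 y)

    cost-applyX : ∀ l′ t (xv : Vec (Var Γ 𝕎) l′) →
                  costT (applyX l′ t (vmap var xv)) ≡ applyW carrier l′ (costT t) (vmap α xv)
    cost-applyX zero     t []       = refl
    cost-applyX (suc l′) t (x ∷ xv) = cost-applyX l′ (t · var x) xv

    cost-applyFX : ∀ k′ l′ t (fv : Vec (Var Γ 𝕎𝕎) k′) (xv : Vec (Var Γ 𝕎) l′) →
                   costT (applyFX k′ l′ t (vmap var fv) (vmap var xv)) ≡
                   applyF carrier k′ l′ (costT t) (vmap ζ fv) (vmap α fv) (vmap α xv)
    cost-applyFX zero     l′ t []       xv = cost-applyX l′ t xv
    cost-applyFX (suc k′) l′ t (f ∷ fv) xv = cost-applyFX k′ l′ (t · var f) fv xv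

    size-applyX : ∀ l′ t (xv : Vec (Var Γ 𝕎) l′) →
                  sizeT (applyX l′ t (vmap var xv)) ≡ applyXˢ l′ (sizeT t) (vmap α xv)
    size-applyX zero     t []       = refl
    size-applyX (suc l′) t (x ∷ xv) = size-applyX l′ (t · var x) xv

    size-applyFX : ∀ k′ l′ t (fv : Vec (Var Γ 𝕎𝕎) k′) (xv : Vec (Var Γ 𝕎) l′) →
                   sizeT (applyFX k′ l′ t (vmap var fv) (vmap var xv)) ≡
                   applyFˢ k′ l′ (sizeT t) (vmap α fv) (vmap α xv)
    size-applyFX zero     l′ t []       xv = size-applyX l′ t xv
    size-applyFX (suc k′) l′ t (f ∷ fv) xv = size-applyFX k′ l′ (t · var f) fv xv

    size-combs : ∀ {j} (fv : Vec (Var Γ 𝕎𝕎) j) n → val (sizeT (combs (vmap var fv))) n ≡ combSize (vmap α fv) n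
    size-combs []       n = refl
    size-combs (f ∷ fv) n = cong (proj₁ (α f) n +_) (size-combs fv n)

    cost-combs : ∀ {j} (fv : Vec (Var Γ 𝕎𝕎) j) n → val (costT (combs (vmap var fv))) n ≡ combCost (vmap ζ fv) n
    cost-combs []       n = refl
    cost-combs (f ∷ fv) n = cong (λ c → suc (proj₁ (ζ f) n + c)) (cost-combs fv n)

    sum-combs : ∀ {j} (fv : Vec (Var Γ 𝕎𝕎) j) → sumT (combs (vmap var fv)) ≡ 0
    sum-combs []       = refl
    sum-combs (f ∷ fv) = sum-combs fv

    size-adds : ∀ {j} (xv : Vec (Var Γ 𝕎) j) → sizeT (adds (vmap var xv)) ≡ sumV (vmap α xv)
    size-adds []       = refl
    size-adds (x ∷ xv) = cong (α x +_) (size-adds xv)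

    sum-adds : ∀ {j} (xv : Vec (Var Γ 𝕎) j) → sumT (adds (vmap var xv)) ≡ sumV (vmap α xv) + j
    sum-adds []               = refl
    sum-adds {suc j} (x ∷ xv) = trans (cong (suc (α x) + 0 +_) (sum-adds xv)) (arith (α x) (sumV (vmap α xv)) j)
      where
      arith : ∀ a s j → suc a + 0 + (s + j) ≡ a + s + suc j
      arith = solve-∀

    size-encs : ∀ {j} (xv : Vec (Var Γ 𝕎) j) → sizeT (encs (vmap var xv)) ≤ sumV (vmap α xv) + j
    size-encs []           = z≤n
    size-encs (x ∷ [])     = m≤m+n _ 1
    size-encs {suc j} (x ∷ y ∷ xv) = ≤-trans (+-monoʳ-≤ (α x) (s≤s (size-encs (y ∷ xv))))
      (≤-reflexive (arith (α x) (sumV (vmap α (y ∷ xv))) j))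
      where
      arith : ∀ a s j → a + suc (s + j) ≡ a + s + suc j
      arith = solve-∀

    sum-encs : ∀ {j} (xv : Vec (Var Γ 𝕎) j) → sumT (encs (vmap var xv)) ≡ sumV (vmap α xv) + j
    sum-encs []           = refl
    sum-encs (x ∷ [])     = arith (α x)
      where
      arith : ∀ a → suc a + 0 + 0 ≡ a + 0 + 1
      arith = solve-∀
    sum-encs {suc j} (x ∷ y ∷ xv) = trans (cong (suc (α x) + 0 +_) (sum-encs (y ∷ xv)))
      (arith (α x) (sumV (vmap α (y ∷ xv))) j)
      where
      arith : ∀ a s j → suc a + 0 + (s + j) ≡ a + s + suc j
      arith = solve-∀

  compatible-F : Compatible Sb Js Jc ruleF
  compatible-F α ζ =
    ≤-trans cost-≤ (≤-reflexive (≡sym (trans (cost-applyFX α ζ k l (sym F) varsF varsX)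
      (apply-curryFᶜ k l totalᶜ totalᶜ-mono (vmap ζ varsF) (vmap α varsF) (vmap α varsX)))))
    , ≤-trans size-≤ (≤-reflexive (≡sym (trans (size-applyFX α ζ k l (sym F) varsF varsX)
      (apply-curryFˢ k l totalˢ totalˢ-mono (vmap α varsF) (vmap α varsX)))))
    where
    X = sumV (vmap α varsX)
    G = combs (vmap var varsF)
    A = adds (vmap var varsX)
    E = encs (vmap var varsX)
    B = tapesV blankTapes

    T-size : suc (suc (sizeT α ζ E) + sizeT α ζ 𝔻⟦ B ⟧) ≤ c₀ + X
    T-size = ≤-trans (≤-reflexive (cong (λ b → suc (suc (sizeT α ζ E) + b)) (size-𝔻 α ζ B)))
      (≤-trans (s≤s (s≤s (+-monoˡ-≤ (size𝔻 B) (size-encs α ζ varsX)))) (≤-reflexive (arith X l (size𝔻 B))))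
      where
      arith : ∀ x l b → suc (suc (x + l + b)) ≡ 2 + b + l + x
      arith = solve-∀

    E₀ = execCost (val (costT α ζ G)) (val (sizeT α ζ G)) (sizeT α ζ A) 0 (suc (suc (sizeT α ζ E) + sizeT α ζ 𝔻⟦ B ⟧))
    C₀ = sumT α ζ 𝕊⟦ ctrlV (run start) ⟧

    args-sum : sumT α ζ G + sumT α ζ A + 0 + C₀ + 0 ≡ X + l
    args-sum = trans (+-identityʳ _) (trans (cong₂ _+_ (cong₂ (λ g a → g + a + 0) (sum-combs α ζ varsF) (sum-adds α ζ varsX))
      (sum-numeral α ζ (ctrlV (run start)))) (arith X l))
      where
      arith : ∀ x l → 0 + (x + l) + 0 + 0 ≡ x + l
      arith = solve-∀

    cost-≤ : suc (E₀ + (sumT α ζ G + sumT α ζ A + 0 + C₀ + 0) + (sumT α ζ E + sumT α ζ 𝔻⟦ B ⟧))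
             ≤ totalᶜ (vmap ζ varsF) (vmap α varsF) (vmap α varsX)
    cost-≤ = s≤s (≤-trans (≤-reflexive (+-assoc E₀ (sumT α ζ G + sumT α ζ A + 0 + C₀ + 0) (sumT α ζ E + sumT α ζ 𝔻⟦ B ⟧)))
      (+-mono-≤
        (execCost-mono (combCost-mon (vmap ζ varsF)) (combSize-mon (vmap α varsF))
          (λ n → ≤-reflexive (cost-combs α ζ varsF n)) (λ n → ≤-reflexive (size-combs α ζ varsF n))
          (≤-reflexive (size-adds α ζ varsX)) (≤-refl {0}) T-size)
        (≤-reflexive (cong₂ _+_ args-sum
          (trans (cong₂ _+_ (sum-encs α ζ varsX) (sum-𝔻 α ζ B)) (+-identityʳ (X + l)))))))

    size-≤ : execCost zero¹ (val (sizeT α ζ G)) (sizeT α ζ A) 0 (suc (suc (sizeT α ζ E) + sizeT α ζ 𝔻⟦ B ⟧))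
             ≤ totalˢ (vmap α varsF) (vmap α varsX)
    size-≤ = ≤-trans (execCost-mono (λ _ → z≤n) (combSize-mon (vmap α varsF)) (λ _ → z≤n)
        (λ n → ≤-reflexive (size-combs α ζ varsF n)) (≤-reflexive (size-adds α ζ varsX)) (≤-refl {0}) T-size)
      (≤-trans (m≤m+n _ _) (n≤1+n _))

  size-acts : ∀ as → size𝔻 (actsV as) ≡ length as
  size-acts []       = refl
  size-acts (a ∷ as) = cong suc (size-acts as)

  -- Every outcome lists one action per tape, which justifies the constant size of `deltaᵘ`.
  size-outcome : ∀ x → size𝔻 (outcome x) ≡ D
  size-outcome (s , b , vw , vq , va) with δ s b vw vq va
  ... | c , a , aw , aq , aa = cong suc (trans (size-acts (a ∷ toList aq ++ (toList aa ++ toList aw))) (cong suc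
    (trans (length-++ (toList aq)) (cong₂ _+_ (length-toList aq)
      (trans (length-++ (toList aa)) (cong₂ _+_ (length-toList aa) (length-toList aw)))))))

  compatible-delta : ∀ x → Compatible Sb Js Jc (deltaRule x)
  compatible-delta x α ζ = ≤-reflexive (cong suc (sum-𝔻 α ζ (outcome x)))
                         , ≤-reflexive (trans (size-𝔻 α ζ (outcome x)) (size-outcome x))

  compatible-all : ∀ rs xs → All (Compatible Sb Js Jc) (ruleF ∷ (map ruleOf rs ++ map deltaRule xs))
  compatible-all rs xs = compatible-F ∷ Allₚ.++⁺
    (all-map ruleOf rs (λ {r} _ → compatible-raw r))
    (all-map deltaRule xs (λ {x} _ → compatible-delta x))

  costPs sizePs : Vec (Fin (k + k)) k
  costPs = tabulate (_↑ˡ k)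
  sizePs = tabulate (k ↑ʳ_)

  XE : SOP (k + k) l
  XE = sumVars (vallFin l)

  open SOPs P D c₀ (sumFapps 1 costPs) (sumFapps 0 sizePs) XE using (runE-eval) renaming (runE to boundE)

  module _ (Cs Ss : Vec Fun1 k) (xs : Vec ℕ l) where

    Fs : Vec (ℕ → ℕ) (k + k)
    Fs = vmap proj₁ (Cs v++ Ss)

    cost-lookup : ∀ q → lookup Fs (lookup costPs q) ≡ proj₁ (lookup Cs q)
    cost-lookup q = trans (cong (lookup Fs) (lookup∘tabulate (_↑ˡ k) q))
      (trans (lookup-map (q ↑ˡ k) proj₁ (Cs v++ Ss)) (cong proj₁ (lookup-++ˡ Cs Ss q)))

    size-lookup : ∀ q → lookup Fs (lookup sizePs q) ≡ proj₁ (lookup Ss q)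
    size-lookup q = trans (cong (lookup Fs) (lookup∘tabulate (k ↑ʳ_) q))
      (trans (lookup-map (k ↑ʳ q) proj₁ (Cs v++ Ss)) (cong proj₁ (lookup-++ʳ Cs Ss q)))

    boundF-eval : totalᶜ Cs Ss xs ≡ evalSOP boundE Fs xs
    boundF-eval = ≡sym (runE-eval Fs xs (combCost Cs) (combSize Ss) (sumV xs)
      (sumFapps-cost costPs Cs Fs xs cost-lookup) (sumFapps-size sizePs Ss Fs xs size-lookup)
      (sumVars-eval (vallFin l) xs Fs xs (λ q → cong (lookup xs) (lookup-allFin q))))

  interpretation : PolyBoundedInterp R
  interpretation = record
    { extraQO    = carrier
    ; Js         = Js
    ; Jc         = Jc
    ; compatible = λ {ρ} m → All.lookup (compatible-all allRuleNames allInputs) m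
    ; cost-o     = refl
    ; cost-i     = refl
    ; cost-nil   = refl
    ; cost-cons  = λ _ _ → refl
    ; c          = 1
    ; 1≤c        = ≤-refl
    ; size-cons  = λ _ _ → refl
    ; P          = boundE
    ; boundF     = λ Cs Ss xs → ≤-reflexive
        (trans (apply-curryFᶜ k l totalᶜ totalᶜ-mono Cs Ss xs) (boundF-eval Cs Ss xs))
    }

theorem6p3 : ∀ {k l : ℕ} (Ψ : Functional k l) → BFF₂ Ψ →
    Σ (STRS k l) λ R → Orthogonal (rules R) × Computes R Ψ × PolyBoundedInterp R
theorem6p3 Ψ (M , P , halts) =
  Construction.R M P , Construction.orthogonal M P , computes M P Ψ halts , Final.interpretation M P
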